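{- Fix any integer $k > 1$ with at most two prime factors. (1) If $k$ is odd, then every integer $n \geq 36$ can be written as $n = p + \eta$ for some prime $p < n$ and some $\eta \in \mathbb{S}_k$. (2) If $k$ is even, then every even integer $n \geq 36$ can be written as $n = p + \eta$ for some prime $p < n$ and some $\eta \in \mathbb{S}_k$.
   Context: $\mathbb{S}$ denotes the set of all positive square-free integers (including $1$), and for an integer $k$, $\mathbb{S}_k = \{s \in \mathbb{S} : (s,k) = 1\}$ is the set of positive square-free integers co-prime to $k$, where $(a,b)$ denotes the greatest common divisor. -}

module Defs where

open import Data.List.Base using (filter; length; upTo)
open import Data.Nat.Base using (ℕ; suc; _+_; _*_; _<_)
open import Data.Nat.Divisibility using (_∣_; _∣?_)
open import Data.Nat.GCD using (gcd)
open import Data.Nat.Primality using (Prime; prime?)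
open import Data.Product.Base using (_×_; ∃-syntax)
open import Level using (0ℓ)
open import Relation.Binary.PropositionalEquality.Core using (_≡_)
open import Relation.Nullary.Decidable using (_×-dec_)
open import Relation.Unary using (Pred; _∈_)

SquareFree : Pred ℕ 0ℓ
SquareFree n = ∀ {d} → d * d ∣ n → d ≡ 1

𝕊 : Pred ℕ 0ℓ
𝕊 s = 0 < s × SquareFree s

𝕊[_] : ℕ → Pred ℕ 0ℓ
𝕊[ k ] s = s ∈ 𝕊 × gcd s k ≡ 1

-- The number of distinct primes dividing k, for k ≥ 1: upTo (suc k) lists
-- 0, …, k, and no divisor of such a k exceeds k.
ω : ℕ → ℕ
ω k = length (filter (λ p → prime? p ×-dec p ∣? k) (upTo (suc k)))

IsPrimePlus𝕊[_] : ℕ → Pred ℕ 0ℓ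
IsPrimePlus𝕊[ k ] n =
  ∃[ p ] ∃[ η ] Prime p × p < n × η ∈ 𝕊[ k ] × n ≡ p + η

{-# OPTIONS --safe #-}
module Submission where

-- It suffices to find, for primes a and b, a prime p such that η = n − p is square-free and prime to a b
-- (except that nothing is asked about 2 ∣ η when n is odd).
--
-- For n ≥ 2²² take p in a fixed class c modulo M = 12, or M = 60 if 5 ∈ {a, b}, chosen such that 3, 4
-- (and 5) do not divide η.  As in Chebyshev's proof, the product of the j ≤ x in such a class, which is
-- about M^(x/M) (x/M)!, is compared with factorials and with the products for x/μ, where μ runs over
-- small residues; this bounds the product of the primes in the class from below.  If q ∣ η or r² ∣ η,
-- then p lies in a single class modulo M q or M r², and the product of such primes is bounded from above
-- in the same way.  If every p ≡ c were excluded, the upper bounds would have to add up to the lower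
-- bound, but with explicit constants they do not.
--
-- For n < 2²², consider four small primes p in one class modulo 12 whose differences are of the form
-- 2^i 3^j, the class being such that 3 ∤ n − p.  A prime other than 2 divides at most one of the numbers
-- n − p, so three primes p with n − p square-free are enough.  A sieve by squares finds the n for which
-- two of the four fail, and other primes in the same class settle these.

open import Defs
open import Data.Bool.Base using (Bool; true; false; if_then_else_; _∨_; _∧_; not; T)
open import Data.Bool.Properties using () renaming (_≟_ to _≟ᵇ_)
open import Data.Empty using (⊥; ⊥-elim)
open import Data.List.Base using (List; []; _∷_; map; length; filter; filterᵇ; foldr; upTo)
open import Data.List.Membership.Propositional using (_∈_)
open import Data.List.Membership.Propositional.Properties using (∈-filter⁻; ∈-filter⁺; ∈-upTo⁺)
open import Data.List.Properties using (filter-all; filter-accept; filter-reject)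
open import Data.List.Relation.Unary.All as All using (All; []; _∷_)
open import Data.List.Relation.Unary.AllPairs as AllPairs using (AllPairs; []; _∷_)
open import Data.List.Relation.Unary.AllPairs.Properties as AllPairs using ()
open import Data.List.Relation.Unary.Any as Any using (Any; here; there)
open import Data.Nat.Base
open import Data.Nat.Coprimality using (Coprime; coprime-divisor; coprime-Bézout) renaming (sym to coprime-sym)
open import Data.Nat.DivMod
open import Data.Nat.Divisibility
open import Data.Nat.GCD using (gcd; gcd[m,n]∣m; gcd[m,n]∣n; module Bézout)
open import Data.Nat.ListAction using (sum; product)
open import Data.Nat.Primality
open import Data.Nat.Primality.Factorisation using (factorise; module PrimeFactorisation)
open import Data.Nat.Properties
open import Data.List.Membership.DecPropositional _≟_ using (_∈?_)
open import Data.Nat.Solver using (module +-*-Solver)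
open import Data.Product.Base using (_×_; _,_; ∃; ∃-syntax; proj₁; proj₂)
open import Data.Sum.Base using (_⊎_; inj₁; inj₂; swap; [_,_]′)
open import Function.Base using (_∘_)
open import Relation.Binary.PropositionalEquality
open import Relation.Nullary
open import Relation.Nullary.Decidable using (decidable-stable; _×-dec_)

-- Real logarithms are avoided. Products are recorded by the exponents of their primes (`ℰ`), so
-- that two products are compared one prime at a time; sizes are compared through integer bounds for
-- 1000 log₂ (`≼`, `≽`), and weights are fractions with denominator `Q` = 10⁶. In thousandths of a
-- bit, per unit of N ≈ n / 12, the usable primes p ≡ c mod 12 amount to at least about 3026.
-- Avoiding 7 costs about 1241, 11 costs 849, 25 costs 424, and all squares of primes from 11 on
-- cost less than 510 together. Avoiding 5 in the same way would cost 1656, so that 5, 7 and the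
-- squares would exceed the supply; this is why a class modulo 60 has to exclude 5 by itself. What
-- is left over, at least 95 modulo 12 and 505 modulo 60, must beat error terms of order √n log n,
-- and does so from 2²² on. The number 121 = 11² separates small from large primes (`y₀` = N / 121 +
-- 1): above it the residue inequality is checked by evaluation, and the squares r² ≥ 121 need only
-- one application of the upper bound.

private variable
  Φ Ψ : Set

-- Indicators, finite sums and finite products

opaque
  𝟙 : Dec Φ → ℕ
  𝟙 d = if does d then 1 else 0

  𝟙-yes : (d : Dec Φ) → Φ → 𝟙 d ≡ 1
  𝟙-yes (yes _) p = refl
  𝟙-yes (no ¬p) p = contradiction p ¬p

  𝟙-no : (d : Dec Φ) → ¬ Φ → 𝟙 d ≡ 0
  𝟙-no (yes p) ¬p = contradiction p ¬p
  𝟙-no (no _) ¬p = refl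

  𝟙≤1 : (d : Dec Φ) → 𝟙 d ≤ 1
  𝟙≤1 (yes _) = ≤-refl
  𝟙≤1 (no _) = z≤n

  𝟙-mono : (d : Dec Φ) (e : Dec Ψ) → (Φ → Ψ) → 𝟙 d ≤ 𝟙 e
  𝟙-mono (yes p) e h = ≤-reflexive (sym (𝟙-yes e (h p)))
  𝟙-mono (no _) e h = z≤n

𝟙-cong : (d : Dec Φ) (e : Dec Ψ) → (Φ → Ψ) → (Ψ → Φ) → 𝟙 d ≡ 𝟙 e
𝟙-cong d e h k = ≤-antisym (𝟙-mono d e h) (𝟙-mono e d k)

-- Indices start at 1: exponents, multiples and the factors of a product are all positive.
∑ : ℕ → (ℕ → ℕ) → ℕ
∑ zero f = 0
∑ (suc n) f = ∑ n f + f (suc n)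

∏ : ℕ → (ℕ → ℕ) → ℕ
∏ zero f = 1
∏ (suc n) f = ∏ n f * f (suc n)

∑-mono : ∀ {f g : ℕ → ℕ} n → (∀ i → 1 ≤ i → i ≤ n → f i ≤ g i) → ∑ n f ≤ ∑ n g
∑-mono zero h = z≤n
∑-mono (suc n) h = +-mono-≤ (∑-mono n λ i 1≤i i≤n → h i 1≤i (m≤n⇒m≤1+n i≤n)) (h (suc n) (s≤s z≤n) ≤-refl)

∑-cong : ∀ {f g : ℕ → ℕ} n → (∀ i → 1 ≤ i → i ≤ n → f i ≡ g i) → ∑ n f ≡ ∑ n g
∑-cong zero h = refl
∑-cong (suc n) h = cong₂ _+_ (∑-cong n λ i 1≤i i≤n → h i 1≤i (m≤n⇒m≤1+n i≤n)) (h (suc n) (s≤s z≤n) ≤-refl)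

∏-mono : ∀ {f g : ℕ → ℕ} n → (∀ i → 1 ≤ i → i ≤ n → f i ≤ g i) → ∏ n f ≤ ∏ n g
∏-mono zero h = ≤-refl
∏-mono (suc n) h = *-mono-≤ (∏-mono n λ i 1≤i i≤n → h i 1≤i (m≤n⇒m≤1+n i≤n)) (h (suc n) (s≤s z≤n) ≤-refl)

∏-cong : ∀ {f g : ℕ → ℕ} n → (∀ i → 1 ≤ i → i ≤ n → f i ≡ g i) → ∏ n f ≡ ∏ n g
∏-cong zero h = refl
∏-cong (suc n) h = cong₂ _*_ (∏-cong n λ i 1≤i i≤n → h i 1≤i (m≤n⇒m≤1+n i≤n)) (h (suc n) (s≤s z≤n) ≤-refl)

∑-zero : ∀ n → ∑ n (λ _ → 0) ≡ 0
∑-zero zero = refl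
∑-zero (suc n) = trans (+-identityʳ _) (∑-zero n)

∑-const : ∀ n c → ∑ n (λ _ → c) ≡ n * c
∑-const zero c = refl
∑-const (suc n) c = trans (cong (_+ c) (∑-const n c)) (+-comm (n * c) c)

∑-+ : ∀ n f g → ∑ n (λ i → f i + g i) ≡ ∑ n f + ∑ n g
∑-+ zero f g = refl
∑-+ (suc n) f g rewrite ∑-+ n f g =
  solve 4 (λ a b c d → (a :+ b) :+ (c :+ d) := (a :+ c) :+ (b :+ d)) refl (∑ n f) (∑ n g) (f (suc n)) (g (suc n))
  where open +-*-Solver

∏-* : ∀ n f g → ∏ n (λ i → f i * g i) ≡ ∏ n f * ∏ n g
∏-* zero f g = refl
∏-* (suc n) f g rewrite ∏-* n f g =
  solve 4 (λ a b c d → (a :* b) :* (c :* d) := (a :* c) :* (b :* d)) refl (∏ n f) (∏ n g) (f (suc n)) (g (suc n))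
  where open +-*-Solver

∑-*ˡ : ∀ n c f → ∑ n (λ i → c * f i) ≡ c * ∑ n f
∑-*ˡ zero c f = sym (*-zeroʳ c)
∑-*ˡ (suc n) c f rewrite ∑-*ˡ n c f = sym (*-distribˡ-+ c (∑ n f) (f (suc n)))

∑-swap : ∀ m n (f : ℕ → ℕ → ℕ) → ∑ m (λ i → ∑ n (f i)) ≡ ∑ n (λ j → ∑ m (λ i → f i j))
∑-swap zero n f = sym (∑-zero n)
∑-swap (suc m) n f = trans (cong (_+ ∑ n (f (suc m))) (∑-swap m n f)) (sym (∑-+ n _ _))

∑-split : ∀ m n f → ∑ (m + n) f ≡ ∑ m f + ∑ n (λ i → f (m + i))
∑-split m zero f rewrite +-identityʳ m = sym (+-identityʳ _)
∑-split m (suc n) f rewrite +-suc m n | ∑-split m n f = +-assoc (∑ m f) _ _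

∑-monoˡ : ∀ {m n} f → m ≤ n → ∑ m f ≤ ∑ n f
∑-monoˡ {m} f m≤n with m≤n⇒∃[o]m+o≡n m≤n
... | k , refl = ≤-trans (m≤m+n _ _) (≤-reflexive (sym (∑-split m k f)))

∑-term : ∀ n f k → 1 ≤ k → k ≤ n → f k ≤ ∑ n f
∑-term n f (suc k) 1≤k k≤n = ≤-trans (m≤n+m _ (∑ k f)) (∑-monoˡ f k≤n)

∑-none : ∀ {f : ℕ → ℕ} n → (∀ i → 1 ≤ i → i ≤ n → f i ≡ 0) → ∑ n f ≡ 0
∑-none n h = trans (∑-cong n h) (∑-zero n)

∑-𝟙≟ : ∀ n k → 1 ≤ k → k ≤ n → ∑ n (λ i → 𝟙 (i ≟ k)) ≡ 1
∑-𝟙≟ zero k 1≤k k≤n = contradiction (≤-trans 1≤k k≤n) λ ()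
∑-𝟙≟ (suc n) k 1≤k k≤n with m≤n⇒m<n∨m≡n k≤n
... | inj₁ k<1+n = cong₂ _+_ (∑-𝟙≟ n k 1≤k (≤-pred k<1+n)) (𝟙-no (suc n ≟ k) (<⇒≢ k<1+n ∘ sym))
... | inj₂ refl = cong₂ _+_ (∑-none n λ i _ i≤n → 𝟙-no (i ≟ suc n) (<⇒≢ (s≤s i≤n))) (𝟙-yes (suc n ≟ suc n) refl)

∏-1 : ∀ {f : ℕ → ℕ} n → (∀ i → 1 ≤ i → i ≤ n → f i ≡ 1) → ∏ n f ≡ 1
∏-1 zero h = refl
∏-1 (suc n) h = cong₂ _*_ (∏-1 n λ i 1≤i i≤n → h i 1≤i (m≤n⇒m≤1+n i≤n)) (h (suc n) (s≤s z≤n) ≤-refl)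

∏-split : ∀ m n f → ∏ (m + n) f ≡ ∏ m f * ∏ n (λ i → f (m + i))
∏-split m zero f rewrite +-identityʳ m = sym (*-identityʳ _)
∏-split m (suc n) f rewrite +-suc m n | ∏-split m n f = *-assoc (∏ m f) _ _

∏-pos : ∀ {f : ℕ → ℕ} n → (∀ i → 1 ≤ i → i ≤ n → 1 ≤ f i) → 1 ≤ ∏ n f
∏-pos n h = ≤-trans (≤-reflexive (sym (∏-1 n λ _ _ _ → refl))) (∏-mono n h)

∏-monoˡ : ∀ {f : ℕ → ℕ} {m n} → m ≤ n → (∀ i → 1 ≤ i → i ≤ n → 1 ≤ f i) → ∏ m f ≤ ∏ n f
∏-monoˡ {f} {m} m≤n h with m≤n⇒∃[o]m+o≡n m≤n
... | k , refl = begin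
  ∏ m f                          ≡⟨ *-identityʳ _ ⟨
  ∏ m f * 1                      ≤⟨ *-monoʳ-≤ (∏ m f) (∏-pos k λ i 1≤i i≤k → h (m + i) (≤-trans 1≤i (m≤n+m i m)) (+-monoʳ-≤ m i≤k)) ⟩
  ∏ m f * ∏ k (λ i → f (m + i))  ≡⟨ ∏-split m k f ⟨
  ∏ (m + k) f                    ∎
  where open ≤-Reasoning

-- Truncated quotients

-- Division by 0 gives 0.
infixl 7 _÷_
_÷_ : ℕ → ℕ → ℕ
n ÷ zero = 0
n ÷ suc d = n / suc d

÷≡/ : ∀ n d .{{_ : NonZero d}} → n ÷ d ≡ n / d
÷≡/ n (suc d) = refl

[s+qd]/d≡q : ∀ s q d .{{_ : NonZero d}} → s < d → (s + q * d) / d ≡ q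
[s+qd]/d≡q s q d s<d = begin
  (s + q * d) / d      ≡⟨ +-distrib-/-∣ʳ s (n∣m*n q) ⟩
  s / d + q * d / d    ≡⟨ cong₂ _+_ (m<n⇒m/n≡0 s<d) (m*n/n≡m q d) ⟩
  q                    ∎
  where open ≡-Reasoning

÷-zeroˡ : ∀ d → 0 ÷ d ≡ 0
÷-zeroˡ zero = refl
÷-zeroˡ (suc d) = refl

÷-÷ : ∀ n a b → n ÷ a ÷ b ≡ n ÷ (a * b)
÷-÷ n zero b = ÷-zeroˡ b
÷-÷ n (suc a) zero rewrite *-zeroʳ a = refl
÷-÷ n (suc a) (suc b) = m/n/o≡m/[n*o] n (suc a) (suc b)

÷-÷-comm : ∀ n a b → n ÷ a ÷ b ≡ n ÷ b ÷ a
÷-÷-comm n a b = trans (÷-÷ n a b) (trans (cong (n ÷_) (*-comm a b)) (sym (÷-÷ n b a)))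

m÷n*n≤m : ∀ m n → m ÷ n * n ≤ m
m÷n*n≤m m zero = z≤n
m÷n*n≤m m (suc n) = m/n*n≤m m (suc n)

m<[1+m÷n]*n : ∀ m n → 1 ≤ n → m < suc (m ÷ n) * n
m<[1+m÷n]*n m (suc n) _ = begin-strict
  m                                  ≡⟨ m≡m%n+[m/n]*n m (suc n) ⟩
  m % suc n + m / suc n * suc n      <⟨ +-monoˡ-< _ (m%n<n m (suc n)) ⟩
  suc n + m / suc n * suc n          ∎
  where open ≤-Reasoning

m*n≤o⇒m≤o÷n : ∀ m n o → 1 ≤ n → m * n ≤ o → m ≤ o ÷ n
m*n≤o⇒m≤o÷n m (suc n) o _ mn≤o = ≤-trans (≤-reflexive (sym (m*n/n≡m m (suc n)))) (/-monoˡ-≤ (suc n) mn≤o)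

m<n*o⇒m÷o<n : ∀ m n o → m < n * o → m ÷ o < n
m<n*o⇒m÷o<n m n zero m<no = ⊥-elim (n≮0 (subst (m <_) (*-zeroʳ n) m<no))
m<n*o⇒m÷o<n m n (suc o) m<no = m<n*o⇒m/o<n m<no

m<n⇒m÷n≡0 : ∀ {m n} → m < n → m ÷ n ≡ 0
m<n⇒m÷n≡0 {m} {suc n} m<n = m<n⇒m/n≡0 m<n

∣⇒suc-÷ : ∀ y d .{{_ : NonZero d}} → d ∣ suc y → ∃[ k ] suc y ≡ d * suc k × y ÷ d ≡ k × suc y ÷ d ≡ suc k
∣⇒suc-÷ y (suc d) (divides (suc k) eq) =
  k , trans eq (*-comm (suc k) (suc d)) , trans (cong (_/ suc d) (suc-injective eq)) ([s+qd]/d≡q d k (suc d) ≤-refl) ,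
  trans (cong (_/ suc d) eq) (m*n/n≡m (suc k) (suc d))

∤⇒suc-÷ : ∀ y d .{{_ : NonZero d}} → ¬ (d ∣ suc y) → suc y ÷ d ≡ y ÷ d
∤⇒suc-÷ y (suc d) d∤ with suc y % suc d in eq
... | zero = contradiction (m%n≡0⇒n∣m (suc y) (suc d) eq) d∤
... | suc r = sym (begin
  y / suc d                                        ≡⟨ cong (_/ suc d) (suc-injective (trans (m≡m%n+[m/n]*n (suc y) (suc d)) (cong (_+ suc y / suc d * suc d) eq))) ⟩
  (r + suc y / suc d * suc d) / suc d              ≡⟨ [s+qd]/d≡q r (suc y / suc d) (suc d) (≤-trans (n≤1+n _) (subst (_< suc d) eq (m%n<n (suc y) (suc d)))) ⟩
  suc y / suc d                                    ∎)
  where open ≡-Reasoning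

∑-multiples : ∀ d .{{_ : NonZero d}} y (f : ℕ → ℕ) → ∑ y (λ j → 𝟙 (d ∣? j) * f j) ≡ ∑ (y ÷ d) (λ m → f (d * m))
∑-multiples d zero f rewrite ÷-zeroˡ d = refl
∑-multiples d (suc y) f with d ∣? suc y
... | no d∤ = begin
  ∑ y (λ j → 𝟙 (d ∣? j) * f j) + 𝟙 (no d∤) * f (suc y)   ≡⟨ cong (λ t → ∑ y (λ j → 𝟙 (d ∣? j) * f j) + t * f (suc y)) (𝟙-no (no d∤) d∤) ⟩
  ∑ y (λ j → 𝟙 (d ∣? j) * f j) + 0      ≡⟨ +-identityʳ _ ⟩
  ∑ y (λ j → 𝟙 (d ∣? j) * f j)          ≡⟨ ∑-multiples d y f ⟩
  ∑ (y ÷ d) (λ m → f (d * m))           ≡⟨ cong (λ t → ∑ t (λ m → f (d * m))) (∤⇒suc-÷ y d d∤) ⟨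
  ∑ (suc y ÷ d) (λ m → f (d * m))       ∎
  where open ≡-Reasoning
... | yes d∣ with ∣⇒suc-÷ y d d∣
...   | k , eq , y÷d , sy÷d = begin
  ∑ y (λ j → 𝟙 (d ∣? j) * f j) + 𝟙 (yes d∣) * f (suc y)  ≡⟨ cong₂ _+_ (∑-multiples d y f) (trans (cong (_* f (suc y)) (𝟙-yes (yes d∣) d∣)) (trans (+-identityʳ _) (cong f eq))) ⟩
  ∑ (y ÷ d) (λ m → f (d * m)) + f (d * suc k)       ≡⟨ cong (λ t → ∑ t (λ m → f (d * m)) + f (d * suc k)) y÷d ⟩
  ∑ (suc k) (λ m → f (d * m))                       ≡⟨ cong (λ t → ∑ t (λ m → f (d * m))) sy÷d ⟨
  ∑ (suc y ÷ d) (λ m → f (d * m))                   ∎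
  where open ≡-Reasoning

∑-shift : ∀ n (f : ℕ → ℕ) → ∑ n (λ i → f (pred i)) + f n ≡ f 0 + ∑ n f
∑-shift zero f = sym (+-identityʳ _)
∑-shift (suc n) f = begin
  ∑ n (λ i → f (pred i)) + f n + f (suc n)    ≡⟨ cong (_+ f (suc n)) (∑-shift n f) ⟩
  f 0 + ∑ n f + f (suc n)                     ≡⟨ +-assoc (f 0) _ _ ⟩
  f 0 + (∑ n f + f (suc n))                   ∎
  where open ≡-Reasoning

∏-single : ∀ {f : ℕ → ℕ} n k → 1 ≤ k → k ≤ n → (∀ i → i ≢ k → f i ≡ 1) → ∏ n f ≡ f k
∏-single zero k 1≤k k≤n h = contradiction (≤-trans 1≤k k≤n) λ ()
∏-single {f} (suc n) k 1≤k k≤n h with m≤n⇒m<n∨m≡n k≤n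
... | inj₁ k<1+n = trans (cong₂ _*_ (∏-single n k 1≤k (≤-pred k<1+n) h) (h (suc n) (<⇒≢ k<1+n ∘ sym))) (*-identityʳ _)
... | inj₂ refl = trans (cong (_* f (suc n)) (∏-1 n λ i _ i≤n → h i (<⇒≢ (s≤s i≤n)))) (+-identityʳ _)

-- Products of prime powers

prime≥2 : ∀ {p} → Prime p → 2 ≤ p
prime≥2 {p} pp = nonTrivial⇒n>1 p {{prime⇒nonTrivial pp}}

prime≥1 : ∀ {p} → Prime p → 1 ≤ p
prime≥1 = ≤-trans (n≤1+n 1) ∘ prime≥2

prime∣prime^⇒≡ : ∀ {p q} e → Prime p → Prime q → q ∣ p ^ e → q ≡ p
prime∣prime^⇒≡ zero pp pq q∣1 = contradiction (prime≥2 pq) (subst (λ q → ¬ 2 ≤ q) (sym (∣1⇒≡1 q∣1)) λ { (s≤s ()) })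
prime∣prime^⇒≡ {p} {q} (suc e) pp pq q∣ with euclidsLemma p (p ^ e) pq q∣
... | inj₂ q∣p^e = prime∣prime^⇒≡ e pp pq q∣p^e
... | inj₁ q∣p with prime⇒irreducible pp q∣p
...   | inj₂ q≡p = q≡p
...   | inj₁ refl = contradiction (prime≥2 pq) λ { (s≤s ()) }

prime-coprime : ∀ {q m} → Prime q → ¬ (q ∣ m) → Coprime m q
prime-coprime pq q∤m (d∣m , d∣q) with prime⇒irreducible pq d∣q
... | inj₁ d≡1 = d≡1
... | inj₂ refl = contradiction d∣m q∤m

2^≤prime^ : ∀ {p} e → Prime p → 2 ^ e ≤ p ^ e
2^≤prime^ e pp = ^-monoˡ-≤ e (prime≥2 pp)

^-nonZero : ∀ {p} e → Prime p → NonZero (p ^ e)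
^-nonZero {p} e pp = m^n≢0 p e {{prime⇒nonZero pp}}

opaque
  primePow : (ℕ → ℕ) → ℕ → ℕ
  primePow a p = if does (prime? p) then p ^ a p else 1

  primePow-prime : ∀ a {p} → Prime p → primePow a p ≡ p ^ a p
  primePow-prime a {p} pp with prime? p
  ... | yes _ = refl
  ... | no ¬pp = contradiction pp ¬pp

  primePow-+ : ∀ (a b : ℕ → ℕ) p → primePow (λ p → a p + b p) p ≡ primePow a p * primePow b p
  primePow-+ a b p with prime? p
  ... | yes _ = ^-distribˡ-+-* p (a p) (b p)
  ... | no _ = refl

  primePow-mono : ∀ (a b : ℕ → ℕ) p → (Prime p → a p ≤ b p) → primePow a p ≤ primePow b p
  primePow-mono a b p h with prime? p
  ... | yes pp = ^-monoʳ-≤ p {{prime⇒nonZero pp}} (h pp)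
  ... | no _ = ≤-refl

  primePow-0 : ∀ (a : ℕ → ℕ) p → (Prime p → a p ≡ 0) → primePow a p ≡ 1
  primePow-0 a p h with prime? p
  ... | yes pp rewrite h pp = refl
  ... | no _ = refl

  primePow-≤ : ∀ (a : ℕ → ℕ) p {b} → 1 ≤ b → (Prime p → p ^ a p ≤ b) → primePow a p ≤ b
  primePow-≤ a p 1≤b h with prime? p
  ... | yes pp = h pp
  ... | no _ = 1≤b

module Valuation (X E : ℕ) (X<2^E : X < 2 ^ E) where

  -- For a prime `p` and 1 ≤ `j` ≤ `X` this is the exponent of `p` in `j`: as `X < 2 ^ E`, no power
  -- beyond `p ^ E` can divide `j`.
  ν : ℕ → ℕ → ℕ
  ν p j = ∑ E (λ e → 𝟙 (p ^ e ∣? j))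

  opaque
    -- Plays the part of an exponential: adding exponent functions multiplies the values, and an
    -- inequality between products follows from inequalities between exponents, one for each prime.
    ℰ : (ℕ → ℕ) → ℕ
    ℰ a = ∏ X (primePow a)

    ℰ-+ : ∀ (a b : ℕ → ℕ) → ℰ (λ p → a p + b p) ≡ ℰ a * ℰ b
    ℰ-+ a b = trans (∏-cong X (λ p _ _ → primePow-+ a b p)) (∏-* X _ _)

    ℰ-mono : ∀ (a b : ℕ → ℕ) → (∀ p → Prime p → p ≤ X → a p ≤ b p) → ℰ a ≤ ℰ b
    ℰ-mono a b h = ∏-mono X (λ p _ p≤X → primePow-mono a b p (λ pp → h p pp p≤X))

    ℰ-cong : ∀ (a b : ℕ → ℕ) → (∀ p → Prime p → p ≤ X → a p ≡ b p) → ℰ a ≡ ℰ b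
    ℰ-cong a b h = ≤-antisym (ℰ-mono a b λ p pp p≤X → ≤-reflexive (h p pp p≤X)) (ℰ-mono b a λ p pp p≤X → ≤-reflexive (sym (h p pp p≤X)))

    ℰ-0 : ∀ (a : ℕ → ℕ) → (∀ p → Prime p → p ≤ X → a p ≡ 0) → ℰ a ≡ 1
    ℰ-0 a h = ∏-1 X (λ p _ p≤X → primePow-0 a p (λ pp → h p pp p≤X))

    ℰ-single : ∀ (a : ℕ → ℕ) {q} → Prime q → q ≤ X → ℰ (λ p → 𝟙 (p ≟ q) * a p) ≡ q ^ a q
    ℰ-single a {q} pq q≤X = begin
      ℰ (λ p → 𝟙 (p ≟ q) * a p)                    ≡⟨ ∏-single X q (prime≥1 pq) q≤X (λ i i≢q → primePow-0 _ i (λ _ → cong (_* a i) (𝟙-no (i ≟ q) i≢q))) ⟩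
      primePow (λ p → 𝟙 (p ≟ q) * a p) q           ≡⟨ primePow-prime _ pq ⟩
      q ^ (𝟙 (q ≟ q) * a q)                        ≡⟨ cong (λ t → q ^ (t * a q)) (𝟙-yes (q ≟ q) refl) ⟩
      q ^ (a q + 0)                                ≡⟨ cong (q ^_) (+-identityʳ (a q)) ⟩
      q ^ a q                                      ∎
      where open ≡-Reasoning

    ℰ-≤-^ : ∀ (a w : ℕ → ℕ) b → 1 ≤ b → (∀ p → Prime p → p ≤ X → p ^ a p ≤ b ^ w p) → ℰ a ≤ b ^ ∑ X w
    ℰ-≤-^ a w b 1≤b h = go X h
      where
      go : ∀ n → (∀ p → Prime p → p ≤ n → p ^ a p ≤ b ^ w p) → ∏ n (primePow a) ≤ b ^ ∑ n w
      go zero h = ≤-refl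
      go (suc n) h = ≤-trans (*-mono-≤ (go n λ p pp p≤n → h p pp (m≤n⇒m≤1+n p≤n)) (primePow-≤ a (suc n) (m^n>0 b {{>-nonZero 1≤b}} (w (suc n))) λ pp → h (suc n) pp ≤-refl))
        (≤-reflexive (sym (^-distribˡ-+-* b (∑ n w) (w (suc n)))))

  -- Multiplication by `p` shifts the conditions `p ^ e ∣ m` by one place. The index 0 that enters
  -- gives the extra 1; the index `E` that drops out is void because `m ≤ X < 2 ^ E`.
  ν-* : ∀ {p q m} → Prime p → Prime q → 1 ≤ m → m ≤ X → ν p (q * m) ≡ 𝟙 (p ≟ q) + ν p m
  ν-* {p} {q} {m} pp pq 1≤m m≤X with p ≟ q
  ... | no p≢q = trans (∑-cong E (λ e _ _ → 𝟙-cong (p ^ e ∣? q * m) (p ^ e ∣? m)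
          (coprime-divisor (prime-coprime pq (p≢q ∘ sym ∘ prime∣prime^⇒≡ e pp pq))) (∣n⇒∣m*n q)))
          (cong (_+ ν p m) (sym (𝟙-no (no p≢q) p≢q)))
  ... | yes refl = begin
    ∑ E (λ e → 𝟙 (p ^ e ∣? p * m))                   ≡⟨ ∑-cong E shift ⟩
    ∑ E (λ e → 𝟙 (p ^ pred e ∣? m))                  ≡⟨ +-identityʳ _ ⟨
    ∑ E (λ e → 𝟙 (p ^ pred e ∣? m)) + 0              ≡⟨ cong (∑ E (λ e → 𝟙 (p ^ pred e ∣? m)) +_) (𝟙-no (p ^ E ∣? m) p^E∤m) ⟨
    ∑ E (λ e → 𝟙 (p ^ pred e ∣? m)) + 𝟙 (p ^ E ∣? m) ≡⟨ ∑-shift E (λ e → 𝟙 (p ^ e ∣? m)) ⟩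
    𝟙 (1 ∣? m) + ν p m                               ≡⟨ cong (_+ ν p m) (𝟙-yes (1 ∣? m) (1∣ m)) ⟩
    1 + ν p m                                        ≡⟨ cong (_+ ν p m) (𝟙-yes (yes refl) refl) ⟨
    𝟙 (yes refl) + ν p m                             ∎
    where
    open ≡-Reasoning
    instance _ = prime⇒nonZero pp
    shift : ∀ e → 1 ≤ e → e ≤ E → 𝟙 (p ^ e ∣? p * m) ≡ 𝟙 (p ^ pred e ∣? m)
    shift (suc e) _ _ = 𝟙-cong (p ^ suc e ∣? p * m) (p ^ e ∣? m) (*-cancelˡ-∣ p) (*-monoʳ-∣ p)
    p^E∤m : ¬ (p ^ E ∣ m)
    p^E∤m d = <⇒≱ (≤-<-trans m≤X (≤-trans X<2^E (2^≤prime^ E pp))) (∣⇒≤ {{>-nonZero 1≤m}} d)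

  ℰ-product : ∀ ps → All Prime ps → product ps ≤ X → product ps ≡ ℰ (λ p → ν p (product ps))
  ℰ-product [] [] _ = sym (ℰ-0 _ λ p pp _ → ∑-none E λ { (suc e) _ _ →
    𝟙-no (p ^ suc e ∣? 1) λ d → contradiction (prime≥2 pp) (subst (λ q → ¬ 2 ≤ q) (sym (m*n≡1⇒m≡1 p _ (∣1⇒≡1 d))) λ { (s≤s ()) }) })
  ℰ-product (q ∷ ps) (pq ∷ pps) qps≤X = begin
    q * m                                      ≡⟨ cong₂ _*_ (sym (trans (ℰ-single (λ _ → 1) pq q≤X) (*-identityʳ q))) (ℰ-product ps pps m≤X) ⟩
    ℰ (λ p → 𝟙 (p ≟ q) * 1) * ℰ (λ p → ν p m)  ≡⟨ ℰ-+ _ _ ⟨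
    ℰ (λ p → 𝟙 (p ≟ q) * 1 + ν p m)            ≡⟨ ℰ-cong _ _ (λ p pp _ → trans (cong (_+ ν p m) (*-identityʳ (𝟙 (p ≟ q)))) (sym (ν-* pp pq 1≤m m≤X))) ⟩
    ℰ (λ p → ν p (q * m))                      ∎
    where
    open ≡-Reasoning
    m = product ps
    1≤m = productOfPrimes≥1 pps
    m≤X : m ≤ X
    m≤X = ≤-trans (m≤n*m m q {{prime⇒nonZero pq}}) qps≤X
    q≤X : q ≤ X
    q≤X = ≤-trans (m≤m*n q m {{>-nonZero 1≤m}}) qps≤X

  ℰ-ν : ∀ j → 1 ≤ j → j ≤ X → j ≡ ℰ (λ p → ν p j)
  ℰ-ν (suc j) _ j≤X = trans eq (trans (ℰ-product (factors F) (factorsPrime F) (subst (_≤ X) eq j≤X)) (ℰ-cong _ _ λ p _ _ → cong (ν p) (sym eq)))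
    where
    open PrimeFactorisation
    F = factorise (suc j)
    eq = isFactorisation F

  ℰ-^ : ∀ (a : ℕ → ℕ) k → ℰ (λ p → k * a p) ≡ ℰ a ^ k
  ℰ-^ a zero = ℰ-0 _ λ _ _ _ → refl
  ℰ-^ a (suc k) = trans (ℰ-+ a (λ p → k * a p)) (cong (ℰ a *_) (ℰ-^ a k))

  -- Legendre's formula with weights: the exponent of `p` is the sum of `w j` over all pairs with
  -- `p ^ e ∣ j`, taken by `e` first, where `j = p ^ e * m`.
  ∏-^-ℰ : ∀ (w : ℕ → ℕ) y → y ≤ X → ∏ y (λ j → j ^ w j) ≡ ℰ (λ p → ∑ E (λ e → ∑ (y ÷ (p ^ e)) (λ m → w (p ^ e * m))))
  ∏-^-ℰ w y y≤X = trans (expand y y≤X) (ℰ-cong _ _ λ p pp _ → begin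
      ∑ y (λ j → w j * ν p j)                              ≡⟨ ∑-cong y (λ j _ _ → sym (∑-*ˡ E (w j) _)) ⟩
      ∑ y (λ j → ∑ E (λ e → w j * 𝟙 (p ^ e ∣? j)))         ≡⟨ ∑-swap y E _ ⟩
      ∑ E (λ e → ∑ y (λ j → w j * 𝟙 (p ^ e ∣? j)))         ≡⟨ ∑-cong E (λ e _ _ → trans (∑-cong y (λ j _ _ → *-comm (w j) _)) (∑-multiples (p ^ e) {{^-nonZero e pp}} y w)) ⟩
      ∑ E (λ e → ∑ (y ÷ (p ^ e)) (λ m → w (p ^ e * m)))    ∎)
    where
    open ≡-Reasoning
    expand : ∀ y → y ≤ X → ∏ y (λ j → j ^ w j) ≡ ℰ (λ p → ∑ y (λ j → w j * ν p j))
    expand zero _ = sym (ℰ-0 _ λ _ _ _ → refl)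
    expand (suc y) y<X = begin
      ∏ y (λ j → j ^ w j) * suc y ^ w (suc y)                        ≡⟨ cong₂ _*_ (expand y (≤-trans (n≤1+n y) y<X)) (cong (_^ w (suc y)) (ℰ-ν (suc y) (s≤s z≤n) y<X)) ⟩
      ℰ (λ p → ∑ y (λ j → w j * ν p j)) * ℰ (λ p → ν p (suc y)) ^ w (suc y)  ≡⟨ cong (ℰ (λ p → ∑ y (λ j → w j * ν p j)) *_) (ℰ-^ _ (w (suc y))) ⟨
      ℰ (λ p → ∑ y (λ j → w j * ν p j)) * ℰ (λ p → w (suc y) * ν p (suc y))  ≡⟨ ℰ-+ _ _ ⟨
      ℰ (λ p → ∑ (suc y) (λ j → w j * ν p j))                        ∎

-- Products over residue classes

∑-periodic : ∀ K (f : ℕ → ℕ) → (∀ i → f (K + i) ≡ f i) → ∀ q s → ∑ (q * K + s) f ≡ q * ∑ K f + ∑ s f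
∑-periodic K f per zero s = refl
∑-periodic K f per (suc q) s = begin
  ∑ (K + q * K + s) f                                ≡⟨ cong (λ t → ∑ t f) (+-assoc K (q * K) s) ⟩
  ∑ (K + (q * K + s)) f                              ≡⟨ ∑-split K (q * K + s) f ⟩
  ∑ K f + ∑ (q * K + s) (λ i → f (K + i))            ≡⟨ cong (∑ K f +_) (trans (∑-cong (q * K + s) (λ i _ _ → per i)) (∑-periodic K f per q s)) ⟩
  ∑ K f + (q * ∑ K f + ∑ s f)                        ≡⟨ +-assoc (∑ K f) _ _ ⟨
  suc q * ∑ K f + ∑ s f                              ∎
  where open ≡-Reasoning

∏-base^ : ∀ n b (w : ℕ → ℕ) → ∏ n (λ i → b ^ w i) ≡ b ^ ∑ n w
∏-base^ zero b w = refl
∏-base^ (suc n) b w = trans (cong (_* b ^ w (suc n)) (∏-base^ n b w)) (sym (^-distribˡ-+-* b (∑ n w) (w (suc n))))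

fac : ℕ → ℕ
fac n = ∏ n (λ j → j ^ 1)

fac-pos : ∀ n → 1 ≤ fac n
fac-pos n = ∏-pos n λ j 1≤j _ → m^n>0 j {{>-nonZero 1≤j}} 1

%≡⇒∣∸ : ∀ {a b} K .{{_ : NonZero K}} → a ≤ b → a % K ≡ b % K → K ∣ b ∸ a
%≡⇒∣∸ {a} {b} K a≤b eq = divides (b / K ∸ a / K) (begin
  b ∸ a                                          ≡⟨ cong₂ _∸_ (m≡m%n+[m/n]*n b K) (m≡m%n+[m/n]*n a K) ⟩
  (b % K + b / K * K) ∸ (a % K + a / K * K)      ≡⟨ cong (λ r → (b % K + b / K * K) ∸ (r + a / K * K)) eq ⟩
  (b % K + b / K * K) ∸ (b % K + a / K * K)      ≡⟨ [m+n]∸[m+o]≡n∸o (b % K) _ _ ⟩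
  b / K * K ∸ a / K * K                          ≡⟨ *-distribʳ-∸ K (b / K) (a / K) ⟨
  (b / K ∸ a / K) * K                            ∎)
  where open ≡-Reasoning

∣∸⇒%≡ : ∀ {a b} K .{{_ : NonZero K}} → a ≤ b → K ∣ b ∸ a → a % K ≡ b % K
∣∸⇒%≡ {a} {b} K a≤b K∣ = sym (trans (cong (_% K) (sym (m+[n∸m]≡n a≤b))) (%-remove-+ʳ a K∣))

module _ (K : ℕ) .{{_ : NonZero K}} where

  %-*-congˡ : ∀ {a a′} b → a % K ≡ a′ % K → (a * b) % K ≡ (a′ * b) % K
  %-*-congˡ {a} {a′} b eq = trans (%-distribˡ-* a b K) (trans (cong (λ t → (t * (b % K)) % K) eq) (sym (%-distribˡ-* a′ b K)))

  %-*-congʳ : ∀ {b b′} a → b % K ≡ b′ % K → (a * b) % K ≡ (a * b′) % K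
  %-*-congʳ {b} {b′} a eq = trans (cong (_% K) (*-comm a b)) (trans (%-*-congˡ a eq) (cong (_% K) (*-comm b′ a)))

  inverse : ∀ {h} → Coprime h K → ∃[ h′ ] (h * h′) % K ≡ 1 % K
  inverse {h} c with coprime-Bézout c
  ... | Bézout.+- x y eq = x , trans (cong (_% K) (trans (*-comm h x) (sym eq))) ([m+kn]%n≡m%n 1 y K)
  -- Here `h * x` is -1 modulo `K`, hence the factor `pred K`, which is again -1.
  ... | Bézout.-+ x y eq = x * pred K , (begin
    (h * (x * pred K)) % K                 ≡⟨ [m+n]%n≡m%n (h * (x * pred K)) K ⟨
    (h * (x * pred K) + K) % K             ≡⟨ cong (_% K) key ⟩
    (1 + y * pred K * K) % K               ≡⟨ [m+kn]%n≡m%n 1 (y * pred K) K ⟩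
    1 % K                                  ∎)
    where
    open ≡-Reasoning
    key : h * (x * pred K) + K ≡ 1 + y * pred K * K
    key = begin
      h * (x * pred K) + K                    ≡⟨ cong (h * (x * pred K) +_) (suc-pred K) ⟨
      h * (x * pred K) + suc (pred K)         ≡⟨ solve 3 (λ h x k → h :* (x :* k) :+ (con 1 :+ k) := con 1 :+ (con 1 :+ x :* h) :* k) refl h x (pred K) ⟩
      1 + (1 + x * h) * pred K                ≡⟨ cong (λ t → 1 + t * pred K) eq ⟩
      1 + y * K * pred K                      ≡⟨ cong suc (solve 3 (λ y k k' → y :* k :* k' := y :* k' :* k) refl y K (pred K)) ⟩
      1 + y * pred K * K                      ∎
      where open +-*-Solver

  Root : ℕ → ℕ → ℕ → Set
  Root h c u = ∀ m → ((h * m) % K ≡ c → m % K ≡ u) × (m % K ≡ u → (h * m) % K ≡ c)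

  residue : ∀ {h} c → c < K → Coprime h K → ∃[ u ] u < K × Root h c u
  residue {h} c c<K cop with inverse cop
  ... | h′ , inv = (h′ * c) % K , m%n<n _ K , λ m → to m , from m
    where
    open ≡-Reasoning
    c%K : c % K ≡ c
    c%K = m<n⇒m%n≡m c<K
    cancel : ∀ m → (h′ * (h * m)) % K ≡ m % K
    cancel m = begin
      (h′ * (h * m)) % K    ≡⟨ cong (_% K) (trans (sym (*-assoc h′ h m)) (cong (_* m) (*-comm h′ h))) ⟩
      (h * h′ * m) % K      ≡⟨ %-*-congˡ m inv ⟩
      (1 * m) % K           ≡⟨ cong (_% K) (*-identityˡ m) ⟩
      m % K                 ∎
    to : ∀ m → (h * m) % K ≡ c → m % K ≡ (h′ * c) % K
    to m eq = trans (sym (cancel m)) (%-*-congʳ h′ (trans eq (sym c%K)))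
    from : ∀ m → m % K ≡ (h′ * c) % K → (h * m) % K ≡ c
    from m eq = begin
      (h * m) % K           ≡⟨ %-*-congʳ h (trans eq (sym (m%n%n≡m%n (h′ * c) K))) ⟩
      (h * ((h′ * c) % K)) % K ≡⟨ %-*-congʳ h (m%n%n≡m%n (h′ * c) K) ⟩
      (h * (h′ * c)) % K    ≡⟨ cong (_% K) (*-assoc h h′ c) ⟨
      (h * h′ * c) % K      ≡⟨ %-*-congˡ c inv ⟩
      (1 * c) % K           ≡⟨ cong (_% K) (*-identityˡ c) ⟩
      c % K                 ≡⟨ c%K ⟩
      c                     ∎

  cnt : ℕ → ℕ → ℕ → ℕ
  cnt c h t = ∑ t (λ m → 𝟙 ((h * m) % K ≟ c))

  cnt-block : ∀ c h → c < K → Coprime h K → cnt c h K ≡ 1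
  cnt-block c h c<K cop = by-root (residue c c<K cop)
    where
    to : ∀ u m → m ≤ K → m % K ≡ suc u → m ≡ suc u
    to u m m≤K eq with m≤n⇒m<n∨m≡n m≤K
    ... | inj₁ m<K = trans (sym (m<n⇒m%n≡m m<K)) eq
    ... | inj₂ refl with () ← trans (sym (n%n≡0 m)) eq
    by-root : ∃[ u ] u < K × Root h c u → cnt c h K ≡ 1
    -- Among the indices 1, ..., `K` the class 0 is represented by `K`.
    by-root (zero , _ , iff) = trans (∑-cong K λ m 1≤m m≤K → 𝟙-cong _ (m ≟ K)
      (λ eq → ≤-antisym m≤K (∣⇒≤ {{>-nonZero 1≤m}} (m%n≡0⇒n∣m m K (proj₁ (iff m) eq))))
      (λ { refl → proj₂ (iff m) (n%n≡0 m) })) (∑-𝟙≟ K K (>-nonZero⁻¹ K) ≤-refl)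
    by-root (suc u , u<K , iff) = trans (∑-cong K λ m 1≤m m≤K → 𝟙-cong _ (m ≟ suc u)
      (λ eq → to u m m≤K (proj₁ (iff m) eq))
      (λ { refl → proj₂ (iff m) (m<n⇒m%n≡m u<K) })) (∑-𝟙≟ K (suc u) (s≤s z≤n) (<⇒≤ u<K))

  cnt-split : ∀ c h → c < K → Coprime h K → ∀ q s → cnt c h (q * K + s) ≡ q + cnt c h s
  cnt-split c h c<K cop q s = begin
    cnt c h (q * K + s)               ≡⟨ ∑-periodic K _ (λ i → cong (λ t → 𝟙 (t ≟ c)) (per i)) q s ⟩
    q * cnt c h K + cnt c h s         ≡⟨ cong (λ t → q * t + cnt c h s) (cnt-block c h c<K cop) ⟩
    q * 1 + cnt c h s                 ≡⟨ cong (_+ cnt c h s) (*-identityʳ q) ⟩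
    q + cnt c h s                     ∎
    where
    open ≡-Reasoning
    per : ∀ i → (h * (K + i)) % K ≡ (h * i) % K
    per i = trans (cong (_% K) (*-distribˡ-+ h K i)) (%-remove-+ˡ (h * i) (n∣m*n h))

  cnt-%  : ∀ c h → c < K → Coprime h K → ∀ t → cnt c h t ≡ t / K + cnt c h (t % K)
  cnt-% c h c<K cop t = trans (cong (cnt c h) (trans (m≡m%n+[m/n]*n t K) (+-comm (t % K) _))) (cnt-split c h c<K cop (t / K) (t % K))

  cnt≤1 : ∀ c h → c < K → Coprime h K → ∀ s → s ≤ K → cnt c h s ≤ 1
  cnt≤1 c h c<K cop s s≤K = ≤-trans (∑-monoˡ _ s≤K) (≤-reflexive (cnt-block c h c<K cop))

  classProd : ℕ → ℕ → ℕ → ℕ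
  classProd c μ y = ∏ y (λ j → j ^ 𝟙 ((μ * j) % K ≟ c))

  classProd-pos : ∀ c μ y → 1 ≤ classProd c μ y
  classProd-pos c μ y = ∏-pos y λ j 1≤j _ → m^n>0 j {{>-nonZero 1≤j}} (𝟙 ((μ * j) % K ≟ c))

  block-cnt : ∀ c μ → c < K → Coprime μ K → ∀ n → ∑ K (λ i → 𝟙 ((μ * (n * K + i)) % K ≟ c)) ≡ 1
  block-cnt c μ c<K cop n = +-cancelˡ-≡ (cnt c μ (n * K)) _ _ (begin
    cnt c μ (n * K) + ∑ K (λ i → 𝟙 ((μ * (n * K + i)) % K ≟ c))   ≡⟨ ∑-split (n * K) K _ ⟨
    cnt c μ (n * K + K)                                           ≡⟨ cnt-split c μ c<K cop n K ⟩
    n + cnt c μ K                                                 ≡⟨ cong₂ _+_ (trans (sym (+-identityʳ n)) (trans (sym (cnt-split c μ c<K cop n 0)) (cong (cnt c μ) (+-identityʳ (n * K))))) (cnt-block c μ c<K cop) ⟩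
    cnt c μ (n * K) + 1                                           ∎)
    where open ≡-Reasoning

  -- Each block of `K` consecutive integers contains exactly one `j` with `μ * j` in the class `c`;
  -- the one in the i-th block is at most i `K`.
  classProd-upper : ∀ c μ → c < K → Coprime μ K → ∀ n → classProd c μ (n * K) ≤ K ^ n * fac n
  classProd-upper c μ c<K cop zero = ≤-refl
  classProd-upper c μ c<K cop (suc n) = begin
    classProd c μ (K + n * K)                                      ≡⟨ cong (classProd c μ) (+-comm K (n * K)) ⟩
    classProd c μ (n * K + K)                                      ≡⟨ ∏-split (n * K) K _ ⟩
    classProd c μ (n * K) * ∏ K (λ i → (n * K + i) ^ w i)          ≤⟨ *-mono-≤ (classProd-upper c μ c<K cop n) (∏-mono K λ i _ i≤K → ^-monoˡ-≤ (w i) (+-monoʳ-≤ (n * K) i≤K)) ⟩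
    K ^ n * fac n * ∏ K (λ i → (n * K + K) ^ w i)                  ≡⟨ cong (K ^ n * fac n *_) (trans (∏-base^ K (n * K + K) w) (cong ((n * K + K) ^_) (block-cnt c μ c<K cop n))) ⟩
    K ^ n * fac n * (n * K + K) ^ 1                                ≡⟨ solve 4 (λ a b n k → a :* b :* ((n :* k :+ k) :* con 1) := k :* a :* (b :* ((con 1 :+ n) :* con 1))) refl (K ^ n) (fac n) n K ⟩
    K ^ suc n * fac (suc n)                                        ∎
    where
    open ≤-Reasoning
    open +-*-Solver
    w = λ i → 𝟙 ((μ * (n * K + i)) % K ≟ c)

  -- The member of block i + 1 is at least i `K`, so the comparison with the factorial is shifted by
  -- one block; the last factor `suc n * K` stays on the right, and the first block is bounded by 1.
  classProd-lower : ∀ c → c < K → ∀ n → K ^ suc n * fac (suc n) ≤ classProd c 1 (suc n * K) * (suc n * K)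
  classProd-lower c c<K zero = begin
    K ^ 1 * fac 1                             ≡⟨ solve 1 (λ k → (k :* con 1) :* con 1 := con 1 :* (con 1 :* k)) refl K ⟩
    1 * (1 * K)                               ≤⟨ *-monoˡ-≤ (1 * K) (classProd-pos c 1 (1 * K)) ⟩
    classProd c 1 (1 * K) * (1 * K)           ∎
    where
    open ≤-Reasoning
    open +-*-Solver
  classProd-lower c c<K (suc m) = begin
    K ^ suc n * fac (suc n)                                        ≡⟨ solve 4 (λ a b n k → k :* a :* (b :* ((con 1 :+ n) :* con 1)) := a :* b :* ((con 1 :+ n) :* k)) refl (K ^ n) (fac n) n K ⟩
    K ^ n * fac n * (suc n * K)                                    ≤⟨ *-monoˡ-≤ (suc n * K) (classProd-lower c c<K m) ⟩
    classProd c 1 (n * K) * (n * K) * (suc n * K)                  ≡⟨ cong (λ t → classProd c 1 (n * K) * t * (suc n * K)) (trans (sym (*-identityʳ (n * K))) (cong ((n * K) ^_) (sym (block-cnt c 1 c<K (λ (d∣1 , _) → ∣1⇒≡1 d∣1) n)))) ⟩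
    classProd c 1 (n * K) * (n * K) ^ ∑ K w * (suc n * K)          ≡⟨ cong (λ t → classProd c 1 (n * K) * t * (suc n * K)) (∏-base^ K (n * K) w) ⟨
    classProd c 1 (n * K) * ∏ K (λ i → (n * K) ^ w i) * (suc n * K)  ≤⟨ *-monoˡ-≤ (suc n * K) (*-monoʳ-≤ (classProd c 1 (n * K)) (∏-mono K λ i _ _ → ^-monoˡ-≤ (w i) (m≤m+n (n * K) i))) ⟩
    classProd c 1 (n * K) * ∏ K (λ i → (n * K + i) ^ w i) * (suc n * K)  ≡⟨ cong (_* (suc n * K)) (trans (sym (∏-split (n * K) K _)) (cong (classProd c 1) (+-comm (n * K) K))) ⟩
    classProd c 1 (suc n * K) * (suc n * K)                        ∎
    where
    open ≤-Reasoning
    open +-*-Solver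
    n = suc m
    w = λ i → 𝟙 ((1 * (n * K + i)) % K ≟ c)

coprime-^ : ∀ {p K} e → Prime p → ¬ (p ∣ K) → Coprime (p ^ e) K
coprime-^ zero pp p∤K (d∣1 , _) = ∣1⇒≡1 d∣1
coprime-^ {p} (suc e) pp p∤K {d} (d∣ , d∣K) =
  coprime-^ e pp p∤K (coprime-divisor (prime-coprime pp λ p∣d → p∤K (∣-trans p∣d d∣K)) d∣ , d∣K)

prime-∤-coprime : ∀ {p c K} → Prime p → Coprime c K → p ∣ K → ¬ (p ∣ c)
prime-∤-coprime pp cop p∣K p∣c = contradiction (prime≥2 pp) (subst (λ q → ¬ 2 ≤ q) (sym (cop (p∣c , p∣K))) λ { (s≤s ()) })

-- Chebyshev bounds in residue classes

legendre : ℕ → ℕ → ℕ → ℕ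
legendre E n p = ∑ E (λ e → n ÷ (p ^ e))

legendre-suc : ∀ E n p → legendre (suc E) n p ≡ n ÷ p + legendre E (n ÷ p) p
legendre-suc E n p = trans (∑-split 1 E _) (cong₂ _+_ (cong (n ÷_) (*-identityʳ p)) (∑-cong E λ e _ _ → sym (÷-÷ n p (p ^ e))))

legendre-upper : ∀ E n p → 1 ≤ p → pred p * legendre E n p ≤ n
legendre-upper zero n p _ = ≤-trans (≤-reflexive (*-zeroʳ (pred p))) z≤n
legendre-upper (suc E) n (suc p) 1≤p = begin
  p * legendre (suc E) n (suc p)             ≡⟨ cong (p *_) (legendre-suc E n (suc p)) ⟩
  p * (m + legendre E m (suc p))             ≡⟨ *-distribˡ-+ p m _ ⟩
  p * m + p * legendre E m (suc p)           ≤⟨ +-monoʳ-≤ (p * m) (legendre-upper E m (suc p) 1≤p) ⟩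
  p * m + m                                  ≡⟨ solve 2 (λ p m → p :* m :+ m := m :* (con 1 :+ p)) refl p m ⟩
  m * suc p                                  ≤⟨ m÷n*n≤m n (suc p) ⟩
  n                                          ∎
  where
  open ≤-Reasoning
  open +-*-Solver
  m = n ÷ suc p

-- Each of the `E` divisions by `p` drops a remainder of at most `pred p`, whence the term
-- `pred p * E`.
legendre-lower : ∀ E n p → 1 ≤ p → n ≤ pred p * legendre E n p + pred p * E + n ÷ (p ^ E)
legendre-lower zero n p _ = ≤-trans (≤-reflexive (sym (n/1≡n n))) (m≤n+m _ _)
legendre-lower (suc E) n (suc p) 1≤p = begin
  n                                                          ≤⟨ ≤-pred (m<[1+m÷n]*n n (suc p) 1≤p) ⟩
  p + m * suc p                                              ≡⟨ solve 2 (λ p m → p :+ m :* (con 1 :+ p) := p :+ p :* m :+ m) refl p m ⟩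
  p + p * m + m                                              ≤⟨ +-monoʳ-≤ (p + p * m) (legendre-lower E m (suc p) 1≤p) ⟩
  p + p * m + (p * l + p * E + m ÷ (suc p ^ E))              ≡⟨ solve 5 (λ p m l e x → p :+ p :* m :+ (p :* l :+ p :* e :+ x) := p :* (m :+ l) :+ p :* (con 1 :+ e) :+ x) refl p m l E (m ÷ (suc p ^ E)) ⟩
  p * (m + l) + p * suc E + m ÷ (suc p ^ E)                  ≡⟨ cong₂ (λ s t → p * s + p * suc E + t) (sym (legendre-suc E n (suc p))) (÷-÷ n (suc p) (suc p ^ E)) ⟩
  p * legendre (suc E) n (suc p) + p * suc E + n ÷ (suc p ^ suc E)   ∎
  where
  open ≤-Reasoning
  open +-*-Solver
  m = n ÷ suc p
  l = legendre E m (suc p)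

opaque
  inClass? : ∀ K .{{_ : NonZero K}} c lo hi p → Dec (lo < p × p ≤ hi × p % K ≡ c)
  inClass? K c lo hi p = (lo <? p) ×-dec (p ≤? hi) ×-dec (p % K ≟ c)

module Chebyshev (X E : ℕ) (X<2^E : X < 2 ^ E) (1≤E : 1 ≤ E) where
  open Valuation X E X<2^E public

  leg : ℕ → ℕ → ℕ
  leg = legendre E

  fac-ℰ : ∀ n → n ≤ X → fac n ≡ ℰ (leg n)
  fac-ℰ n n≤X = trans (∏-^-ℰ (λ _ → 1) n n≤X) (ℰ-cong _ _ λ p _ _ → ∑-cong E λ e _ _ → trans (∑-const (n ÷ (p ^ e)) 1) (*-identityʳ _))

  higherPowers : ℕ → ℕ → ℕ
  higherPowers x p = ∑ E (λ e → 𝟙 ((2 ≤? e) ×-dec (p ^ e ≤? x)))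

  ℰ-pos : ∀ (a : ℕ → ℕ) → 1 ≤ ℰ a
  ℰ-pos a = ≤-trans (≤-reflexive (sym (ℰ-0 (λ _ → 0) λ _ _ _ → refl))) (ℰ-mono _ _ λ _ _ _ → z≤n)

  ℰ-∑ : ∀ n (f : ℕ → ℕ → ℕ) → ℰ (λ p → ∑ n (λ r → f r p)) ≡ ∏ n (λ r → ℰ (f r))
  ℰ-∑ zero f = ℰ-0 _ λ _ _ _ → refl
  ℰ-∑ (suc n) f = trans (ℰ-+ _ (f (suc n))) (cong (_* ℰ (f (suc n))) (ℰ-∑ n f))

  -- The part of n! made up of the primes dividing `K`. A class of units contains no multiples of
  -- these primes, so this part has to be supplied when its product is compared with a factorial.
  R : ℕ → ℕ → ℕ
  R K n = ℰ (λ p → 𝟙 (p ∣? K) * leg n p)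

  module _ (K : ℕ) .{{_ : NonZero K}} where

    classExp : ℕ → ℕ → ℕ → ℕ → ℕ
    classExp c μ y p = ∑ E (λ e → cnt K c (μ * p ^ e) (y ÷ (p ^ e)))

    classProd-ℰ : ∀ c μ y → y ≤ X → classProd K c μ y ≡ ℰ (classExp c μ y)
    classProd-ℰ c μ y y≤X = trans (∏-^-ℰ (λ j → 𝟙 ((μ * j) % K ≟ c)) y y≤X)
      (ℰ-cong _ _ λ p _ _ → ∑-cong E λ e _ _ → ∑-cong (y ÷ (p ^ e)) λ m _ _ → cong (λ t → 𝟙 (t % K ≟ c)) (sym (*-assoc μ (p ^ e) m)))

    n*K÷d÷K : ∀ n d → n * K ÷ d ÷ K ≡ n ÷ d
    n*K÷d÷K n d = trans (÷-÷-comm (n * K) d K) (cong (_÷ d) (trans (÷≡/ (n * K) K) (m*n/n≡m n K)))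

    cnt-lower : ∀ c h → c < K → Coprime h K → ∀ t → t ÷ K ≤ cnt K c h t
    cnt-lower c h c<K cop t = ≤-trans (m≤m+n _ _) (≤-reflexive (trans (cong (_+ cnt K c h (t % K)) (÷≡/ t K)) (sym (cnt-% K c h c<K cop t))))

    -- (∏ j : j ≤ n K, j ≡ c mod K) ≤ K ^ n n!, and away from K the left side is divisible by n! and by the primes in question.
    class-primes-upper : ∀ c n → c < K → Coprime c K → n * K ≤ X →
                         ℰ (λ p → 𝟙 (inClass? K c n (n * K) p)) ≤ K ^ n * R K n
    class-primes-upper c n c<K cop nK≤X = *-cancelʳ-≤ D (K ^ n * R K n) (fac n) {{>-nonZero (fac-pos n)}} (begin
      D * fac n                                                   ≡⟨ cong (D *_) (fac-ℰ n (≤-trans (m≤m*n n K) nK≤X)) ⟩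
      D * ℰ (leg n)                                               ≡⟨ ℰ-+ _ _ ⟨
      ℰ (λ p → 𝟙 (inClass? K c n (n * K) p) + leg n p)            ≤⟨ ℰ-mono _ _ (λ p pp _ → pointwise p pp) ⟩
      ℰ (λ p → classExp c 1 (n * K) p + 𝟙 (p ∣? K) * leg n p)     ≡⟨ ℰ-+ _ _ ⟩
      ℰ (classExp c 1 (n * K)) * R K n                            ≡⟨ cong (_* R K n) (classProd-ℰ c 1 (n * K) nK≤X) ⟨
      classProd K c 1 (n * K) * R K n                             ≤⟨ *-monoˡ-≤ (R K n) (classProd-upper K c 1 c<K (λ (d∣1 , _) → ∣1⇒≡1 d∣1) n) ⟩
      K ^ n * fac n * R K n                                       ≡⟨ solve 3 (λ a b c → a :* b :* c := a :* c :* b) refl (K ^ n) (fac n) (R K n) ⟩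
      K ^ n * R K n * fac n                                       ∎)
      where
      open ≤-Reasoning
      open +-*-Solver
      D = ℰ (λ p → 𝟙 (inClass? K c n (n * K) p))
      pointwise : ∀ p → Prime p → 𝟙 (inClass? K c n (n * K) p) + leg n p ≤ classExp c 1 (n * K) p + 𝟙 (p ∣? K) * leg n p
      pointwise p pp with p ∣? K
      ... | yes p∣K = begin
        𝟙 (inClass? K c n (n * K) p) + leg n p          ≡⟨ cong (_+ leg n p) (𝟙-no (inClass? K c n (n * K) p) λ (_ , _ , eq) → prime-∤-coprime pp cop p∣K (subst (p ∣_) eq (%-presˡ-∣ ∣-refl p∣K))) ⟩
        leg n p                                         ≡⟨ *-identityˡ (leg n p) ⟨
        1 * leg n p                                     ≡⟨ cong (_* leg n p) (𝟙-yes (yes p∣K) p∣K) ⟨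
        𝟙 (yes p∣K) * leg n p                           ≤⟨ m≤n+m _ _ ⟩
        classExp c 1 (n * K) p + 𝟙 (yes p∣K) * leg n p  ∎
      ... | no p∤K = begin
        𝟙 in? + leg n p                                              ≡⟨ cong (_+ leg n p) (trans (sym (trans (cong (𝟙 in? *_) (∑-𝟙≟ E 1 ≤-refl 1≤E)) (*-identityʳ (𝟙 in?)))) (sym (∑-*ˡ E (𝟙 in?) _))) ⟩
        ∑ E (λ e → 𝟙 in? * 𝟙 (e ≟ 1)) + leg n p                      ≡⟨ ∑-+ E _ _ ⟨
        ∑ E (λ e → 𝟙 in? * 𝟙 (e ≟ 1) + n ÷ (p ^ e))                  ≤⟨ ∑-mono E (λ e _ _ → term e) ⟩
        classExp c 1 (n * K) p                                       ≤⟨ m≤m+n _ _ ⟩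
        classExp c 1 (n * K) p + 𝟙 (no p∤K) * leg n p                ∎
        where
        in? = inClass? K c n (n * K) p
        lower : ∀ e → n ÷ (p ^ e) ≤ cnt K c (1 * p ^ e) (n * K ÷ (p ^ e))
        lower e = subst (_≤ cnt K c (1 * p ^ e) (n * K ÷ (p ^ e))) (n*K÷d÷K n (p ^ e))
                    (cnt-lower c (1 * p ^ e) c<K (subst (λ t → Coprime t K) (sym (*-identityˡ (p ^ e))) (coprime-^ e pp p∤K)) (n * K ÷ (p ^ e)))
        term : ∀ e → 𝟙 in? * 𝟙 (e ≟ 1) + n ÷ (p ^ e) ≤ cnt K c (1 * p ^ e) (n * K ÷ (p ^ e))
        term e with e ≟ 1 | in?
        ... | no e≢1 | i = subst (λ t → t + n ÷ (p ^ e) ≤ cnt K c (1 * p ^ e) (n * K ÷ (p ^ e))) (sym (trans (cong (𝟙 i *_) (𝟙-no (no e≢1) e≢1)) (*-zeroʳ (𝟙 i)))) (lower e)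
        ... | yes e≡1 | no ¬i = subst (λ t → t + n ÷ (p ^ e) ≤ cnt K c (1 * p ^ e) (n * K ÷ (p ^ e))) (sym (cong (_* 𝟙 (yes e≡1)) (𝟙-no (no ¬i) ¬i))) (lower e)
        -- As `n < p`, the factorial contributes nothing, while `j = p` itself is a factor of the
        -- class product.
        ... | yes refl | yes i@(n<p , p≤nK , p≡c) = begin
          𝟙 (yes i) * 𝟙 (yes refl) + n ÷ (p ^ 1)      ≡⟨ cong₂ _+_ (cong₂ _*_ (𝟙-yes (yes i) i) (𝟙-yes (yes refl) refl)) (trans (cong (n ÷_) (*-identityʳ p)) (m<n⇒m÷n≡0 n<p)) ⟩
          1                                           ≡⟨ 𝟙-yes (((1 * p ^ 1) * 1) % K ≟ c) (trans (cong (_% K) (solve 1 (λ p → (con 1 :* (p :* con 1)) :* con 1 := p) refl p)) p≡c) ⟨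
          𝟙 (((1 * p ^ 1) * 1) % K ≟ c)               ≤⟨ ∑-term (n * K ÷ (p ^ 1)) _ 1 ≤-refl (m*n≤o⇒m≤o÷n 1 (p ^ 1) (n * K) (m^n>0 p {{prime⇒nonZero pp}} 1) (≤-trans (≤-reflexive (trans (*-identityˡ (p ^ 1)) (*-identityʳ p))) p≤nK)) ⟩
          cnt K c (1 * p ^ 1) (n * K ÷ (p ^ 1))       ∎

sumOver : List ℕ → (ℕ → ℕ) → ℕ
sumOver L f = sum (map f L)

prodOver : List ℕ → (ℕ → ℕ) → ℕ
prodOver L f = product (map f L)

sumOver-mono : ∀ L {f g : ℕ → ℕ} → (∀ μ → f μ ≤ g μ) → sumOver L f ≤ sumOver L g
sumOver-mono [] h = z≤n
sumOver-mono (μ ∷ L) h = +-mono-≤ (h μ) (sumOver-mono L h)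

sumOver-cong : ∀ {L} {f g : ℕ → ℕ} {P : ℕ → Set} → All P L → (∀ μ → P μ → f μ ≡ g μ) → sumOver L f ≡ sumOver L g
sumOver-cong [] h = refl
sumOver-cong (p ∷ ps) h = cong₂ _+_ (h _ p) (sumOver-cong ps h)

sumOver-+ : ∀ L (f g : ℕ → ℕ) → sumOver L (λ μ → f μ + g μ) ≡ sumOver L f + sumOver L g
sumOver-+ [] f g = refl
sumOver-+ (μ ∷ L) f g rewrite sumOver-+ L f g =
  solve 4 (λ a b c d → (a :+ b) :+ (c :+ d) := (a :+ c) :+ (b :+ d)) refl (f μ) (g μ) (sumOver L f) (sumOver L g)
  where open +-*-Solver

sumOver-∑ : ∀ L n (f : ℕ → ℕ → ℕ) → sumOver L (λ μ → ∑ n (f μ)) ≡ ∑ n (λ e → sumOver L (λ μ → f μ e))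
sumOver-∑ [] n f = sym (∑-zero n)
sumOver-∑ (μ ∷ L) n f = trans (cong (∑ n (f μ) +_) (sumOver-∑ L n f)) (sym (∑-+ n _ _))

prodOver-* : ∀ L (f g : ℕ → ℕ) → prodOver L (λ μ → f μ * g μ) ≡ prodOver L f * prodOver L g
prodOver-* [] f g = refl
prodOver-* (μ ∷ L) f g rewrite prodOver-* L f g =
  solve 4 (λ a b c d → (a :* b) :* (c :* d) := (a :* c) :* (b :* d)) refl (f μ) (g μ) (prodOver L f) (prodOver L g)
  where open +-*-Solver

prodOver-mono : ∀ {L} {f g : ℕ → ℕ} {P : ℕ → Set} → All P L → (∀ μ → P μ → f μ ≤ g μ) → prodOver L f ≤ prodOver L g
prodOver-mono [] h = ≤-refl
prodOver-mono (p ∷ ps) h = *-mono-≤ (h _ p) (prodOver-mono ps h)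

prodOver-pos : ∀ L {f : ℕ → ℕ} → (∀ μ → 1 ≤ f μ) → 1 ≤ prodOver L f
prodOver-pos [] h = ≤-refl
prodOver-pos (μ ∷ L) h = *-mono-≤ (h μ) (prodOver-pos L h)

÷≤ : ∀ m d → m ÷ d ≤ m
÷≤ m zero = z≤n
÷≤ m (suc d) = m/n≤m m (suc d)

coprime-* : ∀ {a b K} → Coprime a K → Coprime b K → Coprime (a * b) K
coprime-* ca cb {d} (d∣ab , d∣K) = cb (coprime-divisor (λ (e∣d , e∣a) → ca (e∣a , ∣-trans e∣d d∣K)) d∣ab , d∣K)

-- With x = N M, this compares the product of the j ≤ x, j ≡ c mod M, with the products of the j ≤ x / μ,
-- μ j ≡ c mod M.  By check, a prime p > y₀ with p ≢ c has no greater exponent (beyond that of N!) in the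
-- former than in the latter, so the excess of the former is due to the primes p ≡ c mod M.
module Master (X E : ℕ) (X<2^E : X < 2 ^ E) (1≤E : 1 ≤ E)
              (M : ℕ) .{{_ : NonZero M}} (c : ℕ) (c<M : c < M) (c-unit : Coprime c M)
              (L : List ℕ) (L-units : All (λ μ → Coprime μ M) L)
              (T : ℕ)
              (check : ∀ h t → Coprime h M → t < T →
                cnt M c h (t % M) ≤ 𝟙 (h % M ≟ c) + sumOver L (λ μ → cnt M c (μ * h) (t ÷ μ % M)))
              where
  open Chebyshev X E X<2^E 1≤E

  ℰ-sumOver : ∀ L (f : ℕ → ℕ → ℕ) → ℰ (λ p → sumOver L (λ μ → f μ p)) ≡ prodOver L (λ μ → ℰ (f μ))
  ℰ-sumOver [] f = ℰ-0 _ λ _ _ _ → refl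
  ℰ-sumOver (μ ∷ L) f = trans (ℰ-+ (f μ) _) (cong (ℰ (f μ) *_) (ℰ-sumOver L f))

  module _ (N y₀ : ℕ) (y₀-large : ∀ p → y₀ < p → N * M ÷ p < T) where

    x = N * M

    -- What the residue check leaves over: the primes up to `y₀`, for which `x ÷ p` is out of its
    -- range, the primes of the class itself, and the exponents e ≥ 2.
    rest : ℕ → ℕ
    rest p = 𝟙 (p ≤? y₀) + 𝟙 (inClass? M c y₀ x p) + higherPowers x p

    restₑ : ℕ → ℕ → ℕ
    restₑ p e = 𝟙 (e ≟ 1) * (𝟙 (p ≤? y₀) + 𝟙 (inClass? M c y₀ x p)) + 𝟙 ((2 ≤? e) ×-dec (p ^ e ≤? x))

    ∑-restₑ : ∀ p → ∑ E (restₑ p) ≡ rest p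
    ∑-restₑ p = trans (∑-+ E _ _) (cong (_+ higherPowers x p) (trans
      (∑-cong E (λ e _ _ → *-comm (𝟙 (e ≟ 1)) q))
      (trans (∑-*ˡ E q (λ e → 𝟙 (e ≟ 1))) (trans (cong (q *_) (∑-𝟙≟ E 1 ≤-refl 1≤E)) (*-identityʳ q)))))
      where q = 𝟙 (p ≤? y₀) + 𝟙 (inClass? M c y₀ x p)

    module _ {p : ℕ} (pp : Prime p) (p∤M : ¬ (p ∣ M)) where

      p^e-unit : ∀ e → Coprime (p ^ e) M
      p^e-unit e = coprime-^ e pp p∤M

      -- The complete blocks of length `M` account for exactly the exponent of `p` in N!; only the
      -- incomplete block remains to be compared.
      top : ∀ e → cnt M c (1 * p ^ e) (x ÷ (p ^ e)) ≡ N ÷ (p ^ e) + cnt M c (p ^ e) (x ÷ (p ^ e) % M)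
      top e = begin
        cnt M c (1 * p ^ e) t                   ≡⟨ cong (λ h → cnt M c h t) (*-identityˡ (p ^ e)) ⟩
        cnt M c (p ^ e) t                       ≡⟨ cnt-% M c (p ^ e) c<M (p^e-unit e) t ⟩
        t / M + cnt M c (p ^ e) (t % M)         ≡⟨ cong (_+ cnt M c (p ^ e) (t % M)) (trans (sym (÷≡/ t M)) (n*K÷d÷K M N (p ^ e))) ⟩
        N ÷ (p ^ e) + cnt M c (p ^ e) (t % M)   ∎
        where
        open ≡-Reasoning
        t = x ÷ (p ^ e)

      side : ∀ e μ → Coprime μ M → cnt M c (μ * p ^ e) (x ÷ μ ÷ (p ^ e)) ≡ N ÷ μ ÷ (p ^ e) + cnt M c (μ * p ^ e) (x ÷ (p ^ e) ÷ μ % M)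
      side e μ μ-unit = begin
        cnt M c h (x ÷ μ ÷ (p ^ e))             ≡⟨ cong (cnt M c h) (÷-÷-comm x μ (p ^ e)) ⟩
        cnt M c h t                             ≡⟨ cnt-% M c h c<M (coprime-* μ-unit (p^e-unit e)) t ⟩
        t / M + cnt M c h (t % M)               ≡⟨ cong (_+ cnt M c h (t % M)) (trans (sym (÷≡/ t M)) (begin
            x ÷ (p ^ e) ÷ μ ÷ M                 ≡⟨ ÷-÷-comm (x ÷ (p ^ e)) μ M ⟩
            x ÷ (p ^ e) ÷ M ÷ μ                 ≡⟨ cong (_÷ μ) (n*K÷d÷K M N (p ^ e)) ⟩
            N ÷ (p ^ e) ÷ μ                     ≡⟨ ÷-÷-comm N (p ^ e) μ ⟩
            N ÷ μ ÷ (p ^ e)                     ∎)) ⟩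
        N ÷ μ ÷ (p ^ e) + cnt M c h (t % M)     ∎
        where
        open ≡-Reasoning
        h = μ * p ^ e
        t = x ÷ (p ^ e) ÷ μ

      sides : ℕ → ℕ
      sides e = sumOver L (λ μ → cnt M c (μ * p ^ e) (x ÷ (p ^ e) ÷ μ % M))

      excess≤1 : ∀ e → cnt M c (p ^ e) (x ÷ (p ^ e) % M) ≤ 1
      excess≤1 e = cnt≤1 M c (p ^ e) c<M (p^e-unit e) _ (m%n≤n (x ÷ (p ^ e)) M)

      excess-vanishes : ∀ e → x < p ^ e → cnt M c (p ^ e) (x ÷ (p ^ e) % M) ≡ 0
      excess-vanishes e x<p^e = cong (cnt M c (p ^ e)) (trans (cong (_% M) (m<n⇒m÷n≡0 x<p^e)) (m<n⇒m%n≡m (>-nonZero⁻¹ M)))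

      -- An incomplete block counts at most 1, and 0 once `x < p ^ e`. So the exponents e ≥ 2 are
      -- paid for by `higherPowers`, and `check` is needed for e = 1 only.
      excess : ∀ e → 1 ≤ e → cnt M c (p ^ e) (x ÷ (p ^ e) % M) ≤ sides e + restₑ p e
      excess e 1≤e with m≤n⇒m<n∨m≡n 1≤e
      ... | inj₁ 2≤e = ≤-trans large (≤-trans (m≤n+m _ _) (m≤n+m _ (sides e)))
        where
        large : cnt M c (p ^ e) (x ÷ (p ^ e) % M) ≤ 𝟙 ((2 ≤? e) ×-dec (p ^ e ≤? x))
        large with p ^ e ≤? x
        ... | yes p^e≤x = ≤-trans (excess≤1 e) (≤-reflexive (sym (𝟙-yes ((2 ≤? e) ×-dec yes p^e≤x) (2≤e , p^e≤x))))
        ... | no p^e≰x = ≤-trans (≤-reflexive (excess-vanishes e (≰⇒> p^e≰x))) z≤n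
      ... | inj₂ refl = ≤-trans small (+-monoʳ-≤ (sides 1) (m≤m+n _ _))
        where
        small : cnt M c (p ^ 1) (x ÷ (p ^ 1) % M) ≤ sides 1 + 𝟙 (1 ≟ 1) * (𝟙 (p ≤? y₀) + 𝟙 (inClass? M c y₀ x p))
        small rewrite *-identityʳ p | 𝟙-yes (1 ≟ 1) refl | +-identityʳ (𝟙 (p ≤? y₀) + 𝟙 (inClass? M c y₀ x p)) with p ≤? y₀ | p ≤? x
        ... | yes p≤y₀ | _ = ≤-trans (subst (λ q → cnt M c q (x ÷ q % M) ≤ 1) (*-identityʳ p) (excess≤1 1))
                 (≤-trans (≤-reflexive (sym (𝟙-yes (yes p≤y₀) p≤y₀))) (≤-trans (m≤m+n _ _) (m≤n+m _ (sumOver L _))))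
        ... | no p≰y₀ | no p≰x = ≤-trans (≤-reflexive (subst (λ q → x < q → cnt M c q (x ÷ q % M) ≡ 0) (*-identityʳ p) (excess-vanishes 1) (≰⇒> p≰x))) z≤n
        ... | no p≰y₀ | yes p≤x = begin
          cnt M c p (x ÷ p % M)                                               ≤⟨ check p (x ÷ p) (subst (λ q → Coprime q M) (*-identityʳ p) (p^e-unit 1)) (y₀-large p (≰⇒> p≰y₀)) ⟩
          𝟙 (p % M ≟ c) + S                                                   ≡⟨ +-comm _ S ⟩
          S + 𝟙 (p % M ≟ c)                                                   ≤⟨ +-monoʳ-≤ S (≤-trans (𝟙-mono (p % M ≟ c) (inClass? M c y₀ x p) (λ eq → ≰⇒> p≰y₀ , p≤x , eq)) (m≤n+m _ _)) ⟩
          S + (𝟙 (no p≰y₀) + 𝟙 (inClass? M c y₀ x p))                         ∎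
          where
          open ≤-Reasoning
          S = sumOver L (λ μ → cnt M c (μ * p) (x ÷ p ÷ μ % M))

      unit-case : classExp M c 1 x p + sumOver L (λ μ → leg (N ÷ μ) p) ≤ leg N p + (sumOver L (λ μ → classExp M c μ (x ÷ μ) p) + rest p)
      unit-case = begin
        classExp M c 1 x p + sumOver L (λ μ → leg (N ÷ μ) p)
          ≡⟨ trans (cong (classExp M c 1 x p +_) (sumOver-∑ L E _)) (sym (∑-+ E _ _)) ⟩
        ∑ E (λ e → cnt M c (1 * p ^ e) (x ÷ (p ^ e)) + sumOver L (λ μ → N ÷ μ ÷ (p ^ e)))
          ≤⟨ ∑-mono E (λ e 1≤e _ → term e 1≤e) ⟩
        ∑ E (λ e → N ÷ (p ^ e) + (sumOver L (λ μ → cnt M c (μ * p ^ e) (x ÷ μ ÷ (p ^ e))) + restₑ p e))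
          ≡⟨ trans (∑-+ E _ _) (cong (leg N p +_) (trans (∑-+ E _ _) (cong₂ _+_ (sym (sumOver-∑ L E _)) (∑-restₑ p)))) ⟩
        leg N p + (sumOver L (λ μ → classExp M c μ (x ÷ μ) p) + rest p) ∎
        where
        open ≤-Reasoning
        open +-*-Solver
        term : ∀ e → 1 ≤ e → cnt M c (1 * p ^ e) (x ÷ (p ^ e)) + sumOver L (λ μ → N ÷ μ ÷ (p ^ e))
               ≤ N ÷ (p ^ e) + (sumOver L (λ μ → cnt M c (μ * p ^ e) (x ÷ μ ÷ (p ^ e))) + restₑ p e)
        term e 1≤e = begin
          cnt M c (1 * p ^ e) (x ÷ (p ^ e)) + S                         ≡⟨ cong (_+ S) (top e) ⟩
          N ÷ (p ^ e) + cnt M c (p ^ e) (x ÷ (p ^ e) % M) + S           ≤⟨ +-monoˡ-≤ S (+-monoʳ-≤ (N ÷ (p ^ e)) (excess e 1≤e)) ⟩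
          N ÷ (p ^ e) + (sides e + restₑ p e) + S                       ≡⟨ solve 4 (λ a b r s → a :+ (b :+ r) :+ s := a :+ ((s :+ b) :+ r)) refl (N ÷ (p ^ e)) (sides e) (restₑ p e) S ⟩
          N ÷ (p ^ e) + ((S + sides e) + restₑ p e)                     ≡⟨ cong (λ t → N ÷ (p ^ e) + (t + restₑ p e)) (trans (sym (sumOver-+ L _ _)) (sumOver-cong L-units (λ μ μ-unit → sym (side e μ μ-unit)))) ⟩
          N ÷ (p ^ e) + (sumOver L (λ μ → cnt M c (μ * p ^ e) (x ÷ μ ÷ (p ^ e))) + restₑ p e) ∎
          where S = sumOver L (λ μ → N ÷ μ ÷ (p ^ e))

    classExp-∣ : ∀ {p} → Prime p → p ∣ M → ∀ y → classExp M c 1 y p ≡ 0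
    classExp-∣ {p} pp p∣M y = ∑-none E λ { (suc e) _ _ → ∑-none (y ÷ (p ^ suc e)) λ m _ _ → 𝟙-no (((1 * p ^ suc e) * m) % M ≟ c)
      λ eq → prime-∤-coprime pp c-unit p∣M (subst (p ∣_) eq (%-presˡ-∣ (∣m⇒∣m*n m (∣n⇒∣m*n 1 (m∣m*n (p ^ e)))) p∣M)) }

    lhsExp rhsExp : ℕ → ℕ
    lhsExp p = classExp M c 1 x p + (sumOver L (λ μ → leg (N ÷ μ) p) + 𝟙 (p ∣? M) * leg N p)
    rhsExp p = leg N p + (sumOver L (λ μ → classExp M c μ (x ÷ μ) p + 𝟙 (p ∣? M) * leg (N ÷ μ) p) + rest p)

    pointwise : ∀ p → Prime p → lhsExp p ≤ rhsExp p
    pointwise p pp with p ∣? M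
    ... | no p∤M rewrite 𝟙-no (no p∤M) p∤M = begin
      classExp M c 1 x p + (sumOver L (λ μ → leg (N ÷ μ) p) + 0)    ≡⟨ cong (classExp M c 1 x p +_) (+-identityʳ _) ⟩
      classExp M c 1 x p + sumOver L (λ μ → leg (N ÷ μ) p)          ≤⟨ unit-case pp p∤M ⟩
      leg N p + (sumOver L (λ μ → classExp M c μ (x ÷ μ) p) + rest p)  ≤⟨ +-monoʳ-≤ (leg N p) (+-monoˡ-≤ (rest p) (sumOver-mono L λ μ → m≤m+n _ _)) ⟩
      leg N p + (sumOver L (λ μ → classExp M c μ (x ÷ μ) p + 0) + rest p)  ∎
      where open ≤-Reasoning
    -- For `p ∣ M` the class products do not contain `p`; the parts `R` on the two sides restore the
    -- balance of the factorials.
    ... | yes p∣M rewrite 𝟙-yes (yes p∣M) p∣M | classExp-∣ pp p∣M x = begin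
      sumOver L (λ μ → leg (N ÷ μ) p) + (leg N p + 0)               ≡⟨ trans (cong (sumOver L (λ μ → leg (N ÷ μ) p) +_) (+-identityʳ _)) (+-comm _ (leg N p)) ⟩
      leg N p + sumOver L (λ μ → leg (N ÷ μ) p)                     ≤⟨ +-monoʳ-≤ (leg N p) (≤-trans (sumOver-mono L λ μ → ≤-trans (≤-reflexive (sym (+-identityʳ _))) (m≤n+m _ (classExp M c μ (x ÷ μ) p))) (m≤m+n _ _)) ⟩
      leg N p + (sumOver L (λ μ → classExp M c μ (x ÷ μ) p + (leg (N ÷ μ) p + 0)) + rest p)  ∎
      where open ≤-Reasoning

    -- For k = `N ÷ μ`, the ratio to k! of the bound for the product up to `x ÷ μ`, times the
    -- `M`-part of k!. The index is k + 1 because `x ÷ μ` is rounded up to a multiple of `M`.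
    cofactor : ℕ → ℕ
    cofactor k = M ^ suc k * suc k * R M k

    -- In logarithms: with A = log M + ∑ log p / (p - 1) over p ∣ M, this says A (1 - ∑ 1 / μ) N ≤
    -- log `ℰ rest` + O(log x), a lower bound for the primes of the class once the other parts of
    -- `rest` are estimated.
    master : 1 ≤ N → x ≤ X → M ^ N * R M N ≤ x * prodOver L (λ μ → cofactor (N ÷ μ)) * ℰ rest
    master 1≤N x≤X = *-cancelʳ-≤ _ _ (fac N * F) {{>-nonZero (*-mono-≤ (fac-pos N) (prodOver-pos L λ μ → fac-pos (N ÷ μ)))}} (begin
      M ^ N * R M N * (fac N * F)                      ≡⟨ solve 4 (λ a b c d → a :* b :* (c :* d) := a :* c :* (d :* b)) refl (M ^ N) (R M N) (fac N) F ⟩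
      M ^ N * fac N * (F * R M N)                      ≤⟨ *-monoˡ-≤ (F * R M N) lower ⟩
      classProd M c 1 x * x * (F * R M N)              ≡⟨ solve 3 (λ a b c → a :* b :* c := a :* c :* b) refl (classProd M c 1 x) x (F * R M N) ⟩
      classProd M c 1 x * (F * R M N) * x              ≤⟨ *-monoˡ-≤ x middle ⟩
      fac N * (G * ℰ rest) * x                         ≤⟨ *-monoˡ-≤ x (*-monoʳ-≤ (fac N) (*-monoˡ-≤ (ℰ rest) G-upper)) ⟩
      fac N * (F * W * ℰ rest) * x                     ≡⟨ solve 5 (λ a b c d e → a :* (b :* c :* d) :* e := e :* c :* d :* (a :* b)) refl (fac N) F W (ℰ rest) x ⟩
      x * W * ℰ rest * (fac N * F)                     ∎)
      where
      open ≤-Reasoning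
      open +-*-Solver
      F = prodOver L (λ μ → fac (N ÷ μ))
      W = prodOver L (λ μ → cofactor (N ÷ μ))
      G = prodOver L (λ μ → classProd M c μ (x ÷ μ) * R M (N ÷ μ))
      lower′ : ∀ n → 1 ≤ n → M ^ n * fac n ≤ classProd M c 1 (n * M) * (n * M)
      lower′ (suc n) _ = classProd-lower M c c<M n
      lower : M ^ N * fac N ≤ classProd M c 1 x * x
      lower = lower′ N 1≤N
      G-upper : G ≤ F * W
      G-upper = ≤-trans (prodOver-mono L-units λ μ μ-unit → begin
          classProd M c μ (x ÷ μ) * R M (N ÷ μ)                    ≤⟨ *-monoˡ-≤ (R M (N ÷ μ)) (∏-monoˡ (<⇒≤ (x÷μ< μ)) λ i 1≤i _ → m^n>0 i {{>-nonZero 1≤i}} (𝟙 ((μ * i) % M ≟ c))) ⟩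
          classProd M c μ (suc (N ÷ μ) * M) * R M (N ÷ μ)          ≤⟨ *-monoˡ-≤ (R M (N ÷ μ)) (classProd-upper M c μ c<M μ-unit (suc (N ÷ μ))) ⟩
          M ^ suc (N ÷ μ) * fac (suc (N ÷ μ)) * R M (N ÷ μ)        ≡⟨ solve 4 (λ a f s r → a :* (f :* (s :* con 1)) :* r := f :* (a :* s :* r)) refl (M ^ suc (N ÷ μ)) (fac (N ÷ μ)) (suc (N ÷ μ)) (R M (N ÷ μ)) ⟩
          fac (N ÷ μ) * cofactor (N ÷ μ)                           ∎)
        (≤-reflexive (prodOver-* L _ _))
        where
        x÷μ< : ∀ μ → x ÷ μ < suc (N ÷ μ) * M
        x÷μ< μ = subst (λ t → x ÷ μ < suc t * M) (n*K÷d÷K M N μ) (m<[1+m÷n]*n (x ÷ μ) M (>-nonZero⁻¹ M))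
      N≤X : N ≤ X
      N≤X = ≤-trans (m≤m*n N M) x≤X
      middle : classProd M c 1 x * (F * R M N) ≤ fac N * (G * ℰ rest)
      middle = begin
        classProd M c 1 x * (F * R M N)
          ≡⟨ cong₂ _*_ (classProd-ℰ M c 1 x x≤X) (trans (cong (_* R M N) (trans (prodOver-cong L λ μ → fac-ℰ (N ÷ μ) (≤-trans (÷≤ N μ) N≤X)) (sym (ℰ-sumOver L _)))) (sym (ℰ-+ _ _))) ⟩
        ℰ (classExp M c 1 x) * ℰ (λ p → sumOver L (λ μ → leg (N ÷ μ) p) + 𝟙 (p ∣? M) * leg N p)
          ≡⟨ ℰ-+ _ _ ⟨
        ℰ lhsExp
          ≤⟨ ℰ-mono _ _ (λ p pp _ → pointwise p pp) ⟩
        ℰ rhsExp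
          ≡⟨ trans (ℰ-+ _ _) (cong (ℰ (leg N) *_) (ℰ-+ _ _)) ⟩
        ℰ (leg N) * (ℰ (λ p → sumOver L (λ μ → classExp M c μ (x ÷ μ) p + 𝟙 (p ∣? M) * leg (N ÷ μ) p)) * ℰ rest)
          ≡⟨ cong₂ _*_ (sym (fac-ℰ N N≤X)) (cong (_* ℰ rest) (trans (ℰ-sumOver L _) (prodOver-cong L λ μ → trans (ℰ-+ _ _) (cong (_* R M (N ÷ μ)) (sym (classProd-ℰ M c μ (x ÷ μ) (≤-trans (÷≤ x μ) x≤X))))))) ⟩
        fac N * (G * ℰ rest) ∎
        where
        prodOver-cong : ∀ L {f g : ℕ → ℕ} → (∀ μ → f μ ≡ g μ) → prodOver L f ≡ prodOver L g
        prodOver-cong [] h = refl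
        prodOver-cong (μ ∷ L) h = cong₂ _*_ (h μ) (prodOver-cong L h)

-- Logarithmic bounds

-- Logarithms to base 2 in units of 1/1000: x ≼ a means 1000 log₂ x ≤ a.
opaque
  scale : ℕ
  scale = 1000

infix 4 _≼_ _≽_
record _≼_ (x a : ℕ) : Set where
  constructor ≼-intro
  field ≼-elim : x ^ scale ≤ 2 ^ a
open _≼_

record _≽_ (x a : ℕ) : Set where
  constructor ≽-intro
  field ≽-elim : 2 ^ a ≤ x ^ scale
open _≽_

^-distribʳ-* : ∀ m n k → (m * n) ^ k ≡ m ^ k * n ^ k
^-distribʳ-* m n zero = refl
^-distribʳ-* m n (suc k) rewrite ^-distribʳ-* m n k =
  solve 4 (λ a b c d → a :* b :* (c :* d) := a :* c :* (b :* d)) refl m n (m ^ k) (n ^ k)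
  where open +-*-Solver

^-^-comm : ∀ m a b → (m ^ a) ^ b ≡ (m ^ b) ^ a
^-^-comm m a b = trans (^-*-assoc m a b) (trans (cong (m ^_) (*-comm a b)) (sym (^-*-assoc m b a)))

≼-mono : ∀ {x y a b} → x ≤ y → a ≤ b → y ≼ a → x ≼ b
≼-mono x≤y a≤b (≼-intro h) = ≼-intro (≤-trans (^-monoˡ-≤ scale x≤y) (≤-trans h (^-monoʳ-≤ 2 a≤b)))

≼-≤ : ∀ {x y a} → x ≤ y → y ≼ a → x ≼ a
≼-≤ x≤y = ≼-mono x≤y ≤-refl

≼-1 : ∀ {a} → 1 ≼ a
≼-1 {a} = ≼-intro (≤-trans (≤-reflexive (^-zeroˡ scale)) (m^n>0 2 a))

≼-* : ∀ {x y a b} → x ≼ a → y ≼ b → x * y ≼ a + b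
≼-* {x} {y} {a} {b} (≼-intro p) (≼-intro q) = ≼-intro (begin
  (x * y) ^ scale          ≡⟨ ^-distribʳ-* x y scale ⟩
  x ^ scale * y ^ scale    ≤⟨ *-mono-≤ p q ⟩
  2 ^ a * 2 ^ b            ≡⟨ ^-distribˡ-+-* 2 a b ⟨
  2 ^ (a + b)              ∎)
  where open ≤-Reasoning

≼-^ : ∀ {x a} n → x ≼ a → x ^ n ≼ a * n
≼-^ {x} {a} n (≼-intro p) = ≼-intro (begin
  (x ^ n) ^ scale    ≡⟨ ^-^-comm x n scale ⟩
  (x ^ scale) ^ n    ≤⟨ ^-monoˡ-≤ n p ⟩
  (2 ^ a) ^ n        ≡⟨ ^-*-assoc 2 a n ⟩
  2 ^ (a * n)        ∎)
  where open ≤-Reasoning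

≼-2^ : ∀ L → 2 ^ L ≼ L * scale
≼-2^ L = ≼-intro (≤-reflexive (^-*-assoc 2 L scale))

≽-* : ∀ {x y a b} → x ≽ a → y ≽ b → x * y ≽ a + b
≽-* {x} {y} {a} {b} (≽-intro p) (≽-intro q) = ≽-intro (begin
  2 ^ (a + b)              ≡⟨ ^-distribˡ-+-* 2 a b ⟩
  2 ^ a * 2 ^ b            ≤⟨ *-mono-≤ p q ⟩
  x ^ scale * y ^ scale    ≡⟨ ^-distribʳ-* x y scale ⟨
  (x * y) ^ scale          ∎)
  where open ≤-Reasoning

≽-^ : ∀ {x a} n → x ≽ a → x ^ n ≽ a * n
≽-^ {x} {a} n (≽-intro p) = ≽-intro (begin
  2 ^ (a * n)        ≡⟨ ^-*-assoc 2 a n ⟨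
  (2 ^ a) ^ n        ≤⟨ ^-monoˡ-≤ n p ⟩
  (x ^ scale) ^ n    ≡⟨ ^-^-comm x n scale ⟨
  (x ^ n) ^ scale    ∎)
  where open ≤-Reasoning

≽-weaken : ∀ {x a b} → b ≤ a → x ≽ a → x ≽ b
≽-weaken b≤a (≽-intro p) = ≽-intro (≤-trans (^-monoʳ-≤ 2 b≤a) p)

≽-≼ : ∀ {x y a b} → x ≽ a → x ≤ y → y ≼ b → a ≤ b
≽-≼ {a = a} {b} (≽-intro p) x≤y (≼-intro q) = ≮⇒≥ λ b<a → <⇒≱ (^-monoʳ-< 2 (s≤s (s≤s z≤n)) b<a) (≤-trans p (≤-trans (^-monoˡ-≤ scale x≤y) q))

≼-∏ : ∀ n {f b : ℕ → ℕ} → (∀ i → 1 ≤ i → i ≤ n → f i ≼ b i) → ∏ n f ≼ ∑ n b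
≼-∏ zero h = ≼-1
≼-∏ (suc n) h = ≼-* (≼-∏ n λ i 1≤i i≤n → h i 1≤i (m≤n⇒m≤1+n i≤n)) (h (suc n) (s≤s z≤n) ≤-refl)

≼-prodOver : ∀ L {f b : ℕ → ℕ} → (∀ μ → f μ ≼ b μ) → prodOver L f ≼ sumOver L b
≼-prodOver [] h = ≼-1
≼-prodOver (μ ∷ L) h = ≼-* (h μ) (≼-prodOver L h)

legendre-≼ : ∀ E n {q ρ} → 1 ≤ q → q ≼ ρ * pred q → q ^ legendre E n q ≼ ρ * n
legendre-≼ E n {q} {ρ} 1≤q h = ≼-mono ≤-refl (begin
  ρ * pred q * legendre E n q    ≡⟨ *-assoc ρ (pred q) _ ⟩
  ρ * (pred q * legendre E n q)  ≤⟨ *-monoʳ-≤ ρ (legendre-upper E n q 1≤q) ⟩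
  ρ * n                          ∎) (≼-^ (legendre E n q) h)
  where open ≤-Reasoning

coprime-∣-* : ∀ {a b d} → Coprime b a → a ∣ d → b ∣ d → a * b ∣ d
coprime-∣-* {a} {b} cop (divides e refl) b∣ = subst (a * b ∣_) (*-comm a e) (*-monoʳ-∣ a (coprime-divisor cop (subst (b ∣_) (*-comm e a) b∣)))

%-crt : ∀ {p q} M κ .{{_ : NonZero M}} .{{_ : NonZero κ}} .{{_ : NonZero (M * κ)}} → Coprime κ M →
        p % M ≡ q % M → p % κ ≡ q % κ → p % (M * κ) ≡ q % (M * κ)
%-crt {p} {q} M κ cop eqM eqκ with ≤-total p q
... | inj₁ p≤q = ∣∸⇒%≡ (M * κ) p≤q (coprime-∣-* cop (%≡⇒∣∸ M p≤q eqM) (%≡⇒∣∸ κ p≤q eqκ))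
... | inj₂ q≤p = sym (∣∸⇒%≡ (M * κ) q≤p (coprime-∣-* cop (%≡⇒∣∸ M q≤p (sym eqM)) (%≡⇒∣∸ κ q≤p (sym eqκ))))

module Radical (X E : ℕ) (X<2^E : X < 2 ^ E) (1≤E : 1 ≤ E) where
  open Chebyshev X E X<2^E 1≤E

  module _ (M : ℕ) (ps : List ℕ) (ps-prime : All Prime ps) (ps≤X : All (_≤ X) ps)
           (radical : ∀ p → Prime p → 𝟙 (p ∣? M) ≡ sumOver ps (λ q → 𝟙 (p ≟ q))) where

    ℰ-sumOver-≟ : ∀ ps → All Prime ps → All (_≤ X) ps → ∀ (a : ℕ → ℕ) → ℰ (λ p → sumOver ps (λ q → 𝟙 (p ≟ q)) * a p) ≡ prodOver ps (λ q → q ^ a q)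
    ℰ-sumOver-≟ [] [] [] a = ℰ-0 _ λ _ _ _ → refl
    ℰ-sumOver-≟ (q ∷ ps) (pq ∷ pps) (q≤X ∷ ps≤X) a = begin
      ℰ (λ p → (𝟙 (p ≟ q) + sumOver ps (λ q → 𝟙 (p ≟ q))) * a p)             ≡⟨ ℰ-cong _ _ (λ p _ _ → *-distribʳ-+ (a p) (𝟙 (p ≟ q)) _) ⟩
      ℰ (λ p → 𝟙 (p ≟ q) * a p + sumOver ps (λ q → 𝟙 (p ≟ q)) * a p)         ≡⟨ ℰ-+ _ _ ⟩
      ℰ (λ p → 𝟙 (p ≟ q) * a p) * ℰ (λ p → sumOver ps (λ q → 𝟙 (p ≟ q)) * a p)  ≡⟨ cong₂ _*_ (ℰ-single a pq q≤X) (ℰ-sumOver-≟ ps pps ps≤X a) ⟩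
      q ^ a q * prodOver ps (λ q → q ^ a q)                                  ∎
      where open ≡-Reasoning

    R-radical : ∀ m → R M m ≡ prodOver ps (λ q → q ^ leg m q)
    R-radical m = trans (ℰ-cong _ _ λ p pp _ → cong (_* leg m p) (radical p pp)) (ℰ-sumOver-≟ ps ps-prime ps≤X (leg m))

  R-split : ∀ M κ {r} → Prime r → r ≤ X → (∀ p → Prime p → p ∣ κ → p ≡ r) → ∀ m → R (M * κ) m ≤ R M m * r ^ leg m r
  R-split M κ {r} pr r≤X only m = begin
    R (M * κ) m                                              ≤⟨ ℰ-mono _ _ split ⟩
    ℰ (λ p → 𝟙 (p ∣? M) * leg m p + 𝟙 (p ≟ r) * leg m p)     ≡⟨ ℰ-+ _ _ ⟩
    R M m * ℰ (λ p → 𝟙 (p ≟ r) * leg m p)                    ≡⟨ cong (R M m *_) (ℰ-single (leg m) pr r≤X) ⟩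
    R M m * r ^ leg m r                                      ∎
    where
    open ≤-Reasoning
    split : ∀ p → Prime p → p ≤ X → 𝟙 (p ∣? M * κ) * leg m p ≤ 𝟙 (p ∣? M) * leg m p + 𝟙 (p ≟ r) * leg m p
    split p pp _ = ≤-trans (*-monoˡ-≤ (leg m p) indicator) (≤-reflexive (*-distribʳ-+ (leg m p) (𝟙 (p ∣? M)) (𝟙 (p ≟ r))))
      where
      indicator : 𝟙 (p ∣? M * κ) ≤ 𝟙 (p ∣? M) + 𝟙 (p ≟ r)
      indicator with p ∣? M * κ
      ... | no ∤ = ≤-trans (≤-reflexive (𝟙-no (no ∤) ∤)) z≤n
      ... | yes ∣Mκ with euclidsLemma M κ pp ∣Mκ
      ...   | inj₁ p∣M = ≤-trans (𝟙≤1 _) (≤-trans (≤-reflexive (sym (𝟙-yes (p ∣? M) p∣M))) (m≤m+n _ _))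
      ...   | inj₂ p∣κ = ≤-trans (𝟙≤1 _) (≤-trans (≤-reflexive (sym (𝟙-yes (p ≟ r) (only p pp p∣κ)))) (m≤n+m _ _))

-- Primes in prescribed classes to a further modulus

module Kills (X E : ℕ) (X<2^E : X < 2 ^ E) (1≤E : 1 ≤ E)
             (M : ℕ) .{{_ : NonZero M}} (c : ℕ) (c<M : c < M) (c-unit : Coprime c M)
             (n x y₀ : ℕ) (x≤X : x ≤ X) where
  open Chebyshev X E X<2^E 1≤E

  -- The condition ¬ (p ∣ n) makes p % (M * κ) a unit: a prime p ∣ κ with p ≡ n mod κ would divide n.
  Killed : ∀ κ .{{_ : NonZero κ}} → ℕ → Set
  Killed κ p = (y₀ < p × p ≤ x × p % M ≡ c) × p % κ ≡ n % κ × ¬ (p ∣ n)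

  opaque
    killed? : ∀ κ .{{_ : NonZero κ}} p → Dec (Killed κ p)
    killed? κ p = inClass? M c y₀ x p ×-dec (p % κ ≟ n % κ) ×-dec ¬? (p ∣? n)

  module _ (κ : ℕ) .{{_ : NonZero κ}} (κ-unit : Coprime κ M) where
    private
      K = M * κ
      instance _ = m*n≢0 M κ

    -- By the Chinese remainder theorem all killed primes agree modulo `M * κ`, so that a single
    -- one, found by search, determines the class. If the search fails, there is nothing to bound.
    killed-class : (∀ p → Prime p → p ≤ X → ¬ Killed κ p) ⊎
                   (∃[ c′ ] c′ < K × Coprime c′ K × (∀ p → Prime p → Killed κ p → p % K ≡ c′))
    killed-class with anyUpTo? (λ p → prime? p ×-dec killed? κ p) (suc X)
    ... | no none = inj₁ λ p pp p≤X k → none (p , s≤s p≤X , pp , k)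
    ... | yes (p₀ , _ , pp₀ , (_ , _ , p₀≡c) , p₀≡n , p₀∤n) = inj₂ (p₀ % K , m%n<n p₀ K , unit , λ p pp ((_ , _ , p≡c) , p≡n , _) →
            %-crt M κ κ-unit (trans p≡c (sym p₀≡c)) (trans p≡n (sym p₀≡n)))
      where
      p₀∤K : ¬ (p₀ ∣ K)
      p₀∤K p₀∣K with euclidsLemma M κ pp₀ p₀∣K
      ... | inj₁ p₀∣M = prime-∤-coprime pp₀ c-unit p₀∣M (subst (p₀ ∣_) p₀≡c (%-presˡ-∣ ∣-refl p₀∣M))
      ... | inj₂ p₀∣κ = p₀∤n (∣n∣m%n⇒∣m p₀∣κ (subst (p₀ ∣_) p₀≡n (%-presˡ-∣ ∣-refl p₀∣κ)))
      unit : Coprime (p₀ % K) K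
      unit (d∣ , d∣K) = prime-coprime pp₀ p₀∤K (d∣K , ∣n∣m%n⇒∣m d∣K d∣)

    classBound : ℕ → ℕ
    classBound m = K ^ m * R K m

    classBound-pos : ∀ m → 1 ≤ classBound m
    classBound-pos m = *-mono-≤ (m^n>0 K m) (ℰ-pos _)

    ℰ-none : (∀ p → Prime p → p ≤ X → ¬ Killed κ p) → ℰ (λ p → 𝟙 (killed? κ p)) ≡ 1
    ℰ-none h = ℰ-0 _ λ p pp p≤X → 𝟙-no (killed? κ p) (h p pp p≤X)

    killed-one : ∀ m → m ≤ y₀ → x ≤ m * K → m * K ≤ X → ℰ (λ p → 𝟙 (killed? κ p)) ≤ classBound m
    killed-one m m≤y₀ x≤mK mK≤X with killed-class
    ... | inj₁ none = ≤-trans (≤-reflexive (ℰ-none none)) (classBound-pos m)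
    ... | inj₂ (c′ , c′<K , unit , cls) = ≤-trans
            (ℰ-mono _ _ λ p pp _ → 𝟙-mono (killed? κ p) (inClass? K c′ m (m * K) p)
              λ k@((y₀<p , p≤x , _) , _) → ≤-<-trans m≤y₀ y₀<p , ≤-trans p≤x x≤mK , cls p pp k)
            (class-primes-upper K c′ m c′<K unit mK≤X)

    -- `class-primes-upper` with index m reaches only the primes above m. For small `κ` the index m₁
    -- ≈ N / κ exceeds `y₀`, and the primes between them take a second application with index m₂.
    killed-two : ∀ m₁ m₂ → m₂ ≤ y₀ → m₁ ≤ m₂ * K → m₂ * K ≤ X → x ≤ m₁ * K → m₁ * K ≤ X →
                 ℰ (λ p → 𝟙 (killed? κ p)) ≤ classBound m₁ * classBound m₂
    killed-two m₁ m₂ m₂≤y₀ m₁≤ m₂K≤X x≤ m₁K≤X with killed-class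
    ... | inj₁ none = ≤-trans (≤-reflexive (ℰ-none none)) (*-mono-≤ (classBound-pos m₁) (classBound-pos m₂))
    ... | inj₂ (c′ , c′<K , unit , cls) = begin
      ℰ (λ p → 𝟙 (killed? κ p))                                                              ≤⟨ ℰ-mono _ _ split ⟩
      ℰ (λ p → 𝟙 (inClass? K c′ m₁ (m₁ * K) p) + 𝟙 (inClass? K c′ m₂ (m₂ * K) p))            ≡⟨ ℰ-+ _ _ ⟩
      ℰ (λ p → 𝟙 (inClass? K c′ m₁ (m₁ * K) p)) * ℰ (λ p → 𝟙 (inClass? K c′ m₂ (m₂ * K) p))  ≤⟨ *-mono-≤ (class-primes-upper K c′ m₁ c′<K unit m₁K≤X) (class-primes-upper K c′ m₂ c′<K unit m₂K≤X) ⟩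
      classBound m₁ * classBound m₂                                                          ∎
      where
      open ≤-Reasoning
      split : ∀ p → Prime p → p ≤ X → 𝟙 (killed? κ p) ≤ 𝟙 (inClass? K c′ m₁ (m₁ * K) p) + 𝟙 (inClass? K c′ m₂ (m₂ * K) p)
      split p pp _ with m₁ <? p
      ... | yes m₁<p = ≤-trans (𝟙-mono (killed? κ p) (inClass? K c′ m₁ (m₁ * K) p)
              λ k@((_ , p≤x , _) , _) → m₁<p , ≤-trans p≤x x≤ , cls p pp k) (m≤m+n _ _)
      ... | no m₁≮p = ≤-trans (𝟙-mono (killed? κ p) (inClass? K c′ m₂ (m₂ * K) p)
              λ k@((y₀<p , _ , _) , _) → ≤-<-trans m₂≤y₀ y₀<p , ≤-trans (≮⇒≥ m₁≮p) m₁≤ , cls p pp k) (m≤n+m _ _)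

-- Error terms

suc-pred-^ : ∀ E → pred (2 ^ E) < 2 ^ E
suc-pred-^ E = ≤-reflexive (suc-pred (2 ^ E) {{m^n≢0 2 E}})

nonzero : ℕ → ℕ
nonzero zero = 0
nonzero (suc _) = 1

unit30 : ℕ → ℕ
unit30 r = nonzero (r % 2) * (nonzero (r % 3) * nonzero (r % 5))

unit30-cong : ∀ a b → a % 2 ≡ b % 2 → a % 3 ≡ b % 3 → a % 5 ≡ b % 5 → unit30 a ≡ unit30 b
unit30-cong a b e₂ e₃ e₅ = cong₂ _*_ (cong nonzero e₂) (cong₂ _*_ (cong nonzero e₃) (cong nonzero e₅))

prime-∣ : ∀ {p q} → Prime p → Prime q → p ∣ q → p ≡ q
prime-∣ pp pq p∣q with prime⇒irreducible pq p∣q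
... | inj₁ refl = contradiction (prime≥2 pp) λ { (s≤s ()) }
... | inj₂ p≡q = p≡q

prime[3] : Prime 3
prime[3] = from-yes (prime? 3)

prime[5] : Prime 5
prime[5] = from-yes (prime? 5)

nonzero-∤ : ∀ {r} d .{{_ : NonZero d}} → ¬ (d ∣ r) → nonzero (r % d) ≡ 1
nonzero-∤ {r} d d∤r with r % d in eq
... | zero = contradiction (m%n≡0⇒n∣m r d eq) d∤r
... | suc _ = refl

unit30-∤ : ∀ r → ¬ (2 ∣ r) → ¬ (3 ∣ r) → ¬ (5 ∣ r) → unit30 r ≡ 1
unit30-∤ r 2∤r 3∤r 5∤r = cong₂ _*_ (nonzero-∤ 2 2∤r) (cong₂ _*_ (nonzero-∤ 3 3∤r) (nonzero-∤ 5 5∤r))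

unit30-+30 : ∀ r → unit30 (30 + r) ≡ unit30 r
unit30-+30 r = unit30-cong (30 + r) r (reduce 2 15 refl) (reduce 3 10 refl) (reduce 5 6 refl)
  where
  reduce : ∀ d q .{{_ : NonZero d}} → 30 ≡ q * d → (30 + r) % d ≡ r % d
  reduce d q eq = %-remove-+ˡ r (divides q eq)

primeCount : ℕ → ℕ
primeCount s = ∑ s (λ p → 𝟙 (prime? p))

prime-indicator : ∀ p → 𝟙 (prime? p) ≤ unit30 p + 𝟙 (p ≟ 2) + 𝟙 (p ≟ 3) + 𝟙 (p ≟ 5)
prime-indicator p with prime? p
... | no ¬pp = ≤-trans (≤-reflexive (𝟙-no (no ¬pp) ¬pp)) z≤n
... | yes pp = ≤-trans (𝟙≤1 _) (≮⇒≥ λ sum<1 → small (n<1⇒n≡0 sum<1))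
  where
  small : unit30 p + 𝟙 (p ≟ 2) + 𝟙 (p ≟ 3) + 𝟙 (p ≟ 5) ≢ 0
  small eq = contradiction (trans (sym (unit30-∤ p
      (λ d → absurd prime[2] d (m+n≡0⇒n≡0 (unit30 p) u₂)) (λ d → absurd prime[3] d (m+n≡0⇒n≡0 (unit30 p + 𝟙 (p ≟ 2)) u₃))
      (λ d → absurd prime[5] d (m+n≡0⇒n≡0 _ eq)))) (m+n≡0⇒m≡0 (unit30 p) u₂)) λ ()
    where
    u₃ = m+n≡0⇒m≡0 (unit30 p + 𝟙 (p ≟ 2) + 𝟙 (p ≟ 3)) eq
    u₂ = m+n≡0⇒m≡0 (unit30 p + 𝟙 (p ≟ 2)) u₃
    absurd : ∀ {q} → Prime q → q ∣ p → 𝟙 (p ≟ q) ≢ 0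
    absurd pq q∣p eq₀ = contradiction (trans (sym (𝟙-yes (p ≟ _) (sym (prime-∣ pq pp q∣p)))) eq₀) λ ()

∑-unit30 : ∀ s → ∑ s unit30 ≤ 8 * suc (s / 30)
∑-unit30 s = begin
  ∑ s unit30                                ≡⟨ cong (λ t → ∑ t unit30) (trans (m≡m%n+[m/n]*n s 30) (+-comm (s % 30) _)) ⟩
  ∑ (s / 30 * 30 + s % 30) unit30           ≡⟨ ∑-periodic 30 unit30 unit30-+30 (s / 30) (s % 30) ⟩
  s / 30 * 8 + ∑ (s % 30) unit30            ≤⟨ +-monoʳ-≤ (s / 30 * 8) (∑-monoˡ unit30 (m%n≤n s 30)) ⟩
  s / 30 * 8 + 8                            ≡⟨ solve 1 (λ q → q :* con 8 :+ con 8 := con 8 :* (con 1 :+ q)) refl (s / 30) ⟩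
  8 * suc (s / 30)                          ∎
  where
  open ≤-Reasoning
  open +-*-Solver

∑-𝟙≟≤1 : ∀ n k → ∑ n (λ i → 𝟙 (i ≟ k)) ≤ 1
∑-𝟙≟≤1 zero k = z≤n
∑-𝟙≟≤1 (suc n) k with suc n ≟ k
... | yes refl = ≤-reflexive (trans (cong₂ _+_ (∑-none n λ i _ i≤n → 𝟙-no (i ≟ suc n) (<⇒≢ (s≤s i≤n))) (𝟙-yes (yes refl) refl)) refl)
... | no n≢k = ≤-trans (≤-reflexive (trans (cong (∑ n (λ i → 𝟙 (i ≟ k)) +_) (𝟙-no (no n≢k) n≢k)) (+-identityʳ _))) (∑-𝟙≟≤1 n k)

-- Primes other than 2, 3, 5 lie in the 8 classes prime to 30. So crude a count is enough, since the
-- number of primes up to √n enters the error terms only.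
primeCount-upper : ∀ s → primeCount s ≤ 8 * suc (s / 30) + 3
primeCount-upper s = begin
  primeCount s                                                              ≤⟨ ∑-mono s (λ p _ _ → prime-indicator p) ⟩
  ∑ s (λ p → unit30 p + 𝟙 (p ≟ 2) + 𝟙 (p ≟ 3) + 𝟙 (p ≟ 5))                  ≡⟨ trans (∑-+ s _ _) (cong (_+ ∑ s (λ p → 𝟙 (p ≟ 5))) (trans (∑-+ s _ _) (cong (_+ ∑ s (λ p → 𝟙 (p ≟ 3))) (∑-+ s _ _)))) ⟩
  ∑ s unit30 + ∑ s (λ p → 𝟙 (p ≟ 2)) + ∑ s (λ p → 𝟙 (p ≟ 3)) + ∑ s (λ p → 𝟙 (p ≟ 5))  ≤⟨ +-mono-≤ (+-mono-≤ (+-mono-≤ (∑-unit30 s) (∑-𝟙≟≤1 s 2)) (∑-𝟙≟≤1 s 3)) (∑-𝟙≟≤1 s 5) ⟩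
  8 * suc (s / 30) + 1 + 1 + 1                                              ≡⟨ solve 1 (λ a → a :+ con 1 :+ con 1 :+ con 1 := a :+ con 3) refl (8 * suc (s / 30)) ⟩
  8 * suc (s / 30) + 3                                                      ∎
  where
  open ≤-Reasoning
  open +-*-Solver

∑-cutoff : ∀ n s (f : ℕ → ℕ) → ∑ n (λ i → 𝟙 (i ≤? s) * f i) ≤ ∑ s f
∑-cutoff zero s f = z≤n
∑-cutoff (suc n) s f with suc n ≤? s
... | no n≰s = ≤-trans (≤-reflexive (trans (cong (λ t → ∑ n (λ i → 𝟙 (i ≤? s) * f i) + t * f (suc n)) (𝟙-no (no n≰s) n≰s)) (+-identityʳ _))) (∑-cutoff n s f)
... | yes n≤s = ≤-trans (+-mono-≤ (∑-mono n λ i _ _ → *-monoˡ-≤ (f i) (𝟙≤1 (i ≤? s))) (*-monoˡ-≤ (f (suc n)) (𝟙≤1 (yes n≤s))))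
      (≤-trans (≤-reflexive (cong₂ _+_ (∑-cong n λ i _ _ → *-identityˡ (f i)) (*-identityˡ (f (suc n))))) (∑-monoˡ f n≤s))

module Size (n L : ℕ) (1≤n : 1 ≤ n) (n<2^L : n < 2 ^ L) where
  -- The products formed later involve numbers up to (1 + M) n with M < 64, hence up to 64 n;
  -- therefore 6 more binary digits than for n.
  E X : ℕ
  E = L + 6
  X = pred (2 ^ E)

  X<2^E : X < 2 ^ E
  X<2^E = suc-pred-^ E

  1≤E : 1 ≤ E
  1≤E = ≤-trans (s≤s z≤n) (m≤n+m 6 L)

  open Radical X E X<2^E 1≤E public
  open Chebyshev X E X<2^E 1≤E public

  64n≤X : ∀ {m} → m ≤ 64 * n → m ≤ X
  64n≤X {m} m≤ = <⇒≤pred (begin-strict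
    m                ≤⟨ m≤ ⟩
    64 * n           <⟨ *-monoʳ-< 64 n<2^L ⟩
    64 * 2 ^ L       ≡⟨ *-comm 64 (2 ^ L) ⟩
    2 ^ L * 2 ^ 6    ≡⟨ ^-distribˡ-+-* 2 L 6 ⟨
    2 ^ E            ∎)
    where open ≤-Reasoning

  n≤X : n ≤ X
  n≤X = 64n≤X (m≤n*m n 64)

  2≤X : 2 ≤ X
  2≤X = 64n≤X (≤-trans (≤ᵇ⇒≤ 2 64 _) (m≤m*n 64 n {{>-nonZero 1≤n}}))

  n≼ : n ≼ scale * L
  n≼ = ≼-mono (<⇒≤ n<2^L) (≤-reflexive (*-comm L scale)) (≼-2^ L)

  -- The primes dividing n are left out of `Killed`; their product divides n and costs no more than
  -- log n.
  divisors-≼ : ℰ (λ p → 𝟙 (p ∣? n)) ≼ scale * L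
  divisors-≼ = ≼-mono (≤-trans (ℰ-mono _ _ λ p _ _ → ≤-trans (≤-reflexive (cong (λ d → 𝟙 (d ∣? n)) (sym (*-identityʳ p)))) (∑-term E (λ e → 𝟙 (p ^ e ∣? n)) 1 ≤-refl 1≤E))
      (≤-reflexive (sym (ℰ-ν n 1≤n n≤X)))) ≤-refl n≼

  R2-upper : ∀ m → R 2 m ≤ 2 ^ m
  R2-upper m = begin
    R 2 m                                  ≤⟨ ℰ-mono _ _ (λ p pp _ → *-monoˡ-≤ (leg m p) (𝟙-mono (p ∣? 2) (p ≟ 2) (prime-∣ pp prime[2]))) ⟩
    ℰ (λ p → 𝟙 (p ≟ 2) * leg m p)          ≡⟨ ℰ-single (leg m) prime[2] 2≤X ⟩
    2 ^ leg m 2                            ≤⟨ ^-monoʳ-≤ 2 (≤-trans (≤-reflexive (sym (+-identityʳ _))) (legendre-upper E m 2 (s≤s z≤n))) ⟩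
    2 ^ m                                  ∎
    where open ≤-Reasoning

  -- Induction on dyadic size: the odd primes in (h, 2h] are bounded by 4 ^ h.
  primorial : ∀ j y → y ≤ n → y ≤ 2 ^ suc j → ℰ (λ p → 𝟙 (p ≤? y)) ≤ 4 ^ (y + j)
  primorial zero y y≤n y≤2 = begin
    ℰ (λ p → 𝟙 (p ≤? y))                   ≤⟨ ℰ-mono _ _ (λ p pp _ → exp p pp) ⟩
    ℰ (λ p → 𝟙 (p ≟ 2) * (𝟙 (2 ≤? y)))     ≡⟨ ℰ-single (λ _ → 𝟙 (2 ≤? y)) prime[2] 2≤X ⟩
    2 ^ 𝟙 (2 ≤? y)                         ≤⟨ ^-monoʳ-≤ 2 le ⟩
    2 ^ (2 * (y + 0))                      ≡⟨ ^-*-assoc 2 2 (y + 0) ⟨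
    4 ^ (y + 0)                            ∎
    where
    open ≤-Reasoning
    exp : ∀ p → Prime p → 𝟙 (p ≤? y) ≤ 𝟙 (p ≟ 2) * 𝟙 (2 ≤? y)
    exp p pp with p ≤? y
    ... | no p≰y = ≤-trans (≤-reflexive (𝟙-no (no p≰y) p≰y)) z≤n
    ... | yes p≤y = ≤-trans (𝟙≤1 (yes p≤y)) (≤-reflexive (sym (cong₂ _*_ (𝟙-yes (p ≟ 2) (≤-antisym (≤-trans p≤y y≤2) (prime≥2 pp))) (𝟙-yes (2 ≤? y) (≤-trans (prime≥2 pp) p≤y)))))
    le : 𝟙 (2 ≤? y) ≤ 2 * (y + 0)
    le with 2 ≤? y
    ... | no 2≰y = ≤-trans (≤-reflexive (𝟙-no (no 2≰y) 2≰y)) z≤n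
    ... | yes 2≤y = ≤-trans (𝟙≤1 (yes 2≤y)) (≤-trans (≤-trans (n≤1+n 1) 2≤y) (≤-trans (m≤m+n y 0) (m≤n*m (y + 0) 2)))
  primorial (suc j) y y≤n y≤ with y ≤? 2 ^ suc j
  ... | yes y≤′ = ≤-trans (primorial j y y≤n y≤′) (^-monoʳ-≤ 4 (+-monoʳ-≤ y (n≤1+n j)))
  ... | no y≰′ = begin
    ℰ (λ p → 𝟙 (p ≤? y))                                               ≤⟨ ℰ-mono _ _ (λ p pp _ → exp p pp) ⟩
    ℰ (λ p → 𝟙 (p ≤? h) + 𝟙 (inClass? 2 1 h (h * 2) p))                ≡⟨ ℰ-+ _ _ ⟩
    ℰ (λ p → 𝟙 (p ≤? h)) * ℰ (λ p → 𝟙 (inClass? 2 1 h (h * 2) p))      ≤⟨ *-mono-≤ (primorial j h (≤-trans h≤y y≤n) h≤) (≤-trans (class-primes-upper 2 1 h (s≤s (s≤s z≤n)) (λ (d∣1 , _) → ∣1⇒≡1 d∣1) h*2≤X) (*-monoʳ-≤ (2 ^ h) (R2-upper h))) ⟩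
    4 ^ (h + j) * (2 ^ h * 2 ^ h)                                      ≡⟨ cong (4 ^ (h + j) *_) (^-distribʳ-* 2 2 h) ⟨
    4 ^ (h + j) * 4 ^ h                                                ≡⟨ ^-distribˡ-+-* 4 (h + j) h ⟨
    4 ^ (h + j + h)                                                    ≤⟨ ^-monoʳ-≤ 4 (begin
        h + j + h        ≡⟨ solve 2 (λ h j → h :+ j :+ h := h :* con 2 :+ j) refl h j ⟩
        h * 2 + j        ≤⟨ +-monoˡ-≤ j h*2≤ ⟩
        suc y + j        ≡⟨ +-suc y j ⟨
        y + suc j        ∎) ⟩
    4 ^ (y + suc j)                                                    ∎
    where
    open ≤-Reasoning
    open +-*-Solver
    h = suc y / 2
    h*2≤ : h * 2 ≤ suc y
    h*2≤ = m/n*n≤m (suc y) 2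
    3≤y : 2 < y
    3≤y = ≤-<-trans (m≤m*n 2 (2 ^ j) {{m^n≢0 2 j}}) (≰⇒> y≰′)
    h≤y : h ≤ y
    h≤y = *-cancelʳ-≤ h y 2 (≤-trans h*2≤ (≤-trans (+-monoˡ-≤ y (≤-trans (s≤s z≤n) 3≤y)) (≤-reflexive (solve 1 (λ y → y :+ y := y :* con 2) refl y))))
    h≤ : h ≤ 2 ^ suc j
    h≤ = ≤-pred (m<n*o⇒m/o<n (≤-trans (s≤s (s≤s y≤)) (≤-reflexive (solve 1 (λ a → con 2 :+ con 2 :* a := (con 1 :+ a) :* con 2) refl (2 ^ suc j)))))
    h*2≤X : h * 2 ≤ X
    h*2≤X = 64n≤X (≤-trans h*2≤ (≤-trans (s≤s y≤n) (≤-trans (+-monoˡ-≤ n 1≤n) (≤-trans (≤-reflexive (solve 1 (λ n → n :+ n := con 2 :* n) refl n)) (*-monoˡ-≤ n (≤ᵇ⇒≤ 2 64 _))))))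
    2≤h : 2 ≤ h
    2≤h = /-monoˡ-≤ 2 (s≤s 3≤y)
    y<  : y ≤ h * 2
    y< = ≤-pred (≤-pred (≤-trans (m<[1+m÷n]*n (suc y) 2 (s≤s z≤n)) ≤-refl))
    exp : ∀ p → Prime p → 𝟙 (p ≤? y) ≤ 𝟙 (p ≤? h) + 𝟙 (inClass? 2 1 h (h * 2) p)
    exp p pp with p ≤? h
    ... | yes p≤h = ≤-trans (𝟙≤1 (p ≤? y)) (≤-trans (≤-reflexive (sym (𝟙-yes (yes p≤h) p≤h))) (m≤m+n _ _))
    ... | no p≰h = ≤-trans (𝟙-mono (p ≤? y) (inClass? 2 1 h (h * 2) p) λ p≤y → ≰⇒> p≰h , ≤-trans p≤y y< , odd) (m≤n+m _ _)
      where
      odd : p % 2 ≡ 1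
      odd with p % 2 in eq | m%n<n p 2
      ... | 0 | _ = contradiction (≤-trans (≤-reflexive (sym (prime-∣ prime[2] pp (m%n≡0⇒n∣m p 2 eq)))) 2≤h) p≰h
      ... | 1 | _ = refl
      ... | suc (suc _) | s≤s (s≤s ())

  small-primes-≼ : ∀ y → y ≤ n → ℰ (λ p → 𝟙 (p ≤? y)) ≼ 2 * scale * (y + L)
  small-primes-≼ y y≤n = ≼-mono (primorial L y y≤n (≤-trans y≤n (≤-trans (<⇒≤ n<2^L) (^-monoʳ-≤ 2 (n≤1+n L)))))
    ≤-refl (≼-^ (y + L) (≼-2^ 2))

  powers-upper : ∀ {p} x → Prime p → 1 ≤ x → ∀ k → p ^ ∑ k (λ e → 𝟙 ((2 ≤? e) ×-dec (p ^ e ≤? x))) ≤ x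
  powers-upper x pp 1≤x zero = 1≤x
  powers-upper {p} x pp 1≤x (suc k) with p ^ suc k ≤? x
  ... | yes p^k≤x = ≤-trans (^-monoʳ-≤ p {{prime⇒nonZero pp}} (≤-trans (+-mono-≤ (∑-mono k λ e _ _ → 𝟙≤1 ((2 ≤? e) ×-dec (p ^ e ≤? x))) (𝟙≤1 ((2 ≤? suc k) ×-dec yes p^k≤x)))
                        (≤-reflexive (trans (cong (_+ 1) (trans (∑-const k 1) (*-identityʳ k))) (+-comm k 1))))) p^k≤x
  ... | no p^k≰x = ≤-trans (≤-reflexive (cong (p ^_) (trans (cong (∑ k _ +_) (𝟙-no ((2 ≤? suc k) ×-dec no p^k≰x) λ (_ , le) → p^k≰x le)) (+-identityʳ _)))) (powers-upper x pp 1≤x k)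

  -- Only the primes up to `s` ≈ √n have a proper power up to `x`, and for each of them these powers
  -- contribute a factor of at most n.
  higherPowers-≼ : ∀ x s → 1 ≤ x → x ≤ n → n < suc s * suc s → ℰ (higherPowers x) ≼ scale * L * primeCount s
  higherPowers-≼ x s 1≤x x≤n n<[1+s]² = ≼-mono (≤-trans
      (ℰ-≤-^ (higherPowers x) (λ p → 𝟙 (p ≤? s) * 𝟙 (prime? p)) n 1≤n λ p pp _ → bound p pp)
      (^-monoʳ-≤ n {{>-nonZero 1≤n}} (∑-cutoff X s (λ p → 𝟙 (prime? p)))))
      ≤-refl (≼-^ (primeCount s) n≼)
    where
    bound : ∀ p → Prime p → p ^ higherPowers x p ≤ n ^ (𝟙 (p ≤? s) * 𝟙 (prime? p))
    bound p pp with p ≤? s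
    ... | yes p≤s = ≤-trans (powers-upper x pp 1≤x E) (≤-trans x≤n (≤-reflexive (sym (trans (cong (n ^_) (cong₂ _*_ (𝟙-yes (yes p≤s) p≤s) (𝟙-yes (prime? p) pp))) (^-identityʳ n)))))
    ... | no p≰s = ≤-trans (≤-reflexive (cong (p ^_) (∑-none E λ e _ _ → 𝟙-no ((2 ≤? e) ×-dec (p ^ e ≤? x)) λ (2≤e , p^e≤x) → <⇒≱ (begin-strict
        x                ≤⟨ x≤n ⟩
        n                <⟨ n<[1+s]² ⟩
        suc s * suc s    ≤⟨ *-mono-≤ (≰⇒> p≰s) (≰⇒> p≰s) ⟩
        p * p            ≡⟨ cong (p *_) (*-identityʳ p) ⟨
        p ^ 2            ≤⟨ ^-monoʳ-≤ p {{prime⇒nonZero pp}} 2≤e ⟩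
        p ^ e            ∎) p^e≤x))) (m^n>0 n {{>-nonZero 1≤n}} (𝟙 (no p≰s) * 𝟙 (prime? p)))
      where open ≤-Reasoning

module KillBounds (n L : ℕ) (1≤n : 1 ≤ n) (n<2^L : n < 2 ^ L)
                  (M : ℕ) .{{_ : NonZero M}} (c : ℕ) (c<M : c < M) (c-unit : Coprime c M) (M<64 : M < 64)
                  (N y₀ : ℕ) (NM<n : N * M < n) where
  open Size n L 1≤n n<2^L public

  x : ℕ
  x = N * M

  x≤X : x ≤ X
  x≤X = ≤-trans (<⇒≤ NM<n) n≤X

  open Kills X E X<2^E 1≤E M c c<M c-unit n x y₀ x≤X public
    using (killed?; classBound; ℰ-none; killed-one; killed-two)

  module _ {α ρ : ℕ} (M≼α : M ≼ α) (R≼ρ : ∀ m → R M m ≼ ρ * m)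
           (κ : ℕ) .{{_ : NonZero κ}} (κ-unit : Coprime κ M) {r : ℕ} (pr : Prime r) (r∣κ : r ∣ κ)
           (only : ∀ p → Prime p → p ∣ κ → p ≡ r)
           {ℓ ρ′ : ℕ} (κ≼ℓ : κ ≼ ℓ) (r≼ρ′ : r ≼ ρ′ * pred r) (ρ-small : ρ + ρ′ ≤ 3 * scale) where
    private
      K = M * κ
      instance
        _ = m*n≢0 M κ
        _ = >-nonZero 1≤n

    unit-cost : ℕ
    unit-cost = α + ℓ + (ρ + ρ′)

    -- The index k + 1 in place of k costs one more factor `M * κ`, at most 2 ^ (L + 6), and one
    -- more `ρ + ρ′`, at most 3 bits.
    fixed-cost : ℕ
    fixed-cost = scale * (L + 9)

    unkilled : n < κ → ℰ (λ p → 𝟙 (killed? κ p)) ≡ 1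
    unkilled n<κ = ℰ-none κ κ-unit λ p _ _ ((_ , p≤x , _) , p≡n , _) →
      let p<n = ≤-<-trans p≤x NM<n in
      <⇒≢ p<n (trans (sym (m<n⇒m%n≡m (<-trans p<n n<κ))) (trans p≡n (m<n⇒m%n≡m n<κ)))

    classBound-≼ : κ ≤ n → ∀ k → classBound κ κ-unit (suc k) ≼ k * unit-cost + fixed-cost
    classBound-≼ κ≤n k = ≼-mono (*-monoʳ-≤ (K ^ suc k) (R-split M κ pr r≤X only (suc k))) (begin
      scale * (L + 6) + (α + ℓ) * k + (ρ * suc k + ρ′ * suc k)
        ≡⟨ solve 6 (λ s a k r q l → s :* (l :+ con 6) :+ a :* k :+ (r :* (con 1 :+ k) :+ q :* (con 1 :+ k))
                     := (k :* (a :+ (r :+ q)) :+ s :* (l :+ con 6)) :+ (r :+ q)) refl scale (α + ℓ) k ρ ρ′ L ⟩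
      k * unit-cost + scale * (L + 6) + (ρ + ρ′)
        ≤⟨ +-monoʳ-≤ (k * unit-cost + scale * (L + 6)) ρ-small ⟩
      k * unit-cost + scale * (L + 6) + 3 * scale
        ≡⟨ solve 3 (λ a s l → a :+ s :* (l :+ con 6) :+ con 3 :* s := a :+ s :* (l :+ con 9)) refl (k * unit-cost) scale L ⟩
      k * unit-cost + fixed-cost ∎)
      (≼-* (≼-* K≼ (≼-^ k (≼-* M≼α κ≼ℓ))) (≼-* (R≼ρ (suc k)) (legendre-≼ E (suc k) {ρ = ρ′} (prime≥1 pr) r≼ρ′)))
      where
      open ≤-Reasoning
      open +-*-Solver
      r≤X : r ≤ X
      r≤X = ≤-trans (≤-trans (∣⇒≤ r∣κ) κ≤n) n≤X
      K≼ : K ≼ scale * (L + 6)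
      K≼ = ≼-mono (begin
        M * κ          ≤⟨ *-mono-≤ (<⇒≤ M<64) (≤-trans κ≤n (<⇒≤ n<2^L)) ⟩
        2 ^ 6 * 2 ^ L  ≡⟨ trans (^-distribˡ-+-* 2 L 6) (*-comm (2 ^ L) (2 ^ 6)) ⟨
        2 ^ (L + 6)    ∎) (≤-reflexive (*-comm (L + 6) scale)) (≼-2^ (L + 6))

    m₁ : ℕ
    m₁ = suc (N ÷ κ)

    N≤m₁κ : N ≤ m₁ * κ
    N≤m₁κ = <⇒≤ (m<[1+m÷n]*n N κ (>-nonZero⁻¹ κ))

    x≤m₁K : x ≤ m₁ * K
    x≤m₁K = ≤-trans (*-monoˡ-≤ M N≤m₁κ) (≤-reflexive (solve 3 (λ a k m → a :* k :* m := a :* (m :* k)) refl m₁ κ M))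
      where open +-*-Solver

    [1+M]n≤X : ∀ {m} → m ≤ n + M * n → m ≤ X
    [1+M]n≤X m≤ = 64n≤X (≤-trans m≤ (*-monoˡ-≤ n M<64))

    m₁K≤X : κ ≤ n → m₁ * K ≤ X
    m₁K≤X κ≤n = [1+M]n≤X (begin
      K + N ÷ κ * K        ≡⟨ solve 3 (λ q m k → m :* k :+ q :* (m :* k) := q :* k :* m :+ m :* k) refl (N ÷ κ) M κ ⟩
      N ÷ κ * κ * M + M * κ   ≤⟨ +-mono-≤ (*-monoˡ-≤ M (m÷n*n≤m N κ)) (*-monoʳ-≤ M κ≤n) ⟩
      x + M * n            ≤⟨ +-monoˡ-≤ (M * n) (<⇒≤ NM<n) ⟩
      n + M * n            ∎)
      where
      open ≤-Reasoning
      open +-*-Solver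

    killed-≼ : m₁ ≤ y₀ → ℰ (λ p → 𝟙 (killed? κ p)) ≼ N ÷ κ * unit-cost + fixed-cost
    killed-≼ m₁≤y₀ = by-size (≤-<-connex κ n)
      where
      by-size : κ ≤ n ⊎ n < κ → ℰ (λ p → 𝟙 (killed? κ p)) ≼ N ÷ κ * unit-cost + fixed-cost
      by-size (inj₁ κ≤n) = ≼-≤ (killed-one κ κ-unit m₁ m₁≤y₀ x≤m₁K (m₁K≤X κ≤n)) (classBound-≼ κ≤n (N ÷ κ))
      by-size (inj₂ n<κ) = ≼-≤ (≤-reflexive (unkilled n<κ)) ≼-1

    killed-≼₂ : suc (m₁ ÷ K) ≤ y₀ → ℰ (λ p → 𝟙 (killed? κ p)) ≼ (N ÷ κ * unit-cost + fixed-cost) + (m₁ ÷ K * unit-cost + fixed-cost)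
    killed-≼₂ m₂≤y₀ = by-size (≤-<-connex κ n)
      where
      open ≤-Reasoning
      m₂K≤X : κ ≤ n → suc (m₁ ÷ K) * K ≤ X
      m₂K≤X κ≤n = [1+M]n≤X (begin
        K + m₁ ÷ K * K     ≤⟨ +-mono-≤ (*-monoʳ-≤ M κ≤n) (m÷n*n≤m m₁ K) ⟩
        M * n + m₁         ≡⟨ +-comm (M * n) m₁ ⟩
        m₁ + M * n         ≤⟨ +-monoˡ-≤ (M * n) (≤-trans (s≤s (≤-trans (÷≤ N κ) (m≤m*n N M))) NM<n) ⟩
        n + M * n          ∎)
      by-size : κ ≤ n ⊎ n < κ → ℰ (λ p → 𝟙 (killed? κ p)) ≼ (N ÷ κ * unit-cost + fixed-cost) + (m₁ ÷ K * unit-cost + fixed-cost)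
      by-size (inj₁ κ≤n) = ≼-≤ (killed-two κ κ-unit m₁ (suc (m₁ ÷ K)) m₂≤y₀ (<⇒≤ (m<[1+m÷n]*n m₁ K (>-nonZero⁻¹ K))) (m₂K≤X κ≤n) x≤m₁K (m₁K≤X κ≤n))
                             (≼-* (classBound-≼ κ≤n (N ÷ κ)) (classBound-≼ κ≤n (m₁ ÷ K)))
      by-size (inj₂ n<κ) = ≼-≤ (≤-reflexive (unkilled n<κ)) ≼-1

-- Sums over prime squares

-- The number of binary digits of y, for y < 2 ^ fuel.
bits : ℕ → ℕ → ℕ
bits zero y = 0
bits (suc fuel) zero = 0
bits (suc fuel) y@(suc _) = suc (bits fuel (y / 2))

<2^bits : ∀ fuel y → y < 2 ^ fuel → y < 2 ^ bits fuel y
<2^bits zero y y< = y<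
<2^bits (suc fuel) zero y< = s≤s z≤n
<2^bits (suc fuel) y@(suc _) y< = begin-strict
  y                        ≡⟨ m≡m%n+[m/n]*n y 2 ⟩
  y % 2 + y / 2 * 2        <⟨ +-monoˡ-< (y / 2 * 2) (m%n<n y 2) ⟩
  suc (y / 2) * 2          ≤⟨ *-monoˡ-≤ 2 (<2^bits fuel (y / 2) (m<n*o⇒m/o<n (subst (y <_) (*-comm 2 (2 ^ fuel)) y<))) ⟩
  2 ^ bits fuel (y / 2) * 2  ≡⟨ *-comm (2 ^ bits fuel (y / 2)) 2 ⟩
  2 ^ suc (bits fuel (y / 2))  ∎
  where open ≤-Reasoning

-- The sum over squares r² is evaluated term by term for r ≤ 2 ^ j₀ and dyadically beyond.
opaque
  unfolding scale

  j₀ half eighth Q : ℕ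
  j₀ = 12
  half = 500
  eighth = 125
  Q = 1000000

  2^j₀≡4096 : 2 ^ j₀ ≡ 4096
  2^j₀≡4096 = refl

  instance
    Q-nonZero : NonZero Q
    Q-nonZero = _

  scale≡2*half : scale ≡ 2 * half
  scale≡2*half = refl

  scale≡8*eighth : scale ≡ 8 * eighth
  scale≡8*eighth = refl

-- A computable bound for 1000 log₂ r with steps of 125: the number of binary digits of r⁸ exceeds 8
-- log₂ r. For r ≤ 4096 = 2¹² these are at most 97 digits.
log-weight : ℕ → ℕ
log-weight r = eighth * bits 97 (r ^ 8)

2^97-bound : 4096 ^ 8 < 2 ^ 97
2^97-bound = <ᵇ⇒< (4096 ^ 8) (2 ^ 97) _

≼-log-weight : ∀ r → r ≤ 2 ^ j₀ → r ≼ log-weight r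
≼-log-weight r r≤ = ≼-intro (begin
  r ^ scale                      ≡⟨ cong (r ^_) scale≡8*eighth ⟩
  r ^ (8 * eighth)               ≡⟨ ^-*-assoc r 8 eighth ⟨
  (r ^ 8) ^ eighth               ≤⟨ ^-monoˡ-≤ eighth (<⇒≤ (<2^bits 97 (r ^ 8) (≤-<-trans (^-monoˡ-≤ 8 (subst (r ≤_) 2^j₀≡4096 r≤)) 2^97-bound))) ⟩
  (2 ^ b) ^ eighth               ≡⟨ ^-*-assoc 2 b eighth ⟩
  2 ^ (b * eighth)               ≡⟨ cong (2 ^_) (*-comm b eighth) ⟩
  2 ^ log-weight r               ∎)
  where
  open ≤-Reasoning
  b = bits 97 (r ^ 8)

r²≤2^[r-1] : ∀ k → (7 + k) * (7 + k) ≤ 2 ^ (6 + k)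
r²≤2^[r-1] zero = ≤ᵇ⇒≤ 49 64 _
r²≤2^[r-1] (suc k) = begin
  (8 + k) * (8 + k)             ≤⟨ m≤m+n _ (34 + k * k + 12 * k) ⟩
  (8 + k) * (8 + k) + (34 + k * k + 12 * k)  ≡⟨ solve 1 (λ k → (con 8 :+ k) :* (con 8 :+ k) :+ (con 34 :+ k :* k :+ con 12 :* k) := con 2 :* ((con 7 :+ k) :* (con 7 :+ k))) refl k ⟩
  2 * ((7 + k) * (7 + k))       ≤⟨ *-monoʳ-≤ 2 (r²≤2^[r-1] k) ⟩
  2 ^ suc (6 + k)               ∎
  where
  open ≤-Reasoning
  open +-*-Solver

-- Amounts to r² ≤ 2 ^ (r - 1). It replaces log₂ r / (r - 1), the density of the prime r in a
-- factorial, by a uniform 1/2.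
≼-half : ∀ {r} → 7 ≤ r → r ≼ half * pred r
≼-half {r} 7≤r with m≤n⇒∃[o]m+o≡n 7≤r
... | k , refl = ≼-intro (begin
  (7 + k) ^ scale                 ≡⟨ cong ((7 + k) ^_) scale≡2*half ⟩
  (7 + k) ^ (2 * half)            ≡⟨ ^-*-assoc (7 + k) 2 half ⟨
  ((7 + k) ^ 2) ^ half            ≤⟨ ^-monoˡ-≤ half (≤-trans (≤-reflexive (cong ((7 + k) *_) (*-identityʳ (7 + k)))) (r²≤2^[r-1] k)) ⟩
  (2 ^ (6 + k)) ^ half            ≡⟨ ^-*-assoc 2 (6 + k) half ⟩
  2 ^ ((6 + k) * half)            ≡⟨ cong (2 ^_) (*-comm (6 + k) half) ⟩
  2 ^ (half * (6 + k))            ∎)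
  where open ≤-Reasoning

square-weight : ℕ → ℕ → ℕ → ℕ
square-weight base r₀ zero = 0
square-weight base r₀ r@(suc _) =
  if (r <ᵇ r₀) ∨ (unit30 r ≡ᵇ 0) then 0 else suc (Q * (base + 2 * log-weight r) / (r * r))

square-weight-eq : ∀ base r₀ r .{{_ : NonZero r}} .{{_ : NonZero (r * r)}} → (r <ᵇ r₀) ∨ (unit30 r ≡ᵇ 0) ≡ false →
                   square-weight base r₀ r ≡ suc (Q * (base + 2 * log-weight r) / (r * r))
square-weight-eq base r₀ (suc r) eq = cong (λ t → if t then 0 else suc (Q * (base + 2 * log-weight (suc r)) / (suc r * suc r))) eq

≥⇒≮ᵇ : ∀ {m n} → n ≤ m → (m <ᵇ n) ≡ false
≥⇒≮ᵇ {m} {n} n≤m with m <ᵇ n in eq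
... | false = refl
... | true = contradiction (<ᵇ⇒< m n (subst T (sym eq) _)) (≤⇒≯ n≤m)

module SquareKills (n L : ℕ) (1≤n : 1 ≤ n) (n<2^L : n < 2 ^ L)
                   (M : ℕ) .{{_ : NonZero M}} (c : ℕ) (c<M : c < M) (c-unit : Coprime c M) (M<64 : M < 64)
                   (N : ℕ) (NM<n : N * M < n)
                   (M-smooth : ∀ p → Prime p → p ∣ M → p ≤ 5)
                   (α ρ : ℕ) (M≼α : M ≼ α) (ρ-small : ρ + half ≤ 3 * scale)
                   (s r₀ : ℕ) (11≤r₀ : 11 ≤ r₀) where

  open KillBounds n L 1≤n n<2^L M c c<M c-unit M<64 N (suc (N ÷ 121)) NM<n public

  base D : ℕ
  base = α + ρ + half
  D = scale * (L + 9)

  relevant? : ∀ r → Dec (r₀ ≤ r × r ≤ s × Prime r)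
  relevant? r = (r₀ ≤? r) ×-dec (r ≤? s) ×-dec prime? r

  squareKill : ℕ → ℕ → ℕ
  squareKill zero p = 0
  squareKill r@(suc _) p = 𝟙 (relevant? r) * 𝟙 (killed? (r * r) p)

  module _ (R≼ρ : ∀ m → R M m ≼ ρ * m) where

    squareKill-≼ : ∀ r {λ′} → r ≼ λ′ → ℰ (squareKill r) ≼ 𝟙 (relevant? r) * (N ÷ (r * r) * (base + 2 * λ′)) + 𝟙 (relevant? r) * D
    squareKill-≼ zero _ = ≼-mono (≤-reflexive (ℰ-0 _ λ _ _ _ → refl)) ≤-refl ≼-1
    squareKill-≼ r@(suc _) {λ′} r≼ = by-relevance (relevant? r)
      where
      open +-*-Solver
      open ≤-Reasoning
      lead-cost : ℕ
      lead-cost = N ÷ (r * r) * (base + 2 * λ′)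
      only : Prime r → ∀ p → Prime p → p ∣ r * r → p ≡ r
      only pr p pp p∣ with euclidsLemma r r pp p∣
      ... | inj₁ d = prime-∣ pp pr d
      ... | inj₂ d = prime-∣ pp pr d
      unit : 11 ≤ r → Prime r → Coprime (r * r) M
      unit 11≤r pr = subst (λ t → Coprime t M) (cong (r *_) (*-identityʳ r))
        (coprime-^ 2 pr λ r∣M → <⇒≱ (≤-trans (≤ᵇ⇒≤ 6 11 _) 11≤r) (M-smooth r pr r∣M))
      ÷-antitone : ∀ d e .{{_ : NonZero d}} → d ≤ e → N ÷ e ≤ N ÷ d
      ÷-antitone (suc d) (suc e) d≤e = /-monoʳ-≤ N d≤e
      cost : N ÷ (r * r) * (α + (λ′ + λ′) + (ρ + half)) + D ≡ 1 * lead-cost + 1 * D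
      cost = solve 6 (λ q a l ρ h d → q :* (a :+ (l :+ l) :+ (ρ :+ h)) :+ d := con 1 :* (q :* (a :+ ρ :+ h :+ con 2 :* l)) :+ con 1 :* d) refl (N ÷ (r * r)) α λ′ ρ half D
      by-relevance : Dec (r₀ ≤ r × r ≤ s × Prime r) → ℰ (squareKill r) ≼ 𝟙 (relevant? r) * lead-cost + 𝟙 (relevant? r) * D
      by-relevance (no ¬rel) = ≼-≤ (≤-reflexive (ℰ-0 (squareKill r) λ p _ _ → cong (_* 𝟙 (killed? (r * r) p)) (𝟙-no (relevant? r) ¬rel))) ≼-1
      by-relevance (yes rel@(r₀≤r , _ , pr)) = subst (λ t → ℰ (squareKill r) ≼ t * lead-cost + t * D) (sym (𝟙-yes (relevant? r) rel))
        (subst (ℰ (squareKill r) ≼_) cost (≼-≤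
          (≤-reflexive (ℰ-cong (squareKill r) (λ p → 𝟙 (killed? (r * r) p)) λ p _ _ → trans (cong (_* 𝟙 (killed? (r * r) p)) (𝟙-yes (relevant? r) rel)) (*-identityˡ _)))
          (killed-≼ {ρ = ρ} M≼α R≼ρ (r * r) (unit 11≤r pr) pr (m∣m*n r) (only pr) {ρ′ = half} (≼-* r≼ r≼) (≼-half (≤-trans (≤ᵇ⇒≤ 7 11 _) 11≤r)) ρ-small
            -- Because r² ≥ 11² = 121, the index `N ÷ (r * r)` + 1 is at most `y₀`, and a single
            -- application covers all primes in question.
            (s≤s (÷-antitone 121 (r * r) (*-mono-≤ 11≤r 11≤r))))))
        where
        11≤r : 11 ≤ r
        11≤r = ≤-trans 11≤r₀ r₀≤r

    relevant-prime : ∀ r → 𝟙 (relevant? r) ≤ 𝟙 (r ≤? s) * 𝟙 (prime? r)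
    relevant-prime r with relevant? r
    ... | no ¬rel = ≤-trans (≤-reflexive (𝟙-no (no ¬rel) ¬rel)) z≤n
    ... | yes rel@(_ , r≤s , pr) = ≤-trans (𝟙≤1 (yes rel)) (≤-reflexive (sym (cong₂ _*_ (𝟙-yes (r ≤? s) r≤s) (𝟙-yes (prime? r) pr))))

    -- Beyond `2 ^ j₀` every integer of a dyadic block is charged, with the quotient of the left end
    -- and the logarithm of the right end.
    lead : ℕ → ℕ
    lead zero = ∑ (2 ^ j₀) (λ r → 𝟙 (relevant? r) * (N ÷ (r * r) * (base + 2 * log-weight r)))
    lead (suc k) = lead k + 2 ^ (k + j₀) * (N ÷ (2 ^ (k + j₀) * 2 ^ (k + j₀)) * (base + 2 * (suc (k + j₀) * scale)))

    squareKills-dyadic : ∀ k → ∏ (2 ^ (k + j₀)) (λ r → ℰ (squareKill r)) ≼ lead k + ∑ (2 ^ (k + j₀)) (λ r → 𝟙 (relevant? r) * D)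
    squareKills-dyadic zero = ≼-mono ≤-refl (≤-reflexive (∑-+ (2 ^ j₀) _ _)) (≼-∏ (2 ^ j₀) λ r _ r≤ → squareKill-≼ r (≼-log-weight r r≤))
    squareKills-dyadic (suc k) = subst (λ t → ∏ t (λ r → ℰ (squareKill r)) ≼ lead (suc k) + ∑ t (λ r → 𝟙 (relevant? r) * D)) (cong (h +_) (sym (+-identityʳ h)))
      (≼-mono (≤-reflexive (∏-split h h _)) sumup (≼-* (squareKills-dyadic k) (≼-∏ h λ i _ i≤h → squareKill-≼ (h + i) (h+i≼ i i≤h))))
      where
      open ≤-Reasoning
      open +-*-Solver
      h = 2 ^ (k + j₀)
      C = base + 2 * (suc (k + j₀) * scale)
      h+i≼ : ∀ i → i ≤ h → h + i ≼ suc (k + j₀) * scale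
      h+i≼ i i≤h = ≼-mono (≤-trans (+-monoʳ-≤ h i≤h) (≤-reflexive (cong (h +_) (sym (+-identityʳ h))))) ≤-refl (≼-2^ (suc (k + j₀)))
      block : ∀ i → 𝟙 (relevant? (h + i)) * (N ÷ ((h + i) * (h + i)) * C) ≤ N ÷ (h * h) * C
      block i = ≤-trans (*-monoˡ-≤ _ (𝟙≤1 (relevant? (h + i)))) (≤-trans (≤-reflexive (*-identityˡ _)) (*-monoˡ-≤ C (÷-anti (m^n>0 2 (k + j₀)) (m≤m+n h i))))
        where
        ÷-anti : ∀ {d e} → 1 ≤ d → d ≤ e → N ÷ (e * e) ≤ N ÷ (d * d)
        ÷-anti {suc d} {suc e} _ d≤e = /-monoʳ-≤ N (*-mono-≤ d≤e d≤e)
      sumup : (lead k + ∑ h (λ r → 𝟙 (relevant? r) * D)) + ∑ h (λ i → 𝟙 (relevant? (h + i)) * (N ÷ ((h + i) * (h + i)) * C) + 𝟙 (relevant? (h + i)) * D)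
              ≤ lead (suc k) + ∑ (h + h) (λ r → 𝟙 (relevant? r) * D)
      sumup = begin
        (lead k + ∑ h d) + ∑ h (λ i → 𝟙 (relevant? (h + i)) * (N ÷ ((h + i) * (h + i)) * C) + d (h + i))
          ≡⟨ cong (lead k + ∑ h d +_) (∑-+ h _ _) ⟩
        (lead k + ∑ h d) + (∑ h (λ i → 𝟙 (relevant? (h + i)) * (N ÷ ((h + i) * (h + i)) * C)) + ∑ h (λ i → d (h + i)))
          ≤⟨ +-monoʳ-≤ (lead k + ∑ h d) (+-monoˡ-≤ (∑ h (λ i → d (h + i))) (≤-trans (∑-mono h λ i _ _ → block i) (≤-reflexive (∑-const h (N ÷ (h * h) * C))))) ⟩
        (lead k + ∑ h d) + (h * (N ÷ (h * h) * C) + ∑ h (λ i → d (h + i)))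
          ≡⟨ solve 4 (λ a b c e → (a :+ b) :+ (c :+ e) := (a :+ c) :+ (b :+ e)) refl (lead k) (∑ h d) (h * (N ÷ (h * h) * C)) (∑ h (λ i → d (h + i))) ⟩
        lead (suc k) + (∑ h d + ∑ h (λ i → d (h + i)))
          ≡⟨ cong (lead (suc k) +_) (∑-split h h d) ⟨
        lead (suc k) + ∑ (h + h) d ∎
        where
        d : ℕ → ℕ
        d r = 𝟙 (relevant? r) * D

    private
      V : ℕ → ℕ
      V k = base + 2 * (suc (k + j₀) * scale)

    -- The k-th dyadic block costs about N V k / 2 ^ (k + j₀); the second summand on the left telescopes these.
    tail-step : ∀ k → 2 ^ (k + j₀) * lead k + 2 * N * (V k + 2 * scale) ≤ 2 ^ k * (2 ^ j₀ * lead 0 + 2 * N * (V 0 + 2 * scale))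
    tail-step zero = ≤-reflexive (sym (*-identityˡ _))
    tail-step (suc k) = begin
      2 ^ suc (k + j₀) * (lead k + h * (q * V k)) + 2 * N * (V (suc k) + 2 * scale)
        ≡⟨ solve 7 (λ h l q b k N s → con 2 :* h :* (l :+ h :* (q :* (b :+ con 2 :* ((con 1 :+ k) :* s)))) :+ con 2 :* N :* ((b :+ con 2 :* ((con 2 :+ k) :* s)) :+ con 2 :* s)
             := con 2 :* (h :* l :+ (q :* (h :* h)) :* (b :+ con 2 :* ((con 1 :+ k) :* s)) :+ N :* ((b :+ con 2 :* ((con 1 :+ k) :* s)) :+ con 4 :* s))) refl h (lead k) q base (k + j₀) N scale ⟩
      2 * (h * lead k + q * (h * h) * V k + N * (V k + 4 * scale))
        ≤⟨ *-monoʳ-≤ 2 (+-monoˡ-≤ (N * (V k + 4 * scale)) (+-monoʳ-≤ (h * lead k) (*-monoˡ-≤ (V k) (m÷n*n≤m N (h * h))))) ⟩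
      2 * (h * lead k + N * V k + N * (V k + 4 * scale))
        ≡⟨ solve 4 (λ a N v s → con 2 :* (a :+ N :* v :+ N :* (v :+ con 4 :* s)) := con 2 :* (a :+ con 2 :* N :* (v :+ con 2 :* s))) refl (h * lead k) N (V k) scale ⟩
      2 * (h * lead k + 2 * N * (V k + 2 * scale))
        ≤⟨ *-monoʳ-≤ 2 (tail-step k) ⟩
      2 * (2 ^ k * (2 ^ j₀ * lead 0 + 2 * N * (V 0 + 2 * scale)))
        ≡⟨ *-assoc 2 (2 ^ k) _ ⟨
      2 ^ suc k * (2 ^ j₀ * lead 0 + 2 * N * (V 0 + 2 * scale)) ∎
      where
      open ≤-Reasoning
      open +-*-Solver
      h = 2 ^ (k + j₀)
      q = N ÷ (h * h)

    lead-upper : ∀ k → 2 ^ j₀ * lead k ≤ 2 ^ j₀ * lead 0 + 2 * N * (V 0 + 2 * scale)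
    lead-upper k = *-cancelˡ-≤ (2 ^ k) {{m^n≢0 2 k}} (begin
      2 ^ k * (2 ^ j₀ * lead k)      ≡⟨ *-assoc (2 ^ k) (2 ^ j₀) (lead k) ⟨
      2 ^ k * 2 ^ j₀ * lead k        ≡⟨ cong (_* lead k) (^-distribˡ-+-* 2 k j₀) ⟨
      2 ^ (k + j₀) * lead k        ≤⟨ m≤m+n _ _ ⟩
      2 ^ (k + j₀) * lead k + 2 * N * (V k + 2 * scale)  ≤⟨ tail-step k ⟩
      2 ^ k * (2 ^ j₀ * lead 0 + 2 * N * (V 0 + 2 * scale))  ∎)
      where
      open ≤-Reasoning

    square-weight-term : ∀ r → 1 ≤ r → Q * (𝟙 (relevant? r) * (N ÷ (r * r) * (base + 2 * log-weight r))) ≤ square-weight base r₀ r * N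
    square-weight-term r@(suc _) _ = by-relevance (relevant? r)
      where
      open ≤-Reasoning
      open +-*-Solver
      q b w : ℕ
      q = N ÷ (r * r)
      b = base + 2 * log-weight r
      w = suc (Q * b / (r * r))
      by-relevance : Dec (r₀ ≤ r × r ≤ s × Prime r) → Q * (𝟙 (relevant? r) * (q * b)) ≤ square-weight base r₀ r * N
      by-relevance (no ¬rel) = ≤-trans (≤-reflexive (trans (cong (λ t → Q * (t * (q * b))) (𝟙-no (relevant? r) ¬rel)) (*-zeroʳ Q))) z≤n
      by-relevance (yes rel@(r₀≤r , _ , pr)) = begin
        Q * (𝟙 (relevant? r) * (q * b))  ≡⟨ cong (λ t → Q * (t * (q * b))) (𝟙-yes (relevant? r) rel) ⟩
        Q * (1 * (q * b))                ≡⟨ solve 3 (λ a q b → a :* (con 1 :* (q :* b)) := q :* (a :* b)) refl Q q b ⟩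
        q * (Q * b)                      ≤⟨ *-monoʳ-≤ q (<⇒≤ (m<[1+m÷n]*n (Q * b) (r * r) (s≤s z≤n))) ⟩
        q * (w * (r * r))                ≡⟨ solve 3 (λ q w r → q :* (w :* r) := w :* (q :* r)) refl q w (r * r) ⟩
        w * (q * (r * r))                ≤⟨ *-monoʳ-≤ w (m÷n*n≤m N (r * r)) ⟩
        w * N                            ≡⟨ cong (_* N) (square-weight-eq base r₀ r test) ⟨
        square-weight base r₀ r * N      ∎
        where
        11≤r : 11 ≤ r
        11≤r = ≤-trans 11≤r₀ r₀≤r
        not-∣ : ∀ {q} → Prime q → q < 11 → ¬ (q ∣ r)
        not-∣ pq q<11 q∣r = <⇒≱ (≤-trans q<11 11≤r) (≤-reflexive (sym (prime-∣ pq pr q∣r)))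
        test : (r <ᵇ r₀) ∨ (unit30 r ≡ᵇ 0) ≡ false
        test = cong₂ _∨_ (≥⇒≮ᵇ r₀≤r) (cong (_≡ᵇ 0) (unit30-∤ r (not-∣ prime[2] (≤ᵇ⇒≤ 3 11 _)) (not-∣ prime[3] (≤ᵇ⇒≤ 4 11 _)) (not-∣ prime[5] (≤ᵇ⇒≤ 6 11 _))))

    lead-0 : Q * lead 0 ≤ ∑ (2 ^ j₀) (square-weight base r₀) * N
    lead-0 = begin
      Q * lead 0                                   ≡⟨ ∑-*ˡ (2 ^ j₀) Q _ ⟨
      ∑ (2 ^ j₀) (λ r → Q * (𝟙 (relevant? r) * (N ÷ (r * r) * (base + 2 * log-weight r))))  ≤⟨ ∑-mono (2 ^ j₀) (λ r 1≤r _ → square-weight-term r 1≤r) ⟩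
      ∑ (2 ^ j₀) (λ r → square-weight base r₀ r * N)   ≡⟨ trans (∑-cong (2 ^ j₀) λ r _ _ → *-comm (square-weight base r₀ r) N) (trans (∑-*ˡ (2 ^ j₀) N _) (*-comm N _)) ⟩
      ∑ (2 ^ j₀) (square-weight base r₀) * N           ∎
      where open ≤-Reasoning

-- Existence of an admissible prime

≼-prodOver-All : ∀ {L} {f b : ℕ → ℕ} {P : ℕ → Set} → All P L → (∀ μ → P μ → f μ ≼ b μ) → prodOver L f ≼ sumOver L b
≼-prodOver-All [] h = ≼-1
≼-prodOver-All (p ∷ ps) h = ≼-* (h _ p) (≼-prodOver-All ps h)

≽-prodOver-All : ∀ {L} {f b : ℕ → ℕ} {P : ℕ → Set} → All P L → (∀ μ → P μ → f μ ≽ b μ) → prodOver L f ≽ sumOver L b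
≽-prodOver-All [] h = ≽-intro (≤-reflexive (sym (^-zeroˡ scale)))
≽-prodOver-All (p ∷ ps) h = ≽-* (h _ p) (≽-prodOver-All ps h)

sumOver-*ʳ : ∀ L (f : ℕ → ℕ) m → sumOver L (λ q → f q * m) ≡ sumOver L f * m
sumOver-*ʳ [] f m = refl
sumOver-*ʳ (q ∷ L) f m = trans (cong (f q * m +_) (sumOver-*ʳ L f m)) (sym (*-distribʳ-+ m (f q) (sumOver L f)))

legendre-≽ : ∀ E n {q τ} → 2 ≤ q → n < 2 ^ E → q ≽ τ * pred q → q ^ legendre E n q * q ^ E ≽ τ * n
legendre-≽ E n {q} {τ} 2≤q n<2^E h = ≽-weaken (begin
  τ * n                                       ≤⟨ *-monoʳ-≤ τ (legendre-lower E n q (≤-trans (n≤1+n 1) 2≤q)) ⟩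
  τ * (pred q * l + pred q * E + n ÷ (q ^ E)) ≡⟨ cong (λ t → τ * (pred q * l + pred q * E + t)) (m<n⇒m÷n≡0 (<-≤-trans n<2^E (^-monoˡ-≤ E 2≤q))) ⟩
  τ * (pred q * l + pred q * E + 0)           ≡⟨ solve 4 (λ t p l e → t :* (p :* l :+ p :* e :+ con 0) := t :* p :* l :+ t :* p :* e) refl τ (pred q) l E ⟩
  τ * pred q * l + τ * pred q * E             ∎) (≽-* (≽-^ l h) (≽-^ E h))
  where
  open ≤-Reasoning
  open +-*-Solver
  l = legendre E n q

quotient-weight : ∀ N μ → Q * (N ÷ μ) ≤ suc (Q ÷ μ) * N
quotient-weight N zero = ≤-trans (≤-reflexive (*-zeroʳ Q)) z≤n
quotient-weight N μ@(suc _) = begin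
  Q * (N ÷ μ)                     ≤⟨ *-monoˡ-≤ (N ÷ μ) (<⇒≤ (m<[1+m÷n]*n Q μ (s≤s z≤n))) ⟩
  suc (Q ÷ μ) * μ * (N ÷ μ)       ≡⟨ trans (*-assoc (suc (Q ÷ μ)) μ (N ÷ μ)) (cong (suc (Q ÷ μ) *_) (*-comm μ (N ÷ μ))) ⟩
  suc (Q ÷ μ) * (N ÷ μ * μ)       ≤⟨ *-monoʳ-≤ (suc (Q ÷ μ)) (m÷n*n≤m N μ) ⟩
  suc (Q ÷ μ) * N                 ∎
  where open ≤-Reasoning

-- A power κ of the prime r, to be kept from dividing n ∸ p; at most (w + w₂) / Q is lost per unit of N.
record Kill (M α ρ : ℕ) : Set where
  field
    κ r ℓ ρ′ w w₂ : ℕ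
    .{{κ-nonZero}} : NonZero κ
    7≤κ : 7 ≤ κ
    κ-unit : Coprime κ M
    r-prime : Prime r
    r∣κ : r ∣ κ
    only : ∀ p → Prime p → p ∣ κ → p ≡ r
    κ≼ℓ : κ ≼ ℓ
    r≼ρ′ : r ≼ ρ′ * pred r
    ρ-small : ρ + ρ′ ≤ 3 * scale
    weight : Q * (α + ℓ + (ρ + ρ′)) ≤ w * κ
    weight₂ : w ≤ w₂ * (M * κ)
    weight-small : w ≤ Q * (scale * 9)

-- The numerical conditions are opaque, so that only their evaluation unfolds the constants.
opaque
  -- m is the surplus of the main term per unit of N.
  Margin : (α ρ cofactors kills squares tail lower m : ℕ) → Set
  Margin α ρ cofactors kills squares tail lower m =
    (α + ρ) * cofactors + (2 * scale * suc (Q ÷ 121) + (kills + (squares + tail))) + Q * m ≤ Q * lower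

  -- `tail` / `Q` bounds, per unit of N, the cost of all dyadic blocks beyond `2 ^ j₀`, as summed in
  -- `lead-upper`.
  Tail : (base tail : ℕ) → Set
  Tail base tail = 2 * Q * (base + 2 * (suc j₀ * scale) + 2 * scale) ≤ 2 ^ j₀ * tail

  margin : ∀ {α ρ cofactors kills squares tail lower m} → Margin α ρ cofactors kills squares tail lower m →
           (α + ρ) * cofactors + (2 * scale * suc (Q ÷ 121) + (kills + (squares + tail))) + Q * m ≤ Q * lower
  margin h = h

  tail-bound : ∀ {base tail} → Tail base tail → 2 * Q * (base + 2 * (suc j₀ * scale) + 2 * scale) ≤ 2 ^ j₀ * tail
  tail-bound h = h

killWeight : ∀ {M α ρ} → List (Kill M α ρ) → ℕ
killWeight [] = 0
killWeight (k ∷ ks) = Kill.w k + Kill.w₂ k + killWeight ks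

Admissible : (n M : ℕ) .{{_ : NonZero M}} (c r₀ : ℕ) → List ℕ → ℕ → Set
Admissible n M c r₀ κs p = p < n × Prime p × p % M ≡ c × All (λ κ → ¬ (κ ∣ n ∸ p)) κs × (∀ r → Prime r → r₀ ≤ r → ¬ (r * r ∣ n ∸ p))

module Assembly (n L s : ℕ) (1≤n : 1 ≤ n) (n<2^L : n < 2 ^ L) (n<[1+s]² : n < suc s * suc s) (s≤n : s ≤ n)
                (M : ℕ) .{{_ : NonZero M}} (c : ℕ) (c<M : c < M) (c-unit : Coprime c M) (M<64 : M < 64) (12≤M : 12 ≤ M)
                (N : ℕ) (2≤N : 2 ≤ N) (NM<n : N * M < n)
                (cofactors : List ℕ) (cofactors-units : All (λ μ → Coprime μ M) cofactors)
                (check : ∀ h t → Coprime h M → t < 121 * M →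
                  cnt M c h (t % M) ≤ 𝟙 (h % M ≟ c) + sumOver cofactors (λ μ → cnt M c (μ * h) (t ÷ μ % M)))
                (ps : List ℕ) (ps-prime : All (λ q → Prime q × q ≤ 5) ps)
                (radical : ∀ p → Prime p → 𝟙 (p ∣? M) ≡ sumOver ps (λ q → 𝟙 (p ≟ q)))
                (M-smooth : ∀ p → Prime p → p ∣ M → p ≤ 5)
                (α α⁻ : ℕ) (M≼α : M ≼ α) (M≽α⁻ : M ≽ α⁻)
                (ρf τf σf : ℕ → ℕ)
                (ps-bounds : All (λ q → Prime q × q ≼ ρf q * pred q × q ≽ τf q * pred q × q ≼ σf q) ps)
                (ρ-small : sumOver ps ρf + half ≤ 3 * scale)
                (r₀ : ℕ) (11≤r₀ : 11 ≤ r₀)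
                (kills : List (Kill M α (sumOver ps ρf)))
                (tailWeight : ℕ)
                (tail : Tail (α + sumOver ps ρf + half) tailWeight)
                where

  ρ τ σ y₀ : ℕ
  ρ = sumOver ps ρf
  τ = sumOver ps τf
  σ = sumOver ps σf
  y₀ = suc (N ÷ 121)

  open SquareKills n L 1≤n n<2^L M c c<M c-unit M<64 N NM<n M-smooth α ρ M≼α ρ-small s r₀ 11≤r₀ public

  y₀-large : ∀ p → y₀ < p → N * M ÷ p < 121 * M
  y₀-large p y₀<p = m<n*o⇒m÷o<n (N * M) (121 * M) p (begin-strict
    N * M              <⟨ *-monoˡ-< M (<-trans (m<[1+m÷n]*n N 121 (s≤s z≤n)) (*-monoˡ-< 121 y₀<p)) ⟩
    p * 121 * M        ≡⟨ solve 3 (λ p a m → p :* a :* m := a :* m :* p) refl p 121 M ⟩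
    121 * M * p        ∎)
    where
    open ≤-Reasoning
    open +-*-Solver

  module Ma = Master X E X<2^E 1≤E M c c<M c-unit cofactors cofactors-units (121 * M) check

  N<n : N < n
  N<n = ≤-<-trans (m≤m*n N M) NM<n

  ps≤X : All (_≤ X) ps
  ps≤X = All.map (λ (_ , q≤5) → 64n≤X (≤-trans q≤5 (≤-trans (≤ᵇ⇒≤ 5 64 _) (m≤m*n 64 n {{>-nonZero 1≤n}})))) ps-prime

  R-ps : ∀ m → R M m ≡ prodOver ps (λ q → q ^ leg m q)
  R-ps = R-radical M ps (All.map proj₁ ps-prime) ps≤X radical

  R≼ρ : ∀ m → R M m ≼ ρ * m
  R≼ρ m = subst (_≼ ρ * m) (sym (R-ps m)) (subst (prodOver ps (λ q → q ^ leg m q) ≼_) (sumOver-*ʳ ps ρf m)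
    (≼-prodOver-All {f = λ q → q ^ leg m q} {b = λ q → ρf q * m} ps-bounds λ q (pq , h , _) → legendre-≼ E m {q} {ρf q} (prime≥1 pq) h))

  lower : M ^ N * R M N * prodOver ps (_^ E) ≽ (α⁻ + τ) * N
  lower = subst₂ _≽_ (trans (cong (M ^ N *_) (trans (prodOver-* ps (λ q → q ^ leg N q) (_^ E)) (cong (_* prodOver ps (_^ E)) (sym (R-ps N))))) (sym (*-assoc (M ^ N) (R M N) _)))
      (trans (cong (α⁻ * N +_) (sumOver-*ʳ ps τf N)) (sym (*-distribʳ-+ N α⁻ τ)))
    (≽-* (≽-^ N M≽α⁻) (≽-prodOver-All {f = λ q → q ^ leg N q * q ^ E} {b = λ q → τf q * N} ps-bounds
      λ q (pq , _ , h , _) → legendre-≽ E N {q} {τf q} (prime≥2 pq) N<2^E h))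
    where
    N<2^E : N < 2 ^ E
    N<2^E = <-trans (<-≤-trans N<n n≤X) X<2^E

  correction-≼ : prodOver ps (_^ E) ≼ σ * E
  correction-≼ = subst (prodOver ps (_^ E) ≼_) (sumOver-*ʳ ps σf E)
    (≼-prodOver-All {f = _^ E} {b = λ q → σf q * E} ps-bounds λ q (_ , _ , _ , h) → ≼-^ E h)

  cofactor-cost : ℕ → ℕ
  cofactor-cost μ = α * suc (N ÷ μ) + scale * L + ρ * (N ÷ μ)

  cofactors-≼ : prodOver cofactors (λ μ → Ma.cofactor N y₀ y₀-large (N ÷ μ)) ≼ sumOver cofactors cofactor-cost
  cofactors-≼ = ≼-prodOver cofactors {f = λ μ → Ma.cofactor N y₀ y₀-large (N ÷ μ)} {b = cofactor-cost}
    λ μ → ≼-* (≼-* (≼-^ (suc (N ÷ μ)) M≼α) (≼-≤ (≤-<-trans (÷≤ N μ) N<n) n≼)) (R≼ρ (N ÷ μ))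

  cofactor-weight : ℕ
  cofactor-weight = sumOver cofactors (λ μ → suc (Q ÷ μ))

  cofactor-costs : ∀ μs → Q * sumOver μs cofactor-cost ≤ (α + ρ) * sumOver μs (λ μ → suc (Q ÷ μ)) * N + Q * (length μs * (α + scale * L))
  cofactor-costs [] = ≤-trans (≤-reflexive (*-zeroʳ Q)) z≤n
  cofactor-costs (μ ∷ μs) = begin
    Q * (α * suc k + scale * L + ρ * k + rest′)
      ≡⟨ solve 6 (λ q a k l r t → q :* (a :* (con 1 :+ k) :+ l :+ r :* k :+ t) := (a :+ r) :* (q :* k) :+ q :* (a :+ l) :+ q :* t) refl Q α k (scale * L) ρ rest′ ⟩
    (α + ρ) * (Q * k) + Q * (α + scale * L) + Q * rest′
      ≤⟨ +-mono-≤ (+-monoˡ-≤ (Q * (α + scale * L)) (*-monoʳ-≤ (α + ρ) (quotient-weight N μ))) (cofactor-costs μs) ⟩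
    (α + ρ) * (suc (Q ÷ μ) * N) + Q * (α + scale * L) + ((α + ρ) * W * N + Q * (length μs * (α + scale * L)))
      ≡⟨ solve 7 (λ b w N q a W l → b :* (w :* N) :+ q :* a :+ (b :* W :* N :+ q :* (l :* a)) := b :* (w :+ W) :* N :+ q :* ((con 1 :+ l) :* a)) refl
           (α + ρ) (suc (Q ÷ μ)) N Q (α + scale * L) W (length μs) ⟩
    (α + ρ) * (suc (Q ÷ μ) + W) * N + Q * (suc (length μs) * (α + scale * L)) ∎
    where
    open ≤-Reasoning
    open +-*-Solver
    k = N ÷ μ
    rest′ = sumOver μs cofactor-cost
    W = sumOver μs (λ μ → suc (Q ÷ μ))

  killSum : List (Kill M α ρ) → ℕ → ℕ
  killSum [] p = 0
  killSum (k ∷ ks) p = 𝟙 (killed? κ p) + killSum ks p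
    where open Kill k

  -- Two applications of the class bound, with indices near N / κ and N / (M κ²), cost `w` and `w₂`
  -- per unit of N; the roundings are collected in 3 `Q * D`.
  kill-≼ : ∀ (k : Kill M α ρ) → let open Kill k in
           ∃[ b ] ℰ (λ p → 𝟙 (killed? κ p)) ≼ b × Q * b ≤ (w + w₂) * N + 3 * (Q * D)
  kill-≼ k = (q * B + D) + (z * B + D) , killed-≼₂ {ρ = ρ} M≼α R≼ρ κ κ-unit r-prime r∣κ only {ρ′ = ρ′} κ≼ℓ r≼ρ′ ρ+ρ′-small (s≤s z≤N÷121) , (begin
    Q * ((q * B + D) + (z * B + D))                ≡⟨ solve 5 (λ Q q B D z → Q :* ((q :* B :+ D) :+ (z :* B :+ D)) := q :* (Q :* B) :+ z :* (Q :* B) :+ con 2 :* (Q :* D)) refl Q q B D z ⟩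
    q * (Q * B) + z * (Q * B) + 2 * (Q * D)        ≤⟨ +-monoˡ-≤ (2 * (Q * D)) (+-mono-≤ first second) ⟩
    w * N + (w₂ * N + Q * D) + 2 * (Q * D)         ≡⟨ solve 4 (λ w w₂ N d → w :* N :+ (w₂ :* N :+ d) :+ con 2 :* d := (w :+ w₂) :* N :+ con 3 :* d) refl w w₂ N (Q * D) ⟩
    (w + w₂) * N + 3 * (Q * D)                     ∎)
    where
    open Kill k renaming (ρ-small to ρ+ρ′-small)
    open ≤-Reasoning
    open +-*-Solver
    K B q z : ℕ
    K = M * κ
    B = α + ℓ + (ρ + ρ′)
    q = N ÷ κ
    z = suc q ÷ K
    1≤K : 1 ≤ K
    1≤K = *-mono-≤ (>-nonZero⁻¹ M) (>-nonZero⁻¹ κ)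
    first : q * (Q * B) ≤ w * N
    first = begin
      q * (Q * B)      ≤⟨ *-monoʳ-≤ q weight ⟩
      q * (w * κ)      ≡⟨ solve 3 (λ q w k → q :* (w :* k) := w :* (q :* k)) refl q w κ ⟩
      w * (q * κ)      ≤⟨ *-monoʳ-≤ w (m÷n*n≤m N κ) ⟩
      w * N            ∎
    second : z * (Q * B) ≤ w₂ * N + Q * D
    second = *-cancelʳ-≤ _ _ K {{>-nonZero 1≤K}} (begin
      z * (Q * B) * K                ≡⟨ solve 3 (λ z b k → z :* b :* k := z :* k :* b) refl z (Q * B) K ⟩
      z * K * (Q * B)                ≤⟨ *-monoˡ-≤ (Q * B) (m÷n*n≤m (suc q) K) ⟩
      Q * B + q * (Q * B)            ≤⟨ +-mono-≤ weight first ⟩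
      w * κ + w * N                  ≤⟨ +-mono-≤ (*-mono-≤ (≤-trans weight-small (*-monoʳ-≤ Q (*-monoʳ-≤ scale (m≤n+m 9 L)))) (m≤n*m κ M)) (*-monoˡ-≤ N weight₂) ⟩
      Q * D * K + w₂ * K * N         ≡⟨ solve 4 (λ d k w n → d :* k :+ w :* k :* n := (w :* n :+ d) :* k) refl (Q * D) K w₂ N ⟩
      (w₂ * N + Q * D) * K           ∎)
    2+2q≤N : ∀ t → t * 4 ≤ N → 2 * suc t ≤ N
    2+2q≤N zero _ = 2≤N
    2+2q≤N (suc t) h = ≤-trans (≤-trans (m≤m+n _ (2 * t)) (≤-reflexive (solve 1 (λ t → con 2 :* (con 2 :+ t) :+ con 2 :* t := (con 1 :+ t) :* con 4) refl t))) h
    z≤N÷121 : z ≤ N ÷ 121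
    z≤N÷121 = m*n≤o⇒m≤o÷n z 121 N (s≤s z≤n) (begin
      -- 12 · 7 · 2 = 168 ≥ 121: since 12 ≤ `M` and 7 ≤ `κ`, the second index stays below `y₀`.
      z * 121          ≤⟨ *-monoʳ-≤ z (≤-trans (≤ᵇ⇒≤ 121 168 _) (*-monoˡ-≤ 2 (*-mono-≤ 12≤M 7≤κ))) ⟩
      z * (K * 2)      ≡⟨ solve 2 (λ z k → z :* (k :* con 2) := con 2 :* (z :* k)) refl z K ⟩
      2 * (z * K)      ≤⟨ *-monoʳ-≤ 2 (m÷n*n≤m (suc q) K) ⟩
      2 * suc q        ≤⟨ 2+2q≤N q (≤-trans (*-monoʳ-≤ q (≤-trans (≤ᵇ⇒≤ 4 7 _) 7≤κ)) (m÷n*n≤m N κ)) ⟩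
      N                ∎)

  kills-≼ : ∀ ks → ∃[ b ] ℰ (killSum ks) ≼ b × Q * b ≤ killWeight ks * N + length ks * (3 * (Q * D))
  kills-≼ [] = 0 , ≼-≤ (≤-reflexive (ℰ-0 _ λ _ _ _ → refl)) ≼-1 , ≤-reflexive (*-zeroʳ Q)
  kills-≼ (k ∷ ks) = combine (kill-≼ k) (kills-≼ ks)
    where
    open ≤-Reasoning
    open +-*-Solver
    open Kill k using (κ)
    v = Kill.w k + Kill.w₂ k
    combine : (∃[ b ] ℰ (λ p → 𝟙 (killed? κ p)) ≼ b × Q * b ≤ v * N + 3 * (Q * D)) →
              (∃[ b ] ℰ (killSum ks) ≼ b × Q * b ≤ killWeight ks * N + length ks * (3 * (Q * D))) →
              ∃[ b ] ℰ (killSum (k ∷ ks)) ≼ b × Q * b ≤ killWeight (k ∷ ks) * N + length (k ∷ ks) * (3 * (Q * D))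
    combine (b , h , le) (b′ , h′ , le′) = b + b′ , ≼-≤ (≤-reflexive (ℰ-+ _ (killSum ks))) (≼-* h h′) , (begin
      Q * (b + b′)           ≡⟨ *-distribˡ-+ Q b b′ ⟩
      Q * b + Q * b′         ≤⟨ +-mono-≤ le le′ ⟩
      v * N + 3 * (Q * D) + (killWeight ks * N + length ks * (3 * (Q * D)))  ≡⟨ solve 5 (λ v n d w l → v :* n :+ d :+ (w :* n :+ l :* d) := (v :+ w) :* n :+ (con 1 :+ l) :* d) refl v N (3 * (Q * D)) (killWeight ks) (length ks) ⟩
      (v + killWeight ks) * N + suc (length ks) * (3 * (Q * D))  ∎)

  squareWeight : ℕ
  squareWeight = ∑ (2 ^ j₀) (square-weight base r₀)

  squares : ℕ → ℕ
  squares p = ∑ (2 ^ (L + j₀)) (λ r → squareKill r p)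

  square-cost : ℕ
  square-cost = lead R≼ρ L + ∑ (2 ^ (L + j₀)) (λ r → 𝟙 (relevant? r) * D)

  squares-≼ : ℰ squares ≼ square-cost
  squares-≼ = ≼-≤ (≤-reflexive (ℰ-∑ (2 ^ (L + j₀)) squareKill)) (squareKills-dyadic R≼ρ L)

  lead-weight : Q * lead R≼ρ L ≤ (squareWeight + tailWeight) * N
  lead-weight = *-cancelˡ-≤ h {{m^n≢0 2 j₀}} (begin
    h * (Q * lead R≼ρ L)                                    ≡⟨ solve 3 (λ h q l → h :* (q :* l) := q :* (h :* l)) refl h Q (lead R≼ρ L) ⟩
    Q * (h * lead R≼ρ L)                                    ≤⟨ *-monoʳ-≤ Q (lead-upper R≼ρ L) ⟩
    Q * (h * lead R≼ρ 0 + 2 * N * V)                        ≡⟨ solve 5 (λ q h l n v → q :* (h :* l :+ con 2 :* n :* v) := h :* (q :* l) :+ con 2 :* q :* v :* n) refl Q h (lead R≼ρ 0) N V ⟩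
    h * (Q * lead R≼ρ 0) + 2 * Q * V * N                    ≤⟨ +-mono-≤ (*-monoʳ-≤ h (lead-0 R≼ρ)) (*-monoˡ-≤ N (tail-bound tail)) ⟩
    h * (squareWeight * N) + h * tailWeight * N             ≡⟨ solve 4 (λ h s n t → h :* (s :* n) :+ h :* t :* n := h :* ((s :+ t) :* n)) refl h squareWeight N tailWeight ⟩
    h * ((squareWeight + tailWeight) * N)                   ∎)
    where
    open ≤-Reasoning
    open +-*-Solver
    h V : ℕ
    h = 2 ^ j₀
    V = base + 2 * (suc j₀ * scale) + 2 * scale

  relevant-count : ∑ (2 ^ (L + j₀)) (λ r → 𝟙 (relevant? r) * D) ≤ primeCount s * D
  relevant-count = begin
    ∑ m (λ r → 𝟙 (relevant? r) * D)                ≡⟨ trans (∑-cong m λ r _ _ → *-comm (𝟙 (relevant? r)) D) (∑-*ˡ m D _) ⟩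
    D * ∑ m (λ r → 𝟙 (relevant? r))                ≤⟨ *-monoʳ-≤ D (≤-trans (∑-mono m λ r _ _ → relevant-prime R≼ρ r) (∑-cutoff m s (λ r → 𝟙 (prime? r)))) ⟩
    D * primeCount s                               ≡⟨ *-comm D (primeCount s) ⟩
    primeCount s * D                               ∎
    where
    open ≤-Reasoning
    m = 2 ^ (L + j₀)

  square-weight-total : Q * square-cost ≤ (squareWeight + tailWeight) * N + Q * (primeCount s * D)
  square-weight-total = ≤-trans (≤-reflexive (*-distribˡ-+ Q _ _)) (+-mono-≤ lead-weight (*-monoʳ-≤ Q relevant-count))

  Excluded : ℕ → Set
  Excluded p = Any (λ k → Kill.κ k ∣ n ∸ p) kills ⊎ (∃[ r ] r < suc s × (r₀ ≤ r × r ≤ s × Prime r) × r * r ∣ n ∸ p)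

  excluded? : ∀ p → Dec (Excluded p)
  excluded? p = Any.any? (λ k → Kill.κ k ∣? n ∸ p) kills ⊎-dec anyUpTo? (λ r → relevant? r ×-dec (r * r ∣? n ∸ p)) (suc s)

  killSum-positive : ∀ ks p → p ≤ n → y₀ < p × p ≤ x × p % M ≡ c → ¬ (p ∣ n) → Any (λ k → Kill.κ k ∣ n ∸ p) ks → 1 ≤ killSum ks p
  killSum-positive (k ∷ ks) p p≤n cls p∤n (here κ∣) = ≤-trans (≤-reflexive (sym (𝟙-yes (killed? κ p) (cls , ∣∸⇒%≡ κ p≤n κ∣ , p∤n)))) (m≤m+n _ _)
    where open Kill k
  killSum-positive (k ∷ ks) p p≤n cls p∤n (there any) = ≤-trans (killSum-positive ks p p≤n cls p∤n any) (m≤n+m _ _)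

  squares-positive : ∀ p r → p ≤ n → y₀ < p × p ≤ x × p % M ≡ c → ¬ (p ∣ n) → r₀ ≤ r × r ≤ s × Prime r → r * r ∣ n ∸ p → 1 ≤ squares p
  squares-positive p zero _ _ _ (_ , _ , pr) _ = contradiction (prime≥2 pr) λ ()
  squares-positive p r@(suc _) p≤n cls p∤n rel@(_ , r≤s , _) r²∣ = begin
    1                                            ≡⟨ cong₂ _*_ (𝟙-yes (relevant? r) rel) (𝟙-yes (killed? (r * r) p) (cls , ∣∸⇒%≡ (r * r) p≤n r²∣ , p∤n)) ⟨
    𝟙 (relevant? r) * 𝟙 (killed? (r * r) p)      ≤⟨ ∑-term (2 ^ (L + j₀)) (λ r → squareKill r p) r (s≤s z≤n) r≤ ⟩
    squares p                                    ∎
    where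
    open ≤-Reasoning
    r≤ : r ≤ 2 ^ (L + j₀)
    r≤ = ≤-trans r≤s (≤-trans s≤n (≤-trans (<⇒≤ n<2^L) (^-monoʳ-≤ 2 (m≤m+n L j₀))))

  module _ (excluded : ∀ p → Prime p → y₀ < p → p ≤ x → p % M ≡ c → ¬ (p ∣ n) → Excluded p) where

    -- A prime of the class divides n or is excluded; in the latter case it is congruent to n modulo
    -- some `κ` or r², and so is counted as killed on the right.
    class-covered : ∀ p → Prime p → 𝟙 (inClass? M c y₀ x p) ≤ 𝟙 (p ∣? n) + (killSum kills p + squares p)
    class-covered p pp = by-class (inClass? M c y₀ x p)
      where
      by-class : Dec (y₀ < p × p ≤ x × p % M ≡ c) → 𝟙 (inClass? M c y₀ x p) ≤ 𝟙 (p ∣? n) + (killSum kills p + squares p)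
      by-class (no ¬cls) = ≤-trans (≤-reflexive (𝟙-no (inClass? M c y₀ x p) ¬cls)) z≤n
      by-class (yes cls@(y₀<p , p≤x , p≡c)) = by-divisor (p ∣? n)
        where
        p≤n : p ≤ n
        p≤n = ≤-trans p≤x (<⇒≤ NM<n)
        by-divisor : Dec (p ∣ n) → 𝟙 (inClass? M c y₀ x p) ≤ 𝟙 (p ∣? n) + (killSum kills p + squares p)
        by-divisor (yes p∣n) = ≤-trans (𝟙≤1 _) (≤-trans (≤-reflexive (sym (𝟙-yes (p ∣? n) p∣n))) (m≤m+n _ _))
        by-divisor (no p∤n) = ≤-trans (𝟙≤1 _) (≤-trans (by-exclusion (excluded p pp y₀<p p≤x p≡c p∤n)) (m≤n+m _ (𝟙 (p ∣? n))))
          where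
          by-exclusion : Excluded p → 1 ≤ killSum kills p + squares p
          by-exclusion (inj₁ any) = ≤-trans (killSum-positive kills p p≤n cls p∤n any) (m≤m+n _ _)
          by-exclusion (inj₂ (r , _ , rel , r²∣)) = ≤-trans (squares-positive p r p≤n cls p∤n rel r²∣) (m≤n+m _ _)

    kill-bits : ℕ
    kill-bits = proj₁ (kills-≼ kills)

    rest-cost : ℕ
    rest-cost = 2 * scale * (y₀ + L) + (scale * L + (kill-bits + square-cost)) + scale * L * primeCount s

    rest-≼ : ℰ (Ma.rest N y₀ y₀-large) ≼ rest-cost
    rest-≼ = ≼-≤ (≤-trans (ℰ-mono _ (λ p → 𝟙 (p ≤? y₀) + (𝟙 (p ∣? n) + (killSum kills p + squares p)) + higherPowers x p)
                   λ p pp _ → +-monoˡ-≤ (higherPowers x p) (+-monoʳ-≤ (𝟙 (p ≤? y₀)) (class-covered p pp)))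
               (≤-reflexive (trans (ℰ-+ _ (higherPowers x)) (cong (_* ℰ (higherPowers x)) (trans (ℰ-+ (λ p → 𝟙 (p ≤? y₀)) _)
                 (cong (ℰ (λ p → 𝟙 (p ≤? y₀)) *_) (trans (ℰ-+ (λ p → 𝟙 (p ∣? n)) _) (cong (ℰ (λ p → 𝟙 (p ∣? n)) *_) (ℰ-+ (killSum kills) squares)))))))))
      (≼-* (≼-* (small-primes-≼ y₀ y₀≤n) (≼-* divisors-≼ (≼-* (proj₁ (proj₂ (kills-≼ kills))) squares-≼)))
           (higherPowers-≼ x s 1≤x (<⇒≤ NM<n) n<[1+s]²))
      where
      1≤x : 1 ≤ x
      1≤x = *-mono-≤ (≤-trans (n≤1+n 1) 2≤N) (>-nonZero⁻¹ M)
      y₀≤n : y₀ ≤ n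
      y₀≤n = ≤-trans (s≤s (÷≤ N 121)) N<n

    bits-inequality : (α⁻ + τ) * N ≤ scale * L + sumOver cofactors cofactor-cost + rest-cost + σ * E
    bits-inequality = ≽-≼ lower (*-monoˡ-≤ (prodOver ps (_^ E)) (Ma.master N y₀ y₀-large (≤-trans (n≤1+n 1) 2≤N) x≤X))
      (≼-* (≼-* (≼-* (≼-≤ (<⇒≤ NM<n) n≼) cofactors-≼) rest-≼) correction-≼)

    -- After multiplication by `Q`, everything proportional to `N` goes into `coefficient`; `error`
    -- depends on n only through `L` and `primeCount s`, and so is O(√n log n).
    coefficient error : ℕ
    coefficient = (α + ρ) * cofactor-weight + (2 * scale * suc (Q ÷ 121) + (killWeight kills + (squareWeight + tailWeight)))
    error = scale * L + length cofactors * (α + scale * L) + (2 * scale * (1 + L) + (scale * L + (length kills * (3 * D) + primeCount s * D))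
            + scale * L * primeCount s) + σ * E

    weighted-inequality : Q * ((α⁻ + τ) * N) ≤ coefficient * N + Q * error
    weighted-inequality = begin
      Q * ((α⁻ + τ) * N)
        ≤⟨ *-monoʳ-≤ Q bits-inequality ⟩
      Q * (scale * L + sumOver cofactors cofactor-cost + rest-cost + σ * E)
        ≡⟨ solve 10 (λ q sl c S N₁ L k r p e → q :* (sl :+ c :+ (con 2 :* S :* (con 1 :+ N₁ :+ L) :+ (sl :+ (k :+ r)) :+ p) :+ e)
             := q :* sl :+ q :* c :+ (con 2 :* S :* (q :* N₁) :+ q :* (con 2 :* S :* (con 1 :+ L)) :+ (q :* sl :+ (q :* k :+ q :* r)) :+ q :* p) :+ q :* e)
             refl Q (scale * L) (sumOver cofactors cofactor-cost) scale (N ÷ 121) L kill-bits square-cost (scale * L * primeCount s) (σ * E) ⟩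
      Q * (scale * L) + Q * sumOver cofactors cofactor-cost + (2 * scale * (Q * (N ÷ 121)) + Q * (2 * scale * (1 + L)) + (Q * (scale * L) + (Q * kill-bits + Q * square-cost)) + Q * (scale * L * primeCount s)) + Q * (σ * E)
        ≤⟨ +-monoˡ-≤ (Q * (σ * E)) (+-mono-≤ (+-monoʳ-≤ (Q * (scale * L)) (cofactor-costs cofactors))
             (+-monoˡ-≤ (Q * (scale * L * primeCount s)) (+-mono-≤ (+-monoˡ-≤ (Q * (2 * scale * (1 + L))) (*-monoʳ-≤ (2 * scale) (quotient-weight N 121)))
               (+-monoʳ-≤ (Q * (scale * L)) (+-mono-≤ (proj₂ (proj₂ (kills-≼ kills))) square-weight-total))))) ⟩
      Q * (scale * L) + ((α + ρ) * cofactor-weight * N + Q * (length cofactors * (α + scale * L))) + (2 * scale * (suc (Q ÷ 121) * N) + Q * (2 * scale * (1 + L))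
        + (Q * (scale * L) + ((killWeight kills * N + length kills * (3 * (Q * D))) + ((squareWeight + tailWeight) * N + Q * (primeCount s * D)))) + Q * (scale * L * primeCount s)) + Q * (σ * E)
        ≡⟨ solve 16 (λ q sl b W N m a S w L k l D t P e → q :* sl :+ (b :* W :* N :+ q :* (m :* a)) :+ (con 2 :* S :* (w :* N) :+ q :* (con 2 :* S :* (con 1 :+ L))
               :+ (q :* sl :+ ((k :* N :+ l :* (con 3 :* (q :* D))) :+ (t :* N :+ q :* (P :* D)))) :+ q :* (sl :* P)) :+ q :* e
             := (b :* W :+ (con 2 :* S :* w :+ (k :+ t))) :* N :+ q :* (sl :+ m :* a :+ (con 2 :* S :* (con 1 :+ L) :+ (sl :+ (l :* (con 3 :* D) :+ P :* D)) :+ sl :* P) :+ e))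
             refl Q (scale * L) (α + ρ) cofactor-weight N (length cofactors) (α + scale * L) scale (suc (Q ÷ 121)) L (killWeight kills) (length kills) D (squareWeight + tailWeight) (primeCount s) (σ * E) ⟩
      coefficient * N + Q * error ∎
      where
      open ≤-Reasoning
      open +-*-Solver

    -- The bounds 30 and 180 are common to all five choices of modulus and kills, so that the main
    -- term needs to be compared with one error term only.
    error-upper : ∀ a b → α ≤ a * scale → σ ≤ b * scale → 4 + length cofactors + 3 * length kills + b ≤ 30 →
                  length cofactors * a + 2 + 27 * length kills + 6 * b ≤ 180 →
                  error ≤ scale * ((2 * L + 9) * primeCount s + (30 * L + 180))
    error-upper a b α≤ σ≤ h₁ h₂ = begin
      error
        ≤⟨ +-mono-≤ (+-monoˡ-≤ (2 * S * (1 + L) + (S * L + (k * (3 * D) + P * D)) + S * L * P) (+-monoʳ-≤ (S * L) (*-monoʳ-≤ l (+-monoˡ-≤ (S * L) α≤)))) (*-monoˡ-≤ E σ≤) ⟩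
      S * L + l * (a * S + S * L) + (2 * S * (1 + L) + (S * L + (k * (3 * D) + P * D)) + S * L * P) + b * S * E
        ≡⟨ solve 7 (λ S L l a k P b → S :* L :+ l :* (a :* S :+ S :* L) :+ (con 2 :* S :* (con 1 :+ L) :+ (S :* L :+ (k :* (con 3 :* (S :* (L :+ con 9))) :+ P :* (S :* (L :+ con 9)))) :+ S :* L :* P) :+ b :* S :* (L :+ con 6)
             := S :* ((con 2 :* L :+ con 9) :* P :+ ((con 4 :+ l :+ con 3 :* k :+ b) :* L :+ (l :* a :+ con 2 :+ con 27 :* k :+ con 6 :* b)))) refl S L l a k P b ⟩
      S * ((2 * L + 9) * P + ((4 + l + 3 * k + b) * L + (l * a + 2 + 27 * k + 6 * b)))
        ≤⟨ *-monoʳ-≤ S (+-monoʳ-≤ ((2 * L + 9) * P) (+-mono-≤ (*-monoˡ-≤ L h₁) h₂)) ⟩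
      S * ((2 * L + 9) * P + (30 * L + 180)) ∎
      where
      open ≤-Reasoning
      open +-*-Solver
      S l k P : ℕ
      S = scale
      l = length cofactors
      k = length kills
      P = primeCount s

    impossible : ∀ m a b → Margin α ρ cofactor-weight (killWeight kills) squareWeight tailWeight (α⁻ + τ) m →
                 α ≤ a * scale → σ ≤ b * scale → 4 + length cofactors + 3 * length kills + b ≤ 30 →
                 length cofactors * a + 2 + 27 * length kills + 6 * b ≤ 180 →
                 scale * ((2 * L + 9) * primeCount s + (30 * L + 180)) < m * N → ⊥
    impossible m a b large α≤ σ≤ h₁ h₂ error< = <⇒≱ error< (≤-trans (*-cancelˡ-≤ Q {{Q-nonZero}} (+-cancelˡ-≤ (coefficient * N) _ _ (begin
      coefficient * N + Q * (m * N)      ≡⟨ solve 4 (λ c n q m → c :* n :+ q :* (m :* n) := (c :+ q :* m) :* n) refl coefficient N Q m ⟩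
      (coefficient + Q * m) * N          ≤⟨ *-monoˡ-≤ N (margin large) ⟩
      Q * (α⁻ + τ) * N                   ≡⟨ *-assoc Q (α⁻ + τ) N ⟩
      Q * ((α⁻ + τ) * N)                 ≤⟨ weighted-inequality ⟩
      coefficient * N + Q * error        ∎))) (error-upper a b α≤ σ≤ h₁ h₂))
      where
      open ≤-Reasoning
      open +-*-Solver

  -- Exclusion is decidable, so a search through all p < n turns the contradiction into a witness.
  -- Only r ≤ `s` need be tested, since r² ∣ n - p forces r² ≤ n.
  admissible : (∀ m a b → Margin α ρ cofactor-weight (killWeight kills) squareWeight tailWeight (α⁻ + τ) m →
                 α ≤ a * scale → σ ≤ b * scale → 4 + length cofactors + 3 * length kills + b ≤ 30 →
                 length cofactors * a + 2 + 27 * length kills + 6 * b ≤ 180 →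
                 scale * ((2 * L + 9) * primeCount s + (30 * L + 180)) < m * N →
                 ∃ (Admissible n M c r₀ (map Kill.κ kills)))
  admissible m a b large α≤ σ≤ h₁ h₂ error< = by-search (anyUpTo? (λ p → prime? p ×-dec (p % M ≟ c) ×-dec ¬? (excluded? p)) n)
    where
    avoided : ∀ ks p → ¬ Any (λ k → Kill.κ k ∣ n ∸ p) ks → All (λ κ → ¬ (κ ∣ n ∸ p)) (map Kill.κ ks)
    avoided [] p ¬any = []
    avoided (k ∷ ks) p ¬any = (¬any ∘ here) ∷ avoided ks p (¬any ∘ there)
    r≤s : ∀ r p → p < n → r * r ∣ n ∸ p → r ≤ s
    r≤s r p p<n r²∣ = ≮⇒≥ λ s<r → <⇒≱ n<[1+s]² (≤-trans (*-mono-≤ s<r s<r) (≤-trans (∣⇒≤ {{>-nonZero (m<n⇒0<n∸m p<n)}} r²∣) (m∸n≤m n p)))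
    by-search : Dec (∃[ p ] p < n × Prime p × p % M ≡ c × ¬ Excluded p) → ∃ (Admissible n M c r₀ (map Kill.κ kills))
    by-search (yes (p , p<n , pp , p≡c , free)) = p , p<n , pp , p≡c , avoided kills p (free ∘ inj₁) ,
      λ r pr r₀≤r r²∣ → free (inj₂ (r , s≤s (r≤s r p p<n r²∣) , (r₀≤r , r≤s r p p<n r²∣ , pr) , r²∣))
    by-search (no none) = ⊥-elim (impossible (λ p pp _ p≤x p≡c _ → decidable-stable (excluded? p) λ ¬ex → none (p , ≤-<-trans p≤x NM<n , pp , p≡c , ¬ex))
                    m a b large α≤ σ≤ h₁ h₂ error<)

-- Main term against error terms

sqrt : ∀ n → ∃[ s ] s * s ≤ n × n < suc s * suc s
sqrt zero = 0 , z≤n , s≤s z≤n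
sqrt (suc n) with sqrt n
... | s , s²≤n , n<[1+s]² with suc n <? suc s * suc s
...   | yes lt = s , m≤n⇒m≤1+n s²≤n , lt
...   | no ≮ = suc s , ≮⇒≥ ≮ , ≤-<-trans n<[1+s]² (*-mono-< {suc s} {suc (suc s)} {suc s} {suc (suc s)} ≤-refl ≤-refl)

log₂ : ∀ n → 1 ≤ n → ∃[ ℓ ] 2 ^ ℓ ≤ n × n < 2 ^ suc ℓ
log₂ (suc zero) _ = 0 , ≤-refl , s≤s (s≤s z≤n)
log₂ (suc n@(suc _)) _ with log₂ n (s≤s z≤n)
... | ℓ , lo , hi with suc n <? 2 ^ suc ℓ
...   | yes lt = ℓ , m≤n⇒m≤1+n lo , lt
...   | no ≮ = suc ℓ , ≮⇒≥ ≮ , ≤-<-trans hi (^-monoʳ-< 2 (s≤s (s≤s z≤n)) {suc ℓ} {suc (suc ℓ)} ≤-refl)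

<²⇒< : ∀ {a b} → a * a < b * b → a < b
<²⇒< {a} {b} lt = ≰⇒> λ b≤a → <⇒≱ lt (*-mono-≤ b≤a b≤a)

-- 55 is the value of 2 L + 9 for n = 2²², where L = 23. One more binary digit adds 2 to it but
-- doubles the right side, and (57/55)² < 2.
log-vs-sqrt : ∀ c k → (c * 55) * (c * 55) ≤ 2 ^ 22 → (c * (55 + 2 * k)) * (c * (55 + 2 * k)) ≤ 2 ^ (k + 22)
log-vs-sqrt c zero base = base
log-vs-sqrt c (suc k) base = begin
  (c * (55 + 2 * suc k)) * (c * (55 + 2 * suc k))    ≡⟨ solve 2 (λ c k → (c :* (con 55 :+ con 2 :* (con 1 :+ k))) :* (c :* (con 55 :+ con 2 :* (con 1 :+ k))) := (c :* c) :* ((con 57 :+ con 2 :* k) :* (con 57 :+ con 2 :* k))) refl c k ⟩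
  (c * c) * ((57 + 2 * k) * (57 + 2 * k))            ≤⟨ *-monoʳ-≤ (c * c) (≤-trans (m≤m+n _ (4 * k * k + 212 * k + 2801)) (≤-reflexive (solve 1 (λ k → (con 57 :+ con 2 :* k) :* (con 57 :+ con 2 :* k) :+ (con 4 :* k :* k :+ con 212 :* k :+ con 2801) := con 2 :* ((con 55 :+ con 2 :* k) :* (con 55 :+ con 2 :* k))) refl k))) ⟩
  (c * c) * (2 * ((55 + 2 * k) * (55 + 2 * k)))      ≡⟨ solve 2 (λ c v → (c :* c) :* (con 2 :* (v :* v)) := con 2 :* ((c :* v) :* (c :* v))) refl c (55 + 2 * k) ⟩
  2 * ((c * (55 + 2 * k)) * (c * (55 + 2 * k)))      ≤⟨ *-monoʳ-≤ 2 (log-vs-sqrt c k base) ⟩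
  2 * 2 ^ (k + 22)                                   ∎
  where
  open ≤-Reasoning
  open +-*-Solver

log≤sqrt : ∀ c ℓ s n → (c * 55) * (c * 55) ≤ 2 ^ 22 → 22 ≤ ℓ → 2 ^ ℓ ≤ n → n < suc s * suc s → c * (2 * suc ℓ + 9) ≤ s
log≤sqrt c ℓ s n base 22≤ℓ lo n< = ≤-pred (<²⇒< {b = suc s} (≤-<-trans (subst (λ t → t * t ≤ n) (cong (c *_) eq)
    (≤-trans (log-vs-sqrt c k base) (subst (λ e → 2 ^ e ≤ n) (sym (m∸n+n≡m 22≤ℓ)) lo))) n<))
  where
  open +-*-Solver
  k : ℕ
  k = ℓ ∸ 22
  eq : 55 + 2 * k ≡ 2 * suc ℓ + 9
  eq = trans (solve 1 (λ k → con 55 :+ con 2 :* k := con 2 :* (con 1 :+ (k :+ con 22)) :+ con 9) refl k) (cong (λ e → 2 * suc e + 9) (m∸n+n≡m 22≤ℓ))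

-- For `s ≥ T` the constant is absorbed by `y * s`, and the linear coefficient `x₁ + y` by `e * s`.
quadratic-dominates : ∀ s T a e x₁ x₀ y → T ≤ s → x₁ + y ≤ e * T → x₀ < y * T → a * (s * s) + (x₁ * s + x₀) < (a + e) * (s * s)
quadratic-dominates s T a e x₁ x₀ y T≤s h₁ h₀ = begin-strict
  a * (s * s) + (x₁ * s + x₀)          <⟨ +-monoʳ-< (a * (s * s)) (+-monoʳ-< (x₁ * s) (<-≤-trans h₀ (*-monoʳ-≤ y T≤s))) ⟩
  a * (s * s) + (x₁ * s + y * s)       ≡⟨ cong (a * (s * s) +_) (*-distribʳ-+ s x₁ y) ⟨
  a * (s * s) + (x₁ + y) * s           ≤⟨ +-monoʳ-≤ (a * (s * s)) (*-monoˡ-≤ s (≤-trans h₁ (*-monoʳ-≤ e T≤s))) ⟩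
  a * (s * s) + e * s * s              ≡⟨ solve 3 (λ a e s → a :* (s :* s) :+ e :* s :* s := (a :+ e) :* (s :* s)) refl a e s ⟩
  (a + e) * (s * s)                    ∎
  where
  open ≤-Reasoning
  open +-*-Solver

30*primes : ∀ q s P → 8 * q + 3 * q ≤ 330 → 1 ≤ q → P ≤ 8 * suc (s ÷ q) + 3 → q * P ≤ 8 * s + 330
30*primes q s P q≤ 1≤q le = begin
  q * P                            ≤⟨ *-monoʳ-≤ q le ⟩
  q * (8 * suc (s ÷ q) + 3)        ≡⟨ solve 2 (λ q d → q :* (con 8 :* (con 1 :+ d) :+ con 3) := con 8 :* (d :* q) :+ (con 8 :* q :+ con 3 :* q)) refl q (s ÷ q) ⟩
  8 * (s ÷ q * q) + (8 * q + 3 * q)  ≤⟨ +-mono-≤ (*-monoʳ-≤ 8 (m÷n*n≤m s q)) q≤ ⟩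
  8 * s + 330                      ∎
  where
  open ≤-Reasoning
  open +-*-Solver

-- The error terms are O(√n log n), the main term is linear in n.  The numerical
-- constants are variables, so that they are never unfolded.
main-exceeds-error : ∀ {p q r A B w T e y} n N M m L P s → T ≤ s → s * s ≤ n → n ≤ suc N * M → A * M ≤ w → A * M ≤ 10 * m →
                     p * (2 * L + 9) ≤ s → q * P ≤ 8 * s + r →
                     10 * B * 8 + e ≤ p * q * A → 10 * B * (r + 15 * q) + y ≤ e * T → 10 * B * (45 * (p * q)) + p * q * w < y * T →
                     B * ((2 * L + 9) * P + (30 * L + 180)) < m * N
main-exceeds-error {p} {q} {r} {A} {B} {w} {T} {e} {y} n N M m L P s T≤s s²≤n n≤ AM≤w AM≤10m pu≤s qP≤ h₂ h₁ h₀ = ≰⇒> λ mN≤ → <⇒≱ gap (begin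
    (10 * B * 8 + e) * (s * s)                             ≤⟨ *-monoˡ-≤ (s * s) h₂ ⟩
    p * q * A * (s * s)                                    ≡⟨ *-assoc (p * q) A (s * s) ⟩
    p * q * (A * (s * s))                                  ≤⟨ *-monoʳ-≤ (p * q) (bound mN≤) ⟩
    p * q * (10 * (B * V) + w)                             ≡⟨ solve 4 (λ d B V w → d :* (con 10 :* (B :* V) :+ w) := con 10 :* B :* (d :* V) :+ d :* w) refl (p * q) B V w ⟩
    10 * B * (p * q * V) + p * q * w                       ≤⟨ +-monoˡ-≤ (p * q * w) (*-monoʳ-≤ (10 * B) pqV≤) ⟩
    10 * B * (s * (8 * s + r) + (15 * q * s + 45 * (p * q))) + p * q * w  ≡⟨ solve 6 (λ b s r q d w → b :* (s :* (con 8 :* s :+ r) :+ (con 15 :* q :* s :+ con 45 :* d)) :+ w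
                                                                  := b :* con 8 :* (s :* s) :+ (b :* (r :+ con 15 :* q) :* s :+ (b :* (con 45 :* d) :+ w))) refl (10 * B) s r q (p * q) (p * q * w) ⟩
    10 * B * 8 * (s * s) + (10 * B * (r + 15 * q) * s + (10 * B * (45 * (p * q)) + p * q * w))  ∎)
  where
  open ≤-Reasoning
  open +-*-Solver
  u V : ℕ
  u = 2 * L + 9
  V = u * P + (30 * L + 180)
  gap = quadratic-dominates s T (10 * B * 8) e (10 * B * (r + 15 * q)) (10 * B * (45 * (p * q)) + p * q * w) y T≤s h₁ h₀
  bound : m * N ≤ B * V → A * (s * s) ≤ 10 * (B * V) + w
  bound mN≤ = begin
    A * (s * s)               ≤⟨ *-monoʳ-≤ A (≤-trans s²≤n n≤) ⟩
    A * (M + N * M)           ≡⟨ solve 3 (λ A M N → A :* (M :+ N :* M) := A :* M :* N :+ A :* M) refl A M N ⟩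
    A * M * N + A * M         ≤⟨ +-mono-≤ (*-monoˡ-≤ N AM≤10m) AM≤w ⟩
    10 * m * N + w            ≡⟨ cong (_+ w) (*-assoc 10 m N) ⟩
    10 * (m * N) + w          ≤⟨ +-monoˡ-≤ w (*-monoʳ-≤ 10 mN≤) ⟩
    10 * (B * V) + w          ∎
  pqV≤ : p * q * V ≤ s * (8 * s + r) + (15 * q * s + 45 * (p * q))
  pqV≤ = begin
    p * q * V                                              ≡⟨ solve 4 (λ p q L P → p :* q :* ((con 2 :* L :+ con 9) :* P :+ (con 30 :* L :+ con 180)) := (p :* (con 2 :* L :+ con 9)) :* (q :* P) :+ (con 15 :* q :* (p :* (con 2 :* L :+ con 9)) :+ con 45 :* (p :* q))) refl p q L P ⟩
    (p * u) * (q * P) + (15 * q * (p * u) + 45 * (p * q))  ≤⟨ +-mono-≤ (*-mono-≤ pu≤s qP≤) (+-monoˡ-≤ (45 * (p * q)) (*-monoʳ-≤ (15 * q) pu≤s)) ⟩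
    s * (8 * s + r) + (15 * q * s + 45 * (p * q))          ∎

-- The check of residues

allBelow : ℕ → (ℕ → Bool) → Bool
allBelow zero f = true
allBelow (suc n) f = f n ∧ allBelow n f

allBelow-sound : ∀ n f → allBelow n f ≡ true → ∀ i → i < n → f i ≡ true
allBelow-sound (suc n) f eq i i<1+n with f n in eqₙ | m≤n⇒m<n∨m≡n (≤-pred i<1+n)
... | true | inj₁ i<n = allBelow-sound n f eq i i<n
... | true | inj₂ refl = eqₙ

anyOf : List (ℕ × ℕ) → (ℕ × ℕ → Bool) → Bool
anyOf [] f = false
anyOf (a ∷ as) f = f a ∨ anyOf as f

-- i is the inverse of a residue g, so that cnt M 1 g s is 0 or 1 according to s < i or i ≤ s < M.
row : ℕ → (M : ℕ) .{{_ : NonZero M}} → List (ℕ × ℕ) → ℕ → Bool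
row T M table i = allBelow T λ t → (t % M <ᵇ i) ∨ anyOf table λ (μ , j) → j ≤ᵇ (t ÷ μ % M)

inverses : (M : ℕ) .{{_ : NonZero M}} → List (ℕ × ℕ) → ℕ → List (ℕ × ℕ)
inverses M L i = map (λ (μ , μ′) → μ , (μ′ * i) % M) L

-- `i` is found as the inverse of `g` by trying all residues. The class `g` = 1 is exempt: after
-- division by `c` it is that of the primes p ≡ c, whose excess is allowed.
residueCheck : (M : ℕ) .{{_ : NonZero M}} → List (ℕ × ℕ) → Bool
residueCheck M L = allBelow M λ g → allBelow M λ i →
  not ((g * i) % M ≡ᵇ 1) ∨ (g ≡ᵇ 1) ∨ row (121 * M) M (inverses M L i) i

∨-elim : ∀ {a b} → a ∨ b ≡ true → (a ≡ true) ⊎ (b ≡ true)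
∨-elim {true} eq = inj₁ refl
∨-elim {false} eq = inj₂ eq

module Residues (M : ℕ) .{{_ : NonZero M}} (1<M : 1 < M) (L : List (ℕ × ℕ))
                (L-inverse : All (λ (μ , μ′) → (μ * μ′) % M ≡ 1) L)
                (checked : residueCheck M L ≡ true) where

  ≡1⇒unit : ∀ {h h′} → (h * h′) % M ≡ 1 → Coprime h M
  ≡1⇒unit {h} {h′} eq (d∣h , d∣M) = ∣1⇒≡1 (subst (_ ∣_) eq (%-presˡ-∣ (∣m⇒∣m*n h′ d∣h) d∣M))

  cofactors-units : All (λ μ → Coprime μ M) (map proj₁ L)
  cofactors-units = go L-inverse
    where
    go : ∀ {L} → All (λ (μ , μ′) → (μ * μ′) % M ≡ 1) L → All (λ μ → Coprime μ M) (map proj₁ L)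
    go [] = []
    go (eq ∷ eqs) = ≡1⇒unit eq ∷ go eqs

  cnt-pos : ∀ h i s → 1 ≤ i → (h * i) % M ≡ 1 → i ≤ s → 1 ≤ cnt M 1 h s
  cnt-pos h i s 1≤i eq i≤s = ≤-trans (≤-reflexive (sym (𝟙-yes ((h * i) % M ≟ 1) eq))) (∑-term s (λ m → 𝟙 ((h * m) % M ≟ 1)) i 1≤i i≤s)

  cnt-zero : ∀ h i s → (h * i) % M ≡ 1 → i < M → s < i → cnt M 1 h s ≡ 0
  cnt-zero h (suc i) s eq i<M (s≤s s≤i) = n≤0⇒n≡0 (≤-trans (∑-monoˡ _ s≤i) (+-cancelʳ-≤ 1 (cnt M 1 h i) 0
    (subst (λ t → cnt M 1 h i + t ≤ 1) (𝟙-yes ((h * suc i) % M ≟ 1) eq) (cnt≤1 M 1 h 1<M (≡1⇒unit eq) (suc i) (<⇒≤ i<M)))))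

  nonzero-inverse : ∀ {h i} → (h * i) % M ≡ 1 → 1 ≤ i
  nonzero-inverse {h} {zero} eq = contradiction (trans (sym eq) (trans (cong (_% M) (*-zeroʳ h)) (m<n⇒m%n≡m (<-trans (s≤s z≤n) 1<M)))) λ ()
  nonzero-inverse {h} {suc i} eq = s≤s z≤n

  any-cofactor : ∀ {g i} L t → (g * i) % M ≡ 1 → All (λ (μ , μ′) → (μ * μ′) % M ≡ 1) L →
                 anyOf (inverses M L i) (λ (μ , j) → j ≤ᵇ (t ÷ μ % M)) ≡ true → 1 ≤ sumOver (map proj₁ L) (λ μ → cnt M 1 (μ * g) (t ÷ μ % M))
  any-cofactor {g} {i} ((μ , μ′) ∷ L) t eq (eqμ ∷ eqs) found with ∨-elim found
  ... | inj₂ found′ = ≤-trans (any-cofactor L t eq eqs found′) (m≤n+m _ _)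
  ... | inj₁ le = ≤-trans (cnt-pos (μ * g) j (t ÷ μ % M) (nonzero-inverse {μ * g} inv) inv (≤ᵇ⇒≤ j _ (subst T (sym le) _))) (m≤m+n _ _)
    where
    j = (μ′ * i) % M
    inv : (μ * g * j) % M ≡ 1
    inv = begin
      (μ * g * ((μ′ * i) % M)) % M    ≡⟨ %-*-congʳ M (μ * g) (m%n%n≡m%n (μ′ * i) M) ⟩
      (μ * g * (μ′ * i)) % M          ≡⟨ cong (_% M) (solve 4 (λ a b c d → a :* b :* (c :* d) := a :* c :* (b :* d)) refl μ g μ′ i) ⟩
      (μ * μ′ * (g * i)) % M          ≡⟨ %-*-congˡ M (g * i) (trans eqμ (sym (m<n⇒m%n≡m 1<M))) ⟩
      (1 * (g * i)) % M               ≡⟨ cong (_% M) (*-identityˡ (g * i)) ⟩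
      (g * i) % M                     ≡⟨ eq ⟩
      1                               ∎
      where
      open ≡-Reasoning
      open +-*-Solver

  unit-check : ∀ g t → g < M → Coprime g M → t < 121 * M →
               cnt M 1 g (t % M) ≤ 𝟙 (g ≟ 1) + sumOver (map proj₁ L) (λ μ → cnt M 1 (μ * g) (t ÷ μ % M))
  unit-check g t g<M unit t< = by-root (residue M {g} 1 1<M unit)
    where
    S : ℕ
    S = sumOver (map proj₁ L) (λ μ → cnt M 1 (μ * g) (t ÷ μ % M))
    by-root : ∃[ i ] i < M × Root M g 1 i → cnt M 1 g (t % M) ≤ 𝟙 (g ≟ 1) + S
    by-root (i , i<M , iff) = from-check (∨-elim {not ((g * i) % M ≡ᵇ 1)} (allBelow-sound M _ (allBelow-sound M _ checked g g<M) i i<M))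
      where
      inv : (g * i) % M ≡ 1
      inv = proj₂ (iff i) (m<n⇒m%n≡m i<M)
      ≤1 : cnt M 1 g (t % M) ≤ 1
      ≤1 = cnt≤1 M 1 g 1<M unit _ (m%n≤n t M)
      from-row : ((t % M <ᵇ i) ≡ true) ⊎ (anyOf (inverses M L i) (λ (μ , j) → j ≤ᵇ (t ÷ μ % M)) ≡ true) → cnt M 1 g (t % M) ≤ 𝟙 (g ≟ 1) + S
      from-row (inj₁ lt) = ≤-trans (≤-reflexive (cnt-zero g i (t % M) inv i<M (<ᵇ⇒< (t % M) i (subst T (sym lt) _)))) z≤n
      from-row (inj₂ found) = ≤-trans ≤1 (≤-trans (any-cofactor L t inv L-inverse found) (m≤n+m _ _))
      from-check : (not ((g * i) % M ≡ᵇ 1) ≡ true) ⊎ ((g ≡ᵇ 1) ∨ row (121 * M) M (inverses M L i) i ≡ true) → cnt M 1 g (t % M) ≤ 𝟙 (g ≟ 1) + S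
      from-check (inj₁ eq) = contradiction (trans (sym eq) (cong (λ a → not (a ≡ᵇ 1)) inv)) λ ()
      from-check (inj₂ eq) with ∨-elim {g ≡ᵇ 1} eq
      ... | inj₁ g≡1 = ≤-trans ≤1 (≤-trans (≤-reflexive (sym (𝟙-yes (g ≟ 1) (≡ᵇ⇒≡ g 1 (subst T (sym g≡1) _))))) (m≤m+n _ _))
      ... | inj₂ ok = from-row (∨-elim {t % M <ᵇ i} (allBelow-sound (121 * M) _ ok t t<))

  -- Division by `c` turns the condition h m ≡ c into g m ≡ 1 with g = h / c, so that one table
  -- serves all unit classes.
  check : ∀ c → c < M → Coprime c M → ∀ h t → Coprime h M → t < 121 * M →
          cnt M c h (t % M) ≤ 𝟙 (h % M ≟ c) + sumOver (map proj₁ L) (λ μ → cnt M c (μ * h) (t ÷ μ % M))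
  check c c<M c-unit h t h-unit t< with inverse M c-unit
  ... | c′ , inv = begin
    cnt M c h (t % M)                                                              ≡⟨ rescale h g (cong (_% M) refl) (t % M) ⟩
    cnt M 1 g (t % M)                                                              ≤⟨ unit-check g t (m%n<n (c′ * h) M) g-unit t< ⟩
    𝟙 (g ≟ 1) + sumOver (map proj₁ L) (λ μ → cnt M 1 (μ * g) (t ÷ μ % M))          ≤⟨ +-mono-≤ (𝟙-mono (g ≟ 1) (h % M ≟ c) back) (sumOver-mono (map proj₁ L) λ μ → ≤-reflexive (sym (rescale (μ * h) (μ * g) (push μ) (t ÷ μ % M)))) ⟩
    𝟙 (h % M ≟ c) + sumOver (map proj₁ L) (λ μ → cnt M c (μ * h) (t ÷ μ % M))      ∎
    where
    open ≤-Reasoning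
    open +-*-Solver
    1%M : 1 % M ≡ 1
    1%M = m<n⇒m%n≡m 1<M
    c%M : c % M ≡ c
    c%M = m<n⇒m%n≡m c<M
    g : ℕ
    g = (c′ * h) % M
    cancel : ∀ v → (c * (c′ * v)) % M ≡ v % M
    cancel v = trans (cong (_% M) (sym (*-assoc c c′ v))) (trans (%-*-congˡ M v inv) (cong (_% M) (*-identityˡ v)))
    to-1 : ∀ v → v % M ≡ c → (c′ * v) % M ≡ 1
    to-1 v eq = trans (%-*-congʳ M c′ (trans eq (sym c%M))) (trans (cong (_% M) (*-comm c′ c)) (trans inv 1%M))
    from-1 : ∀ v → (c′ * v) % M ≡ 1 → v % M ≡ c
    from-1 v eq = trans (sym (cancel v)) (trans (%-*-congʳ M c (trans eq (sym 1%M))) (trans (cong (_% M) (*-identityʳ c)) c%M))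
    back : g ≡ 1 → h % M ≡ c
    back = from-1 h
    c′-unit : Coprime c′ M
    c′-unit = ≡1⇒unit (trans (cong (_% M) (*-comm c′ c)) (trans inv 1%M))
    g-unit : Coprime g M
    g-unit (d∣g , d∣M) = coprime-* c′-unit h-unit (∣n∣m%n⇒∣m d∣M d∣g , d∣M)
    rescale : ∀ h g → g % M ≡ (c′ * h) % M % M → ∀ s → cnt M c h s ≡ cnt M 1 g s
    rescale h g eq s = ∑-cong s λ m _ _ → 𝟙-cong ((h * m) % M ≟ c) ((g * m) % M ≟ 1)
      (λ e → trans (pull m) (to-1 (h * m) e)) (λ e → from-1 (h * m) (trans (sym (pull m)) e))
      where
      pull : ∀ m → (g * m) % M ≡ (c′ * (h * m)) % M
      pull m = trans (%-*-congˡ M m (trans eq (m%n%n≡m%n (c′ * h) M))) (cong (_% M) (*-assoc c′ h m))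
    push : ∀ μ → (μ * g) % M ≡ (c′ * (μ * h)) % M % M
    push μ = trans (%-*-congʳ M μ (m%n%n≡m%n (c′ * h) M)) (trans (cong (_% M) (solve 3 (λ a b c → a :* (b :* c) := b :* (a :* c)) refl μ c′ h)) (sym (m%n%n≡m%n (c′ * (μ * h)) M)))

-- The primes below M not dividing M, with their inverses. For t < M they must suffice: a unit
-- residue i > 1 has such a prime factor μ, and i ≤ t gives i / μ ≤ t ÷ μ, where i / μ is the
-- inverse belonging to μ g. Larger t are left to the evaluation.
pairs12 pairs60 : List (ℕ × ℕ)
pairs12 = (5 , 5) ∷ (7 , 7) ∷ (11 , 11) ∷ []
pairs60 = (7 , 43) ∷ (11 , 11) ∷ (13 , 37) ∷ (17 , 53) ∷ (19 , 19) ∷ (23 , 47) ∷ (29 , 29) ∷ (31 , 31) ∷ (37 , 13) ∷ (41 , 41) ∷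
          (43 , 7) ∷ (47 , 23) ∷ (53 , 17) ∷ (59 , 59) ∷ []

residueCheck12 : residueCheck 12 pairs12 ≡ true
residueCheck12 = refl

residueCheck60 : residueCheck 60 pairs60 ≡ true
residueCheck60 = refl

-- Numerical constants

ps12 ps60 : List ℕ
ps12 = 2 ∷ 3 ∷ []
ps60 = 2 ∷ 3 ∷ 5 ∷ []

-- Upper bounds ρf, σf and lower bounds τf for log q / (q - 1) and log q.
ρf τf σf : ℕ → ℕ
ρf 2 = 1000
ρf 3 = 793
ρf 5 = 581
ρf _ = 0
τf 2 = 1000
τf 3 = 792
τf 5 = 580
τf _ = 0
σf 2 = 1000
σf 3 = 1585
σf 5 = 2322
σf _ = 0

cofactorWeight : List (ℕ × ℕ) → ℕ
cofactorWeight L = sumOver (map proj₁ L) (λ μ → suc (Q ÷ μ))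

squareWeights : ℕ → ℕ → ℕ → ℕ
squareWeights α ρ r₀ = ∑ (2 ^ j₀) (square-weight (α + ρ + half) r₀)

opaque
  unfolding scale Q j₀ half eighth Margin Tail

  12≼ : 12 ≼ 3585
  12≼ = ≼-intro (≤ᵇ⇒≤ (12 ^ 1000) (2 ^ 3585) _)
  12≽ : 12 ≽ 3584
  12≽ = ≽-intro (≤ᵇ⇒≤ (2 ^ 3584) (12 ^ 1000) _)
  60≼ : 60 ≼ 5907
  60≼ = ≼-intro (≤ᵇ⇒≤ (60 ^ 1000) (2 ^ 5907) _)
  60≽ : 60 ≽ 5906
  60≽ = ≽-intro (≤ᵇ⇒≤ (2 ^ 5906) (60 ^ 1000) _)

  bounds-2 : 2 ≼ ρf 2 * 1 × 2 ≽ τf 2 * 1 × 2 ≼ σf 2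
  bounds-2 = ≼-intro (≤ᵇ⇒≤ (2 ^ 1000) (2 ^ 1000) _) , ≽-intro (≤ᵇ⇒≤ (2 ^ 1000) (2 ^ 1000) _) , ≼-intro (≤ᵇ⇒≤ (2 ^ 1000) (2 ^ 1000) _)
  bounds-3 : 3 ≼ ρf 3 * 2 × 3 ≽ τf 3 * 2 × 3 ≼ σf 3
  bounds-3 = ≼-intro (≤ᵇ⇒≤ (3 ^ 1000) (2 ^ 1586) _) , ≽-intro (≤ᵇ⇒≤ (2 ^ 1584) (3 ^ 1000) _) , ≼-intro (≤ᵇ⇒≤ (3 ^ 1000) (2 ^ 1585) _)
  bounds-5 : 5 ≼ ρf 5 * 4 × 5 ≽ τf 5 * 4 × 5 ≼ σf 5
  bounds-5 = ≼-intro (≤ᵇ⇒≤ (5 ^ 1000) (2 ^ 2324) _) , ≽-intro (≤ᵇ⇒≤ (2 ^ 2320) (5 ^ 1000) _) , ≼-intro (≤ᵇ⇒≤ (5 ^ 1000) (2 ^ 2322) _)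

  7≼ : 7 ≼ 2808
  7≼ = ≼-intro (≤ᵇ⇒≤ (7 ^ 1000) (2 ^ 2808) _)
  11≼ : 11 ≼ 3460
  11≼ = ≼-intro (≤ᵇ⇒≤ (11 ^ 1000) (2 ^ 3460) _)
  13≼ : 13 ≼ 3701
  13≼ = ≼-intro (≤ᵇ⇒≤ (13 ^ 1000) (2 ^ 3701) _)
  25≼ : 25 ≼ 4644
  25≼ = ≼-intro (≤ᵇ⇒≤ (25 ^ 1000) (2 ^ 4644) _)
  49≼ : 49 ≼ 5615
  49≼ = ≼-intro (≤ᵇ⇒≤ (49 ^ 1000) (2 ^ 5615) _)

  step-7 : 8 ^ scale ≤ 7 ^ scale * 2 ^ 193
  step-7 = ≤ᵇ⇒≤ (8 ^ 1000) (7 ^ 1000 * 2 ^ 193) _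
  step-11 : 12 ^ scale ≤ 11 ^ scale * 2 ^ 126
  step-11 = ≤ᵇ⇒≤ (12 ^ 1000) (11 ^ 1000 * 2 ^ 126) _
  step-13 : 14 ^ scale ≤ 13 ^ scale * 2 ^ 107
  step-13 = ≤ᵇ⇒≤ (14 ^ 1000) (13 ^ 1000 * 2 ^ 107) _

  -- Weight α ρ κ ℓ ρ′ w: the class of κ costs at most w/Q per unit of N.
  Weight : (α ρ κ ℓ ρ′ w : ℕ) → Set
  Weight α ρ κ ℓ ρ′ w = Q * (α + ℓ + (ρ + ρ′)) ≤ w * κ × w ≤ Q * (scale * 9)

  weight-bounds : ∀ {α ρ κ ℓ ρ′ w} → Weight α ρ κ ℓ ρ′ w → Q * (α + ℓ + (ρ + ρ′)) ≤ w * κ × w ≤ Q * (scale * 9)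
  weight-bounds h = h

  weight-12-7 : Weight 3585 1793 7 2808 half 1240857143
  weight-12-7 = ≤ᵇ⇒≤ (1000000 * (3585 + 2808 + (1793 + 500))) (1240857143 * 7) _ , ≤ᵇ⇒≤ 1240857143 9000000000 _

  weight-12-11 : Weight 3585 1793 11 3460 half 848909091
  weight-12-11 = ≤ᵇ⇒≤ (1000000 * (3585 + 3460 + (1793 + 500))) (848909091 * 11) _ , ≤ᵇ⇒≤ 848909091 9000000000 _

  weight-12-13 : Weight 3585 1793 13 3701 half 736846154
  weight-12-13 = ≤ᵇ⇒≤ (1000000 * (3585 + 3701 + (1793 + 500))) (736846154 * 13) _ , ≤ᵇ⇒≤ 736846154 9000000000 _

  weight-12-25 : Weight 3585 1793 25 4644 581 424120000
  weight-12-25 = ≤ᵇ⇒≤ (1000000 * (3585 + 4644 + (1793 + 581))) (424120000 * 25) _ , ≤ᵇ⇒≤ 424120000 9000000000 _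

  weight-12-49 : Weight 3585 1793 49 5615 half 234551021
  weight-12-49 = ≤ᵇ⇒≤ (1000000 * (3585 + 5615 + (1793 + 500))) (234551021 * 49) _ , ≤ᵇ⇒≤ 234551021 9000000000 _

  weight-60-7 : Weight 5907 2374 7 2808 half 1655571429
  weight-60-7 = ≤ᵇ⇒≤ (1000000 * (5907 + 2808 + (2374 + 500))) (1655571429 * 7) _ , ≤ᵇ⇒≤ 1655571429 9000000000 _

  weight-60-11 : Weight 5907 2374 11 3460 half 1112818182
  weight-60-11 = ≤ᵇ⇒≤ (1000000 * (5907 + 3460 + (2374 + 500))) (1112818182 * 11) _ , ≤ᵇ⇒≤ 1112818182 9000000000 _

  weight-60-49 : Weight 5907 2374 49 5615 half 293795919
  weight-60-49 = ≤ᵇ⇒≤ (1000000 * (5907 + 5615 + (2374 + 500))) (293795919 * 49) _ , ≤ᵇ⇒≤ 293795919 9000000000 _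

  -- 2 · 10⁶ · 33878 / 4096, rounded up. The weights of the kills are obtained by rounding up as
  -- well.
  tail-12 : Tail (3585 + 1793 + half) 16541993
  tail-12 = ≤ᵇ⇒≤ (2 * 1000000 * (5878 + 26000 + 2000)) (4096 * 16541993) _

  tail-60 : Tail (5907 + 2374 + half) 17959473
  tail-60 = ≤ᵇ⇒≤ (2 * 1000000 * (8781 + 26000 + 2000)) (4096 * 17959473) _

  -- 2536503207 is the sum of `w` and `w₂` for the kills 7, 11 and 25; 5376 = 3584 + 1000 + 792 is
  -- the lower bound for log 12 and for the densities of 2 and 3; 95 is the surplus.
  margin-A : Margin 3585 1793 (cofactorWeight pairs12) 2536503207 (squareWeights 3585 1793 13) 16541993 5376 95
  margin-A = ≤ᵇ⇒≤ _ _ _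

  margin-B : Margin 3585 1793 (cofactorWeight pairs12) 2422732513 (squareWeights 3585 1793 11) 16541993 5376 95
  margin-B = ≤ᵇ⇒≤ _ _ _

  margin-C : Margin 3585 1793 (cofactorWeight pairs12) 2257393400 (squareWeights 3585 1793 11) 16541993 5376 95
  margin-C = ≤ᵇ⇒≤ _ _ _

  margin-D : Margin 5907 2374 (cofactorWeight pairs60) 1659513266 (squareWeights 5907 2374 11) 17959473 8278 505
  margin-D = ≤ᵇ⇒≤ _ _ _

  margin-E : Margin 5907 2374 (cofactorWeight pairs60) 1408400121 (squareWeights 5907 2374 11) 17959473 8278 505
  margin-E = ≤ᵇ⇒≤ _ _ _

radical-12 : ∀ p → Prime p → 𝟙 (p ∣? 12) ≡ sumOver ps12 (λ q → 𝟙 (p ≟ q))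
radical-12 p pp = by-divisibility (p ∣? 12)
  where
  by-divisibility : Dec (p ∣ 12) → 𝟙 (p ∣? 12) ≡ sumOver ps12 (λ q → 𝟙 (p ≟ q))
  by-divisibility (no p∤) = trans (𝟙-no (p ∣? 12) p∤) (sym (cong₂ (λ a b → a + (b + 0))
    (𝟙-no (p ≟ 2) λ { refl → p∤ (divides 6 refl) }) (𝟙-no (p ≟ 3) λ { refl → p∤ (divides 4 refl) })))
  by-divisibility (yes p∣) with euclidsLemma 4 3 pp p∣
  ... | inj₂ p∣3 with prime-∣ pp prime[3] p∣3
  ...   | refl = trans (𝟙-yes (3 ∣? 12) p∣) (sym (cong₂ (λ a b → a + (b + 0)) (𝟙-no (3 ≟ 2) λ ()) (𝟙-yes (3 ≟ 3) refl)))
  by-divisibility (yes p∣) | inj₁ p∣4 with prime∣prime^⇒≡ 2 prime[2] pp p∣4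
  ...   | refl = trans (𝟙-yes (2 ∣? 12) p∣) (sym (cong₂ (λ a b → a + (b + 0)) (𝟙-yes (2 ≟ 2) refl) (𝟙-no (2 ≟ 3) λ ())))

prime∣60 : ∀ p → Prime p → p ∣ 60 → p ≡ 2 ⊎ p ≡ 3 ⊎ p ≡ 5
prime∣60 p pp p∣ with euclidsLemma 4 15 pp p∣
... | inj₁ p∣4 = inj₁ (prime∣prime^⇒≡ 2 prime[2] pp p∣4)
... | inj₂ p∣15 with euclidsLemma 3 5 pp p∣15
...   | inj₁ p∣3 = inj₂ (inj₁ (prime-∣ pp prime[3] p∣3))
...   | inj₂ p∣5 = inj₂ (inj₂ (prime-∣ pp prime[5] p∣5))

radical-60 : ∀ p → Prime p → 𝟙 (p ∣? 60) ≡ sumOver ps60 (λ q → 𝟙 (p ≟ q))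
radical-60 p pp = by-divisibility (p ∣? 60)
  where
  three : ∀ {a b c a′ b′ c′ : ℕ} → a ≡ a′ → b ≡ b′ → c ≡ c′ → a + (b + (c + 0)) ≡ a′ + (b′ + (c′ + 0))
  three refl refl refl = refl
  by-divisibility : Dec (p ∣ 60) → 𝟙 (p ∣? 60) ≡ sumOver ps60 (λ q → 𝟙 (p ≟ q))
  by-divisibility (no p∤) = trans (𝟙-no (p ∣? 60) p∤) (sym (three {a′ = 0} {0} {0}
    (𝟙-no (p ≟ 2) λ { refl → p∤ (divides 30 refl) }) (𝟙-no (p ≟ 3) λ { refl → p∤ (divides 20 refl) }) (𝟙-no (p ≟ 5) λ { refl → p∤ (divides 12 refl) })))
  by-divisibility (yes p∣) with prime∣60 p pp p∣
  ... | inj₁ refl = trans (𝟙-yes (2 ∣? 60) p∣) (sym (three {a′ = 1} {0} {0} (𝟙-yes (2 ≟ 2) refl) (𝟙-no (2 ≟ 3) λ ()) (𝟙-no (2 ≟ 5) λ ())))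
  ... | inj₂ (inj₁ refl) = trans (𝟙-yes (3 ∣? 60) p∣) (sym (three {a′ = 0} {1} {0} (𝟙-no (3 ≟ 2) λ ()) (𝟙-yes (3 ≟ 3) refl) (𝟙-no (3 ≟ 5) λ ())))
  ... | inj₂ (inj₂ refl) = trans (𝟙-yes (5 ∣? 60) p∣) (sym (three {a′ = 0} {0} {1} (𝟙-no (5 ≟ 2) λ ()) (𝟙-no (5 ≟ 3) λ ()) (𝟙-yes (5 ≟ 5) refl)))

smooth-60 : ∀ p → Prime p → p ∣ 60 → p ≤ 5
smooth-60 p pp p∣ with prime∣60 p pp p∣
... | inj₁ refl = ≤ᵇ⇒≤ 2 5 _
... | inj₂ (inj₁ refl) = ≤ᵇ⇒≤ 3 5 _
... | inj₂ (inj₂ refl) = ≤ᵇ⇒≤ 5 5 _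

smooth-12 : ∀ p → Prime p → p ∣ 12 → p ≤ 5
smooth-12 p pp p∣12 = smooth-60 p pp (∣-trans p∣12 (divides 5 refl))

-- Logarithms grow by at most log ((q₀ + 1) / q₀) per step beyond q₀.
≼-linear : ∀ q₀ ℓ₀ s₀ → 1 ≤ q₀ → q₀ ≼ ℓ₀ → suc q₀ ^ scale ≤ q₀ ^ scale * 2 ^ s₀ → ∀ t → t + q₀ ≼ ℓ₀ + t * s₀
≼-linear q₀ ℓ₀ s₀ 1≤q₀ base step zero = subst (q₀ ≼_) (sym (+-identityʳ ℓ₀)) base
≼-linear q₀ ℓ₀ s₀ 1≤q₀ base step (suc t) = ≼-intro (*-cancelʳ-≤ _ _ (q₀ ^ scale) {{m^n≢0 q₀ scale {{>-nonZero 1≤q₀}}}} (begin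
  suc q ^ scale * q₀ ^ scale                         ≡⟨ ^-distribʳ-* (suc q) q₀ scale ⟨
  (suc q * q₀) ^ scale                               ≤⟨ ^-monoˡ-≤ scale (≤-trans (+-monoˡ-≤ (q * q₀) (m≤n+m q₀ t)) (≤-reflexive (solve 2 (λ q p → q :+ q :* p := q :* (con 1 :+ p)) refl q q₀))) ⟩
  (q * suc q₀) ^ scale                               ≡⟨ ^-distribʳ-* q (suc q₀) scale ⟩
  q ^ scale * suc q₀ ^ scale                         ≤⟨ *-mono-≤ (_≼_.≼-elim (≼-linear q₀ ℓ₀ s₀ 1≤q₀ base step t)) step ⟩
  2 ^ (ℓ₀ + t * s₀) * (q₀ ^ scale * 2 ^ s₀)          ≡⟨ solve 3 (λ a b c → a :* (b :* c) := a :* c :* b) refl (2 ^ (ℓ₀ + t * s₀)) (q₀ ^ scale) (2 ^ s₀) ⟩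
  2 ^ (ℓ₀ + t * s₀) * 2 ^ s₀ * q₀ ^ scale            ≡⟨ cong (_* q₀ ^ scale) (^-distribˡ-+-* 2 (ℓ₀ + t * s₀) s₀) ⟨
  2 ^ (ℓ₀ + t * s₀ + s₀) * q₀ ^ scale                ≡⟨ cong (λ e → 2 ^ e * q₀ ^ scale) (solve 3 (λ l t s → l :+ t :* s :+ s := l :+ (con 1 :+ t) :* s) refl ℓ₀ t s₀) ⟩
  2 ^ (ℓ₀ + suc t * s₀) * q₀ ^ scale                 ∎))
  where
  open ≤-Reasoning
  open +-*-Solver
  q = t + q₀

-- Every prime q ≥ `q₀` is charged the weight of `q₀`. Along q = `q₀` + t the cost grows by at most
-- `Q * s₀` per step and the allowance w q by `w`, which is no less by `slope`.
primeKill : ∀ {M α ρ} .{{_ : NonZero M}} → (∀ p → Prime p → p ∣ M → p ≤ 5) → ρ + half ≤ 3 * scale →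
            ∀ q₀ ℓ₀ s₀ w w₂ → 7 ≤ q₀ → q₀ ≼ ℓ₀ → suc q₀ ^ scale ≤ q₀ ^ scale * 2 ^ s₀ →
            Weight α ρ q₀ ℓ₀ half w → Q * s₀ ≤ w → w ≤ w₂ * (M * q₀) →
            ∀ q → Prime q → q₀ ≤ q → Kill M α ρ
primeKill {M} {α} {ρ} smooth ρ-small q₀ ℓ₀ s₀ w w₂ 7≤q₀ q₀≼ step weight slope weight₂ q pq q₀≤q = record
  { κ = q ; r = q ; ℓ = ℓ₀ + t * s₀ ; ρ′ = half ; w = w ; w₂ = w₂
  ; κ-nonZero = prime⇒nonZero pq
  ; 7≤κ = 7≤q
  ; κ-unit = coprime-sym (prime-coprime pq λ q∣M → <⇒≱ (≤-trans (≤ᵇ⇒≤ 6 7 _) 7≤q) (smooth q pq q∣M))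
  ; r-prime = pq
  ; r∣κ = ∣-refl
  ; only = λ p pp p∣q → prime-∣ pp pq p∣q
  ; κ≼ℓ = subst (_≼ ℓ₀ + t * s₀) (m∸n+n≡m q₀≤q) (≼-linear q₀ ℓ₀ s₀ (≤-trans (s≤s z≤n) 7≤q₀) q₀≼ step t)
  ; r≼ρ′ = ≼-half 7≤q
  ; ρ-small = ρ-small
  ; weight = begin
      Q * (α + (ℓ₀ + t * s₀) + (ρ + half))            ≡⟨ solve 7 (λ Q a l t s r h → Q :* (a :+ (l :+ t :* s) :+ (r :+ h)) := Q :* s :* t :+ Q :* (a :+ l :+ (r :+ h))) refl Q α ℓ₀ t s₀ ρ half ⟩
      Q * s₀ * t + Q * (α + ℓ₀ + (ρ + half))          ≤⟨ +-mono-≤ (*-monoˡ-≤ t slope) (proj₁ (weight-bounds weight)) ⟩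
      w * t + w * q₀                                  ≡⟨ *-distribˡ-+ w t q₀ ⟨
      w * (t + q₀)                                    ≡⟨ cong (w *_) (m∸n+n≡m q₀≤q) ⟩
      w * q                                           ∎
  ; weight₂ = ≤-trans weight₂ (*-monoʳ-≤ w₂ (*-monoʳ-≤ M q₀≤q))
  ; weight-small = proj₂ (weight-bounds weight)
  }
  where
  open ≤-Reasoning
  open +-*-Solver
  t = q ∸ q₀
  7≤q : 7 ≤ q
  7≤q = ≤-trans 7≤q₀ q₀≤q

squareOfKill : ∀ {M α ρ} .{{_ : NonZero M}} r κ → κ ≡ r * r → 7 ≤ κ → Prime r → ¬ (r ∣ M) → ∀ ℓ ρ′ w w₂ → κ ≼ ℓ → r ≼ ρ′ * pred r → ρ + ρ′ ≤ 3 * scale →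
               Weight α ρ κ ℓ ρ′ w → w ≤ w₂ * (M * κ) → Kill M α ρ
squareOfKill {M} r κ refl 7≤κ pr r∤M ℓ ρ′ w w₂ κ≼ r≼ ρ-small weight weight₂ = record
  { κ = κ ; r = r ; ℓ = ℓ ; ρ′ = ρ′ ; w = w ; w₂ = w₂
  ; κ-nonZero = >-nonZero (≤-trans (s≤s z≤n) 7≤κ)
  ; 7≤κ = 7≤κ
  ; κ-unit = subst (λ t → Coprime t M) (cong (r *_) (*-identityʳ r)) (coprime-^ 2 pr r∤M)
  ; r-prime = pr
  ; r∣κ = m∣m*n r
  ; only = only
  ; κ≼ℓ = κ≼
  ; r≼ρ′ = r≼
  ; ρ-small = ρ-small
  ; weight = proj₁ (weight-bounds weight)
  ; weight₂ = weight₂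
  ; weight-small = proj₂ (weight-bounds weight)
  }
  where
  only : ∀ p → Prime p → p ∣ r * r → p ≡ r
  only p pp p∣ with euclidsLemma r r pp p∣
  ... | inj₁ d = prime-∣ pp pr d
  ... | inj₂ d = prime-∣ pp pr d

prime[7] : Prime 7
prime[7] = from-yes (prime? 7)

prime[11] : Prime 11
prime[11] = from-yes (prime? 11)

opaque
  unfolding scale Q half

  ρ-small-12 : 1793 + half ≤ 3 * scale
  ρ-small-12 = ≤ᵇ⇒≤ 2293 3000 _
  ρ-small-60 : 2374 + half ≤ 3 * scale
  ρ-small-60 = ≤ᵇ⇒≤ 2874 3000 _
  ρ-small-25 : 1793 + 581 ≤ 3 * scale
  ρ-small-25 = ≤ᵇ⇒≤ 2374 3000 _
  slope-12-7 : Q * 193 ≤ 1240857143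
  slope-12-7 = ≤ᵇ⇒≤ 193000000 1240857143 _
  slope-12-11 : Q * 126 ≤ 848909091
  slope-12-11 = ≤ᵇ⇒≤ 126000000 848909091 _
  slope-12-13 : Q * 107 ≤ 736846154
  slope-12-13 = ≤ᵇ⇒≤ 107000000 736846154 _
  slope-60-7 : Q * 193 ≤ 1655571429
  slope-60-7 = ≤ᵇ⇒≤ 193000000 1655571429 _
  slope-60-11 : Q * 126 ≤ 1112818182
  slope-60-11 = ≤ᵇ⇒≤ 126000000 1112818182 _

kill12-7 : Kill 12 3585 1793
kill12-7 = primeKill smooth-12 ρ-small-12 7 2808 193 1240857143 14772109 (≤ᵇ⇒≤ 7 7 _) 7≼ step-7 weight-12-7 slope-12-7 (≤ᵇ⇒≤ 1240857143 (14772109 * 84) _) 7 prime[7] ≤-refl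

kill12-≥11 kill12-≥13 : ∀ q → Prime q → _ → Kill 12 3585 1793
kill12-≥11 = primeKill smooth-12 ρ-small-12 11 3460 126 848909091 6431130 (≤ᵇ⇒≤ 7 11 _) 11≼ step-11 weight-12-11 slope-12-11 (≤ᵇ⇒≤ 848909091 (6431130 * 132) _)
kill12-≥13 = primeKill smooth-12 ρ-small-12 13 3701 107 736846154 4723373 (≤ᵇ⇒≤ 7 13 _) 13≼ step-13 weight-12-13 slope-12-13 (≤ᵇ⇒≤ 736846154 (4723373 * 156) _)

kill12-25 kill12-49 : Kill 12 3585 1793
kill12-25 = squareOfKill 5 25 refl (≤ᵇ⇒≤ 7 25 _) prime[5] (λ 5∣12 → from-no (5 ∣? 12) 5∣12) 4644 581 424120000 1413734 25≼ (proj₁ bounds-5) ρ-small-25 weight-12-25 (≤ᵇ⇒≤ 424120000 (1413734 * 300) _)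
kill12-49 = squareOfKill 7 49 refl (≤ᵇ⇒≤ 7 49 _) prime[7] (λ 7∣12 → from-no (7 ∣? 12) 7∣12) 5615 half 234551021 398897 49≼ (≼-half (≤ᵇ⇒≤ 7 7 _)) ρ-small-12 weight-12-49 (≤ᵇ⇒≤ 234551021 (398897 * 588) _)

kill60-≥7 kill60-≥11 : ∀ q → Prime q → _ → Kill 60 5907 2374
kill60-≥7 = primeKill smooth-60 ρ-small-60 7 2808 193 1655571429 3941837 (≤ᵇ⇒≤ 7 7 _) 7≼ step-7 weight-60-7 slope-60-7 (≤ᵇ⇒≤ 1655571429 (3941837 * 420) _)
kill60-≥11 = primeKill smooth-60 ρ-small-60 11 3460 126 1112818182 1686089 (≤ᵇ⇒≤ 7 11 _) 11≼ step-11 weight-60-11 slope-60-11 (≤ᵇ⇒≤ 1112818182 (1686089 * 660) _)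

kill60-49 : Kill 60 5907 2374
kill60-49 = squareOfKill 7 49 refl (≤ᵇ⇒≤ 7 49 _) prime[7] (λ 7∣60 → from-no (7 ∣? 60) 7∣60) 5615 half 293795919 99931 49≼ (≼-half (≤ᵇ⇒≤ 7 7 _)) ρ-small-60 weight-60-49 (≤ᵇ⇒≤ 293795919 (99931 * 2940) _)

opaque
  unfolding scale

  α≤-12 : 3585 ≤ 4 * scale
  α≤-12 = ≤ᵇ⇒≤ 3585 4000 _
  α≤-60 : 5907 ≤ 6 * scale
  α≤-60 = ≤ᵇ⇒≤ 5907 6000 _
  σ≤-12 : 2585 ≤ 3 * scale
  σ≤-12 = ≤ᵇ⇒≤ 2585 3000 _
  σ≤-60 : 4907 ≤ 5 * scale
  σ≤-60 = ≤ᵇ⇒≤ 4907 5000 _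

  -- The hypotheses of main-exceeds-error for p = 37, q = 30 and s ≥ 2048.
  leading : 10 * scale * 8 + 7690 ≤ 37 * 30 * 79
  leading = ≤ᵇ⇒≤ 87690 87690 _
  linear : 10 * scale * (330 + 15 * 30) + 7949120 ≤ 7690 * 2048
  linear = ≤ᵇ⇒≤ 15749120 15749120 _
  constant : 10 * scale * (45 * (37 * 30)) + 37 * 30 * 4740 < 7949120 * 2048
  constant = ≤ᵇ⇒≤ 504761401 16279797760 _

-- The range n ≥ 2 ^ 22

module Large (n : ℕ) (2^22≤n : 2 ^ 22 ≤ n) where

  s ℓ L : ℕ
  s = proj₁ (sqrt n)
  ℓ = proj₁ (log₂ n (≤-trans (≤ᵇ⇒≤ 1 (2 ^ 22) _) 2^22≤n))
  L = suc ℓ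

  1≤n : 1 ≤ n
  1≤n = ≤-trans (≤ᵇ⇒≤ 1 (2 ^ 22) _) 2^22≤n

  s²≤n : s * s ≤ n
  s²≤n = proj₁ (proj₂ (sqrt n))

  n<[1+s]² : n < suc s * suc s
  n<[1+s]² = proj₂ (proj₂ (sqrt n))

  2^ℓ≤n : 2 ^ ℓ ≤ n
  2^ℓ≤n = proj₁ (proj₂ (log₂ n (≤-trans (≤ᵇ⇒≤ 1 (2 ^ 22) _) 2^22≤n)))

  n<2^L : n < 2 ^ L
  n<2^L = proj₂ (proj₂ (log₂ n (≤-trans (≤ᵇ⇒≤ 1 (2 ^ 22) _) 2^22≤n)))

  2048≤s : 2048 ≤ s
  2048≤s = ≤-pred (<²⇒< {2048} {suc s} (≤-<-trans 2^22≤n n<[1+s]²))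

  22≤ℓ : 22 ≤ ℓ
  22≤ℓ = ≤-pred (≰⇒> λ L≤22 → <⇒≱ (<-≤-trans n<2^L (^-monoʳ-≤ 2 L≤22)) 2^22≤n)

  s≤n : s ≤ n
  s≤n = ≤-trans (m≤m*n s s {{>-nonZero (≤-trans (≤ᵇ⇒≤ 1 2048 _) 2048≤s)}}) s²≤n

  log-s : 37 * (2 * L + 9) ≤ s
  log-s = log≤sqrt 37 ℓ s n (≤ᵇ⇒≤ (37 * 55 * (37 * 55)) (2 ^ 22) _) 22≤ℓ 2^ℓ≤n n<[1+s]²

  primes-s : 30 * primeCount s ≤ 8 * s + 330
  primes-s = 30*primes 30 s (primeCount s) (≤ᵇ⇒≤ 330 330 _) (≤ᵇ⇒≤ 1 30 _) (primeCount-upper s)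

  module _ (M : ℕ) .{{_ : NonZero M}} (M≤60 : M ≤ 60) where

    N : ℕ
    N = pred n ÷ M

    NM<n : N * M < n
    NM<n = ≤-<-trans (m÷n*n≤m (pred n) M) (≤-reflexive (suc-pred n {{>-nonZero 1≤n}}))

    n≤[1+N]M : n ≤ suc N * M
    n≤[1+N]M = subst (_≤ suc N * M) (suc-pred n {{>-nonZero 1≤n}}) (m<[1+m÷n]*n (pred n) M (>-nonZero⁻¹ M))

    2≤N : 2 ≤ N
    2≤N = m*n≤o⇒m≤o÷n 2 M (pred n) (>-nonZero⁻¹ M) (≤-trans (*-monoʳ-≤ 2 M≤60) (≤-pred (subst (121 ≤_) (sym (suc-pred n {{>-nonZero 1≤n}})) (≤-trans (≤ᵇ⇒≤ 121 (2 ^ 22) _) 2^22≤n))))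

    -- As N ≈ n / M, the condition demands a surplus of 7.9 thousandths of a bit for each integer up
    -- to n. The surpluses 95 for M = 12 and 505 for M = 60 satisfy it.
    error< : ∀ m → 79 * M ≤ 10 * m → scale * ((2 * L + 9) * primeCount s + (30 * L + 180)) < m * N
    error< m 79M≤10m = main-exceeds-error {37} {30} {330} {79} {scale} {4740} {2048} {7690} {7949120}
      n N M m L (primeCount s) s 2048≤s s²≤n n≤[1+N]M (*-monoʳ-≤ 79 M≤60) 79M≤10m log-s primes-s leading linear constant

  module R12 = Residues 12 (≤ᵇ⇒≤ 2 12 _) pairs12 (refl ∷ refl ∷ refl ∷ []) residueCheck12
  module R60 = Residues 60 (≤ᵇ⇒≤ 2 60 _) pairs60 (refl ∷ refl ∷ refl ∷ refl ∷ refl ∷ refl ∷ refl ∷ refl ∷ refl ∷ refl ∷ refl ∷ refl ∷ refl ∷ refl ∷ []) residueCheck60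

  module _ (c : ℕ) (c<12 : c < 12) (c-unit : Coprime c 12) where

    admissible₁₂ = Assembly.admissible n L s 1≤n n<2^L n<[1+s]² s≤n 12 c c<12 c-unit (≤ᵇ⇒≤ 13 64 _) ≤-refl
      (N 12 (≤ᵇ⇒≤ 12 60 _)) (2≤N 12 (≤ᵇ⇒≤ 12 60 _)) (NM<n 12 (≤ᵇ⇒≤ 12 60 _))
      (map proj₁ pairs12) R12.cofactors-units (R12.check c c<12 c-unit)
      ps12 ((prime[2] , ≤ᵇ⇒≤ 2 5 _) ∷ (prime[3] , ≤ᵇ⇒≤ 3 5 _) ∷ []) radical-12 smooth-12
      3585 3584 12≼ 12≽ ρf τf σf ((prime[2] , bounds-2) ∷ (prime[3] , bounds-3) ∷ []) ρ-small-12

    -- For b < 13 and a ≤ b, neither equal to 5: avoiding 7 and 11 altogether covers every such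
    -- pair, and their squares with them, so that the sum over squares starts at 13.
    case-A : ∃ (Admissible n 12 c 13 (7 ∷ 11 ∷ 25 ∷ []))
    case-A = admissible₁₂ 13 (≤ᵇ⇒≤ 11 13 _) (kill12-7 ∷ kill12-≥11 11 prime[11] ≤-refl ∷ kill12-25 ∷ []) 16541993 tail-12 95 4 3 margin-A α≤-12 σ≤-12 (≤ᵇ⇒≤ 19 30 _) (≤ᵇ⇒≤ 113 180 _)
               (error< 12 (≤ᵇ⇒≤ 12 60 _) 95 (≤ᵇ⇒≤ 948 950 _))

    case-B : ∀ q → Prime q → 13 ≤ q → ∃ (Admissible n 12 c 11 (7 ∷ q ∷ 25 ∷ []))
    case-B q pq 13≤q = admissible₁₂ 11 ≤-refl (kill12-7 ∷ kill12-≥13 q pq 13≤q ∷ kill12-25 ∷ []) 16541993 tail-12 95 4 3 margin-B α≤-12 σ≤-12 (≤ᵇ⇒≤ 19 30 _) (≤ᵇ⇒≤ 113 180 _)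
               (error< 12 (≤ᵇ⇒≤ 12 60 _) 95 (≤ᵇ⇒≤ 948 950 _))

    -- Here 7 itself may divide n - p, so that only 49 has to be avoided. This pays for two large
    -- primes besides 25.
    case-C : ∀ q q′ → Prime q → 11 ≤ q → Prime q′ → 13 ≤ q′ → ∃ (Admissible n 12 c 11 (q ∷ q′ ∷ 25 ∷ 49 ∷ []))
    case-C q q′ pq 11≤q pq′ 13≤q′ = admissible₁₂ 11 ≤-refl (kill12-≥11 q pq 11≤q ∷ kill12-≥13 q′ pq′ 13≤q′ ∷ kill12-25 ∷ kill12-49 ∷ []) 16541993 tail-12 95 4 3 margin-C α≤-12 σ≤-12 (≤ᵇ⇒≤ 22 30 _) (≤ᵇ⇒≤ 140 180 _)
               (error< 12 (≤ᵇ⇒≤ 12 60 _) 95 (≤ᵇ⇒≤ 948 950 _))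

  module _ (c : ℕ) (c<60 : c < 60) (c-unit : Coprime c 60) where

    admissible₆₀ = Assembly.admissible n L s 1≤n n<2^L n<[1+s]² s≤n 60 c c<60 c-unit (≤ᵇ⇒≤ 61 64 _) (≤ᵇ⇒≤ 12 60 _)
      (N 60 ≤-refl) (2≤N 60 ≤-refl) (NM<n 60 ≤-refl)
      (map proj₁ pairs60) R60.cofactors-units (R60.check c c<60 c-unit)
      ps60 ((prime[2] , ≤ᵇ⇒≤ 2 5 _) ∷ (prime[3] , ≤ᵇ⇒≤ 3 5 _) ∷ (prime[5] , ≤-refl) ∷ []) radical-60 smooth-60
      5907 5906 60≼ 60≽ ρf τf σf ((prime[2] , bounds-2) ∷ (prime[3] , bounds-3) ∷ (prime[5] , bounds-5) ∷ []) ρ-small-60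

    -- Modulo 60 the class already excludes 5 and 25, and if the other prime is less than 11,
    -- avoiding 7 is all that remains besides the squares from 11 on.
    case-D : ∃ (Admissible n 60 c 11 (7 ∷ []))
    case-D = admissible₆₀ 11 ≤-refl (kill60-≥7 7 prime[7] ≤-refl ∷ []) 17959473 tail-60 505 6 5 margin-D α≤-60 σ≤-60 (≤ᵇ⇒≤ 26 30 _) (≤ᵇ⇒≤ 143 180 _)
               (error< 60 ≤-refl 505 (≤ᵇ⇒≤ 4740 5050 _))

    case-E : ∀ q → Prime q → 11 ≤ q → ∃ (Admissible n 60 c 11 (q ∷ 49 ∷ []))
    case-E q pq 11≤q = admissible₆₀ 11 ≤-refl (kill60-≥11 q pq 11≤q ∷ kill60-49 ∷ []) 17959473 tail-60 505 6 5 margin-E α≤-60 σ≤-60 (≤ᵇ⇒≤ 29 30 _) (≤ᵇ⇒≤ 170 180 _)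
               (error< 60 ≤-refl 505 (≤ᵇ⇒≤ 4740 5050 _))

-- p + (n ∸ p) is a representation of n that works for every k all of whose prime factors are a or b.
Represents : ℕ → ℕ → ℕ → ℕ → Set
Represents n a b p = p < n × Prime p × (∀ r → Prime r → ¬ (r * r ∣ n ∸ p)) ×
                     (∀ r → Prime r → r ≡ a ⊎ r ≡ b → (r ≡ 2 → 2 ∣ n) → ¬ (r ∣ n ∸ p))

-- The unit group modulo 60 has exponent 4, so c⁴ ≡ 1 expresses that c is a unit and exhibits c³ as
-- its inverse.
residueOk : ℕ → ℕ → Bool
residueOk v c = ((c * (c * c * c)) % 60 ≡ᵇ 1) ∧ not (c % 3 ≡ᵇ v % 3) ∧ not (c % 4 ≡ᵇ v % 4) ∧ not (c % 5 ≡ᵇ v % 5)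

residueFor : ℕ → ℕ → ℕ
residueFor zero v = 0
residueFor (suc c) v = if residueOk v c then c else residueFor c v

residueFor-check : allBelow 60 (λ v → (residueFor 60 v <ᵇ 60) ∧ residueOk v (residueFor 60 v)) ≡ true
residueFor-check = refl

∧-elim : ∀ {a b} → a ∧ b ≡ true → a ≡ true × b ≡ true
∧-elim {true} eq = refl , eq

not-≡ᵇ : ∀ {a b} → not (a ≡ᵇ b) ≡ true → a ≢ b
not-≡ᵇ {a} {b} eq refl with a ≡ᵇ a | ≡⇒≡ᵇ a a refl
not-≡ᵇ {a} {b} () refl | true | _

record Residue (n : ℕ) : Set where
  field
    c : ℕ
    c<60 : c < 60
    inv : (c * (c * c * c)) % 60 ≡ 1
    c≢n-3 : c % 3 ≢ n % 3
    c≢n-4 : c % 4 ≢ n % 4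
    c≢n-5 : c % 5 ≢ n % 5

opaque
  residueOf : ∀ n → Residue n
  residueOf n with ∧-elim {residueFor 60 (n % 60) <ᵇ 60} (allBelow-sound 60 (λ v → (residueFor 60 v <ᵇ 60) ∧ residueOk v (residueFor 60 v)) residueFor-check (n % 60) (m%n<n n 60))
  ... | lt , ok with ∧-elim ok
  ...   | ok₁ , ok′ with ∧-elim ok′
  ...     | ok₃ , ok″ with ∧-elim ok″
  ...       | ok₄ , ok₅ = record
    { c = c
    ; c<60 = <ᵇ⇒< c 60 (subst T (sym lt) _)
    ; inv = ≡ᵇ⇒≡ _ 1 (subst T (sym ok₁) _)
    ; c≢n-3 = λ eq → not-≡ᵇ ok₃ (trans eq (sym (m∣n⇒o%n%m≡o%m 3 60 n (divides 20 refl))))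
    ; c≢n-4 = λ eq → not-≡ᵇ ok₄ (trans eq (sym (m∣n⇒o%n%m≡o%m 4 60 n (divides 15 refl))))
    ; c≢n-5 = λ eq → not-≡ᵇ ok₅ (trans eq (sym (m∣n⇒o%n%m≡o%m 5 60 n (divides 12 refl))))
    }
    where
    c : ℕ
    c = residueFor 60 (n % 60)

∤-∸ : ∀ {p n} d .{{_ : NonZero d}} → p ≤ n → p % d ≢ n % d → ¬ (d ∣ n ∸ p)
∤-∸ d p≤n ≢ d∣ = ≢ (∣∸⇒%≡ d p≤n d∣)

prime-<13 : ∀ {p} → Prime p → p < 13 → p ≡ 2 ⊎ p ≡ 3 ⊎ p ≡ 5 ⊎ p ≡ 7 ⊎ p ≡ 11
prime-<13 {0} pp _ = contradiction pp (from-no (prime? 0))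
prime-<13 {1} pp _ = contradiction pp (from-no (prime? 1))
prime-<13 {2} pp _ = inj₁ refl
prime-<13 {3} pp _ = inj₂ (inj₁ refl)
prime-<13 {4} pp _ = contradiction pp (from-no (prime? 4))
prime-<13 {5} pp _ = inj₂ (inj₂ (inj₁ refl))
prime-<13 {6} pp _ = contradiction pp (from-no (prime? 6))
prime-<13 {7} pp _ = inj₂ (inj₂ (inj₂ (inj₁ refl)))
prime-<13 {8} pp _ = contradiction pp (from-no (prime? 8))
prime-<13 {9} pp _ = contradiction pp (from-no (prime? 9))
prime-<13 {10} pp _ = contradiction pp (from-no (prime? 10))
prime-<13 {11} pp _ = inj₂ (inj₂ (inj₂ (inj₂ refl)))
prime-<13 {12} pp _ = contradiction pp (from-no (prime? 12))
prime-<13 {suc (suc (suc (suc (suc (suc (suc (suc (suc (suc (suc (suc (suc p))))))))))))} pp lt = contradiction lt (≤⇒≯ (m≤m+n 13 p))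

data PrimeSize (p : ℕ) : Set where
  is-2 : p ≡ 2 → PrimeSize p
  is-3 : p ≡ 3 → PrimeSize p
  is-5 : p ≡ 5 → PrimeSize p
  is-7 : p ≡ 7 → PrimeSize p
  is-11 : p ≡ 11 → PrimeSize p
  large : 13 ≤ p → PrimeSize p

primeSize : ∀ {p} → Prime p → PrimeSize p
primeSize {p} pp with 13 ≤? p
... | yes 13≤p = large 13≤p
... | no 13≰p with prime-<13 pp (≰⇒> 13≰p)
...   | inj₁ eq = is-2 eq
...   | inj₂ (inj₁ eq) = is-3 eq
...   | inj₂ (inj₂ (inj₁ eq)) = is-5 eq
...   | inj₂ (inj₂ (inj₂ (inj₁ eq))) = is-7 eq
...   | inj₂ (inj₂ (inj₂ (inj₂ eq))) = is-11 eq

5<p⇒7≤p : ∀ {p} → Prime p → 5 ≤ p → p ≢ 5 → 7 ≤ p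
5<p⇒7≤p pp 5≤p p≢5 with primeSize pp
... | is-2 refl = contradiction 5≤p (<⇒≱ (≤ᵇ⇒≤ 3 5 _))
... | is-3 refl = contradiction 5≤p (<⇒≱ (≤ᵇ⇒≤ 4 5 _))
... | is-5 refl = contradiction refl p≢5
... | is-7 refl = ≤-refl
... | is-11 refl = ≤ᵇ⇒≤ 7 11 _
... | large 13≤p = ≤-trans (≤ᵇ⇒≤ 7 13 _) 13≤p

7≤p<11 : ∀ {p} → Prime p → 7 ≤ p → p < 11 → p ≡ 7
7≤p<11 pp 7≤p p<11 with primeSize pp
... | is-2 refl = contradiction 7≤p (<⇒≱ (≤ᵇ⇒≤ 3 7 _))
... | is-3 refl = contradiction 7≤p (<⇒≱ (≤ᵇ⇒≤ 4 7 _))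
... | is-5 refl = contradiction 7≤p (<⇒≱ (≤ᵇ⇒≤ 6 7 _))
... | is-7 eq = eq
... | is-11 refl = contradiction p<11 (≤⇒≯ ≤-refl)
... | large 13≤p = contradiction p<11 (≤⇒≯ (≤-trans (≤ᵇ⇒≤ 11 13 _) 13≤p))

module LargeRange (n : ℕ) (2^22≤n : 2 ^ 22 ≤ n) where
  open Large n 2^22≤n
  open Residue (residueOf n)

  c₁₂ : ℕ
  c₁₂ = c % 12

  c-unit : Coprime c 60
  c-unit = R60.≡1⇒unit {c} {c * c * c} inv

  c₁₂-unit : Coprime c₁₂ 12
  c₁₂-unit = R12.≡1⇒unit {c₁₂} {c * c * c} (trans (%-*-congˡ 12 {c₁₂} {c} (c * c * c) (m%n%n≡m%n c 12))
    (trans (sym (m∣n⇒o%n%m≡o%m 12 60 (c * (c * c * c)) (divides 5 refl))) (cong (_% 12) inv)))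

  module _ {p : ℕ} (p<n : p < n) (p≡c : p % 12 ≡ c₁₂) where

    η : ℕ
    η = n ∸ p

    p%d : ∀ d .{{_ : NonZero d}} → d ∣ 12 → p % d ≡ c % d
    p%d d d∣12 = trans (sym (m∣n⇒o%n%m≡o%m d 12 p d∣12)) (trans (cong (_% d) p≡c) (m∣n⇒o%n%m≡o%m d 12 c d∣12))

    3∤η : ¬ (3 ∣ η)
    3∤η = ∤-∸ 3 (<⇒≤ p<n) (c≢n-3 ∘ trans (sym (p%d 3 (divides 4 refl))))

    4∤η : ¬ (4 ∣ η)
    4∤η = ∤-∸ 4 (<⇒≤ p<n) (c≢n-4 ∘ trans (sym (p%d 4 (divides 3 refl))))

    2∤p : ¬ (2 ∣ p)
    2∤p 2∣p = contradiction (c₁₂-unit (subst (2 ∣_) p≡c (%-presˡ-∣ 2∣p (divides 6 refl)) , divides 6 refl)) λ ()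

    2∤η : 2 ∣ n → ¬ (2 ∣ η)
    2∤η 2∣n 2∣η = 2∤p (∣m+n∣m⇒∣n (subst (2 ∣_) (sym (m∸n+n≡m (<⇒≤ p<n))) 2∣n) 2∣η)

    represents : ∀ {a b} → Prime p → ¬ (25 ∣ η) → (∀ r → Prime r → 7 ≤ r → ¬ (r * r ∣ η)) →
                 (∀ r → Prime r → 5 ≤ r → r ≡ a ⊎ r ≡ b → ¬ (r ∣ η)) → Represents n a b p
    represents {a} {b} pp 25∤η r²∤η r∤η = p<n , pp , squares , divisors
      where
      squares : ∀ r → Prime r → ¬ (r * r ∣ η)
      squares r pr with primeSize pr
      ... | is-2 refl = 4∤η
      ... | is-3 refl = 3∤η ∘ ∣-trans (m∣m*n 3)
      ... | is-5 refl = 25∤η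
      ... | is-7 refl = r²∤η 7 pr ≤-refl
      ... | is-11 refl = r²∤η 11 pr (≤ᵇ⇒≤ 7 11 _)
      ... | large 13≤r = r²∤η r pr (≤-trans (≤ᵇ⇒≤ 7 13 _) 13≤r)
      divisors : ∀ r → Prime r → r ≡ a ⊎ r ≡ b → (r ≡ 2 → 2 ∣ n) → ¬ (r ∣ η)
      divisors r pr r∈ even with primeSize pr
      ... | is-2 refl = 2∤η (even refl)
      ... | is-3 refl = 3∤η
      ... | is-5 refl = r∤η 5 pr ≤-refl r∈
      ... | is-7 refl = r∤η 7 pr (≤ᵇ⇒≤ 5 7 _) r∈
      ... | is-11 refl = r∤η 11 pr (≤ᵇ⇒≤ 5 11 _) r∈
      ... | large 13≤r = r∤η r pr (≤-trans (≤ᵇ⇒≤ 5 13 _) 13≤r) r∈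

  squares≥7 : ∀ p → (∀ r → Prime r → 11 ≤ r → ¬ (r * r ∣ n ∸ p)) → ¬ (49 ∣ n ∸ p) → ∀ r → Prime r → 7 ≤ r → ¬ (r * r ∣ n ∸ p)
  squares≥7 p r²∤ 49∤ r pr 7≤r = by-size (11 ≤? r)
    where
    by-size : Dec (11 ≤ r) → ¬ (r * r ∣ n ∸ p)
    by-size (yes 11≤r) = r²∤ r pr 11≤r
    by-size (no 11≰r) = 49∤ ∘ subst (λ r → r * r ∣ n ∸ p) (7≤p<11 pr 7≤r (≰⇒> 11≰r))

  represented-12 : ∀ {a b} → a ≤ b → Prime a → Prime b → a ≢ 5 → b ≢ 5 → ∃ (Represents n a b)
  represented-12 {a} {b} a≤b pa pb a≢5 b≢5 = by-size (b <? 13) (a <? 11)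
    where
    from-A : ∃ (Admissible n 12 c₁₂ 13 (7 ∷ 11 ∷ 25 ∷ [])) → b < 13 → ∃ (Represents n a b)
    from-A (p , p<n , pp , p≡c , (7∤ ∷ 11∤ ∷ 25∤ ∷ []) , r²∤) b<13 = p , represents p<n p≡c pp 25∤ squares divisors
      where
      squares : ∀ r → Prime r → 7 ≤ r → ¬ (r * r ∣ n ∸ p)
      squares r pr 7≤r d with primeSize pr
      ... | is-2 refl = contradiction 7≤r (<⇒≱ (≤ᵇ⇒≤ 3 7 _))
      ... | is-3 refl = contradiction 7≤r (<⇒≱ (≤ᵇ⇒≤ 4 7 _))
      ... | is-5 refl = contradiction 7≤r (<⇒≱ (≤ᵇ⇒≤ 6 7 _))
      ... | is-7 refl = 7∤ (∣-trans (m∣m*n 7) d)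
      ... | is-11 refl = 11∤ (∣-trans (m∣m*n 11) d)
      ... | large 13≤r = r²∤ r pr 13≤r d
      divisors : ∀ r → Prime r → 5 ≤ r → r ≡ a ⊎ r ≡ b → ¬ (r ∣ n ∸ p)
      divisors r pr 5≤r r∈ with primeSize pr | r∈
      ... | is-2 refl | _ = contradiction 5≤r (<⇒≱ (≤ᵇ⇒≤ 3 5 _))
      ... | is-3 refl | _ = contradiction 5≤r (<⇒≱ (≤ᵇ⇒≤ 4 5 _))
      ... | is-5 refl | inj₁ eq = contradiction (sym eq) a≢5
      ... | is-5 refl | inj₂ eq = contradiction (sym eq) b≢5
      ... | is-7 refl | _ = 7∤
      ... | is-11 refl | _ = 11∤
      ... | large 13≤r | inj₁ refl = contradiction 13≤r (<⇒≱ (≤-<-trans a≤b b<13))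
      ... | large 13≤r | inj₂ refl = contradiction 13≤r (<⇒≱ b<13)
    from-B : ∃ (Admissible n 12 c₁₂ 11 (7 ∷ b ∷ 25 ∷ [])) → a < 11 → ∃ (Represents n a b)
    from-B (p , p<n , pp , p≡c , (7∤ ∷ b∤ ∷ 25∤ ∷ []) , r²∤) a<11 = p , represents p<n p≡c pp 25∤ (squares≥7 p r²∤ (7∤ ∘ ∣-trans (m∣m*n 7))) divisors
      where
      divisors : ∀ r → Prime r → 5 ≤ r → r ≡ a ⊎ r ≡ b → ¬ (r ∣ n ∸ p)
      divisors r pr 5≤r (inj₂ refl) = b∤
      divisors r pr 5≤r (inj₁ refl) = 7∤ ∘ subst (_∣ n ∸ p) (7≤p<11 pr (5<p⇒7≤p pr 5≤r a≢5) a<11)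
    from-C : ∃ (Admissible n 12 c₁₂ 11 (a ∷ b ∷ 25 ∷ 49 ∷ [])) → ∃ (Represents n a b)
    from-C (p , p<n , pp , p≡c , (a∤ ∷ b∤ ∷ 25∤ ∷ 49∤ ∷ []) , r²∤) = p , represents p<n p≡c pp 25∤ (squares≥7 p r²∤ 49∤) divisors
      where
      divisors : ∀ r → Prime r → 5 ≤ r → r ≡ a ⊎ r ≡ b → ¬ (r ∣ n ∸ p)
      divisors r pr 5≤r (inj₁ refl) = a∤
      divisors r pr 5≤r (inj₂ refl) = b∤
    by-size : Dec (b < 13) → Dec (a < 11) → ∃ (Represents n a b)
    by-size (yes b<13) _ = from-A (case-A c₁₂ (m%n<n c 12) c₁₂-unit) b<13
    by-size (no b≮13) (yes a<11) = from-B (case-B c₁₂ (m%n<n c 12) c₁₂-unit b pb (≮⇒≥ b≮13)) a<11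
    by-size (no b≮13) (no a≮11) = from-C (case-C c₁₂ (m%n<n c 12) c₁₂-unit a b pa (≮⇒≥ a≮11) pb (≮⇒≥ b≮13))

  -- The order of `a` and `b` is immaterial here: one of them is 5, which the class takes care of,
  -- and only the other one, `q`, decides the case.
  represented-60 : ∀ {a b q} → Prime q → (∀ r → r ≡ a ⊎ r ≡ b → r ≡ 5 ⊎ r ≡ q) → ∃ (Represents n a b)
  represented-60 {a} {b} {q} pq ab⊆ = by-size (q <? 11)
    where
    mod-12 : ∀ {p} → p % 60 ≡ c → p % 12 ≡ c₁₂
    mod-12 {p} p≡c = trans (sym (m∣n⇒o%n%m≡o%m 12 60 p (divides 5 refl))) (cong (_% 12) p≡c)
    5∤ : ∀ {p} → p < n → p % 60 ≡ c → ¬ (5 ∣ n ∸ p)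
    5∤ {p} p<n p≡c = ∤-∸ 5 (<⇒≤ p<n) (c≢n-5 ∘ trans (trans (cong (_% 5) (sym p≡c)) (m∣n⇒o%n%m≡o%m 5 60 p (divides 12 refl))))
    from-D : ∃ (Admissible n 60 c 11 (7 ∷ [])) → q < 11 → ∃ (Represents n a b)
    from-D (p , p<n , pp , p≡c , (7∤ ∷ []) , r²∤) q<11 = p , represents p<n (mod-12 {p} p≡c) pp (5∤ p<n p≡c ∘ ∣-trans (m∣m*n 5)) (squares≥7 p r²∤ (7∤ ∘ ∣-trans (m∣m*n 7))) divisors
      where
      divisors : ∀ r → Prime r → 5 ≤ r → r ≡ a ⊎ r ≡ b → ¬ (r ∣ n ∸ p)
      divisors r pr 5≤r r∈ with ab⊆ r r∈ | r ≟ 5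
      ... | _ | yes refl = 5∤ p<n p≡c
      ... | inj₁ refl | no r≢5 = contradiction refl r≢5
      ... | inj₂ refl | no r≢5 = 7∤ ∘ subst (_∣ n ∸ p) (7≤p<11 pr (5<p⇒7≤p pr 5≤r r≢5) q<11)
    from-E : ∃ (Admissible n 60 c 11 (q ∷ 49 ∷ [])) → ∃ (Represents n a b)
    from-E (p , p<n , pp , p≡c , (q∤ ∷ 49∤ ∷ []) , r²∤) = p , represents p<n (mod-12 {p} p≡c) pp (5∤ p<n p≡c ∘ ∣-trans (m∣m*n 5)) (squares≥7 p r²∤ 49∤) divisors
      where
      divisors : ∀ r → Prime r → 5 ≤ r → r ≡ a ⊎ r ≡ b → ¬ (r ∣ n ∸ p)
      divisors r pr 5≤r r∈ with ab⊆ r r∈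
      ... | inj₁ refl = 5∤ p<n p≡c
      ... | inj₂ refl = q∤
    by-size : Dec (q < 11) → ∃ (Represents n a b)
    by-size (yes q<11) = from-D (case-D c c<60 c-unit) q<11
    by-size (no q≮11) = from-E (case-E c c<60 c-unit q pq (≮⇒≥ q≮11))

  represented-≤ : ∀ {a b} → a ≤ b → Prime a → Prime b → ∃ (Represents n a b)
  represented-≤ {a} {b} a≤b pa pb = by-5 (a ≟ 5) (b ≟ 5)
    where
    by-5 : Dec (a ≡ 5) → Dec (b ≡ 5) → ∃ (Represents n a b)
    by-5 (yes refl) _ = represented-60 pb λ _ r∈ → r∈
    by-5 (no _) (yes refl) = represented-60 pa λ _ → swap
    by-5 (no a≢5) (no b≢5) = represented-12 a≤b pa pb a≢5 b≢5

  represented : ∀ a b → Prime a → Prime b → ∃ (Represents n a b)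
  represented a b pa pb with ≤-total a b
  ... | inj₁ a≤b = represented-≤ a≤b pa pb
  ... | inj₂ b≤a with represented-≤ b≤a pb pa
  ...   | p , p<n , pp , sq , dv = p , p<n , pp , sq , λ r pr → dv r pr ∘ swap

-- The range n < 2 ^ 22

module _ {K : ℕ → Set} (K? : ∀ p → Dec (K p)) where

  ¬K? : ∀ p → Dec (¬ K p)
  ¬K? p = ¬? (K? p)

  -- Pairwise exclusion leaves room for one element with `K` at most; once it has been met, the
  -- filter keeps the whole remainder of the list.
  length-filter-¬ : ∀ ps → AllPairs (λ p q → ¬ (K p × K q)) ps → length ps ≤ suc (length (filter ¬K? ps))
  length-filter-¬ [] [] = z≤n
  length-filter-¬ (p ∷ ps) (p-excl ∷ excl) = by-K (K? p)
    where
    by-K : Dec (K p) → suc (length ps) ≤ suc (length (filter ¬K? (p ∷ ps)))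
    by-K (yes k) = s≤s (≤-reflexive (cong length (sym (trans (filter-reject ¬K? (λ ¬k → ¬k k)) (filter-all ¬K? (All.map (λ ¬both k′ → ¬both (k , k′)) p-excl))))))
    by-K (no ¬k) = s≤s (subst (length ps ≤_) (cong length (sym (filter-accept ¬K? {p} {ps} ¬k))) (length-filter-¬ ps excl))

record Candidate (n p : ℕ) : Set where
  constructor candidate
  field
    p<n : p < n
    p-prime : Prime p
    p-odd : ¬ (2 ∣ p)

SquareFreeη : ℕ → ℕ → Set
SquareFreeη n p = ∀ r → Prime r → ¬ (r * r ∣ n ∸ p)

-- The prime 2 is exempt because for even n an odd p already makes n - p odd.
Separated : ℕ → ℕ → ℕ → Set
Separated n p q = ∀ r → Prime r → r ≢ 2 → ¬ (r ∣ n ∸ p × r ∣ n ∸ q)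

∃-head : ∀ (ps : List ℕ) → 1 ≤ length ps → ∃[ p ] p ∈ ps
∃-head (p ∷ ps) _ = p , here refl

-- Each of a and b divides n ∸ p for at most one of the separated candidates p.
three-candidates : ∀ n a b → Prime a → Prime b → ∀ ps → (∀ {p} → p ∈ ps → Candidate n p × SquareFreeη n p) → AllPairs (Separated n) ps → 3 ≤ length ps →
                   ∃ (Represents n a b)
three-candidates n a b pa pb ps good sep 3≤ = from-survivor (∃-head qs (≤-pred (≤-pred (≤-trans 3≤ (≤-trans (length-filter-¬ (bad? a) ps (AllPairs.map (λ {p} {q} → exclusive pa p q) sep))
    (s≤s (length-filter-¬ (bad? b) as (AllPairs.filter⁺ (¬K? (bad? a)) (AllPairs.map (λ {p} {q} → exclusive pb p q) sep)))))))))
  where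
  Bad : ℕ → ℕ → Set
  Bad r p = r ≢ 2 × r ∣ n ∸ p
  bad? : ∀ r p → Dec (Bad r p)
  bad? r p = ¬? (r ≟ 2) ×-dec (r ∣? n ∸ p)
  exclusive : ∀ {r} → Prime r → ∀ p q → Separated n p q → ¬ (Bad r p × Bad r q)
  exclusive {r} pr p q s ((r≢2 , d) , (_ , e)) = s r pr r≢2 (d , e)
  as qs : List ℕ
  as = filter (¬K? (bad? a)) ps
  qs = filter (¬K? (bad? b)) as
  from-survivor : (∃[ p ] p ∈ qs) → ∃ (Represents n a b)
  from-survivor (p , p∈qs) with ∈-filter⁻ (¬K? (bad? b)) {xs = as} p∈qs
  ... | p∈as , ¬bad-b with ∈-filter⁻ (¬K? (bad? a)) {xs = ps} p∈as
  ...   | p∈ps , ¬bad-a with good p∈ps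
  ...     | candidate p<n pp odd , sqf = p , p<n , pp , sqf , divisors
    where
    2∤η : 2 ∣ n → ¬ (2 ∣ n ∸ p)
    2∤η 2∣n 2∣η = odd (∣m+n∣m⇒∣n (subst (2 ∣_) (sym (m∸n+n≡m (<⇒≤ p<n))) 2∣n) 2∣η)
    divisors : ∀ r → Prime r → r ≡ a ⊎ r ≡ b → (r ≡ 2 → 2 ∣ n) → ¬ (r ∣ n ∸ p)
    divisors r pr r∈ even with r ≟ 2 | r∈
    ... | yes refl | _ = 2∤η (even refl)
    ... | no r≢2 | inj₁ refl = λ d → ¬bad-a (r≢2 , d)
    ... | no r≢2 | inj₂ refl = λ d → ¬bad-b (r≢2 , d)

-- 20736 = 2⁸ 3⁴, so the divisors have no prime factors other than 2 and 3.
smooth : ℕ → Bool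
smooth zero = false
smooth (suc d) = 20736 % suc d ≡ᵇ 0

smooth-prime : ∀ {r d} → Prime r → smooth d ≡ true → r ∣ d → r ≡ 2 ⊎ r ≡ 3
smooth-prime {r} {suc d} pr sm r∣d = by-144 (euclidsLemma 144 144 pr (∣-trans r∣d (m%n≡0⇒n∣m 20736 (suc d) (≡ᵇ⇒≡ _ 0 (subst T (sym sm) _)))))
  where
  by-12 : r ∣ 12 ⊎ r ∣ 12 → r ≡ 2 ⊎ r ≡ 3
  by-12 d12 with prime∣60 r pr (∣-trans ([_,_]′ (λ d → d) (λ d → d) d12) (divides 5 refl))
  ... | inj₁ eq = inj₁ eq
  ... | inj₂ (inj₁ eq) = inj₂ eq
  ... | inj₂ (inj₂ refl) = ⊥-elim (from-no (5 ∣? 12) ([_,_]′ (λ d → d) (λ d → d) d12))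
  by-144 : r ∣ 144 ⊎ r ∣ 144 → r ≡ 2 ⊎ r ≡ 3
  by-144 (inj₁ d) = by-12 (euclidsLemma 12 12 pr d)
  by-144 (inj₂ d) = by-12 (euclidsLemma 12 12 pr d)

-- A common prime divisor of n - p and n - q divides q - p, so it is 2 or 3.
smooth-separated : ∀ {n p q} → p < q → q < n → smooth (q ∸ p) ≡ true → ¬ (3 ∣ n ∸ p × 3 ∣ n ∸ q) → Separated n p q
smooth-separated {n} {p} {q} p<q q<n sm ¬3 r pr r≢2 (r∣ηp , r∣ηq) with smooth-prime pr sm r∣q-p
  where
  r∣q-p : r ∣ q ∸ p
  r∣q-p = ∣m+n∣m⇒∣n (subst (r ∣_) (begin
    n ∸ p                ≡⟨ cong (_∸ p) (m∸n+n≡m (<⇒≤ q<n)) ⟨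
    n ∸ q + q ∸ p        ≡⟨ +-∸-assoc (n ∸ q) (<⇒≤ p<q) ⟩
    n ∸ q + (q ∸ p)      ∎) r∣ηp) r∣ηq
    where open ≡-Reasoning
... | inj₁ r≡2 = r≢2 r≡2
... | inj₂ refl = ¬3 (r∣ηp , r∣ηq)

module _ (sep : ℕ → ℕ → Bool) where

  thirdOf : ℕ → ℕ → List ℕ → Bool
  thirdOf p q [] = false
  thirdOf p q (r ∷ rs) = (sep p r ∧ sep q r) ∨ thirdOf p q rs

  secondOf : ℕ → List ℕ → Bool
  secondOf p [] = false
  secondOf p (q ∷ qs) = (sep p q ∧ thirdOf p q qs) ∨ secondOf p qs

  tripleOf : List ℕ → Bool
  tripleOf [] = false
  tripleOf (p ∷ ps) = secondOf p ps ∨ tripleOf ps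

  thirdOf-sound : ∀ p q rs → thirdOf p q rs ≡ true → ∃[ r ] r ∈ rs × sep p r ≡ true × sep q r ≡ true
  thirdOf-sound p q (r ∷ rs) eq with ∨-elim {sep p r ∧ sep q r} eq
  ... | inj₁ both = r , here refl , ∧-elim both
  ... | inj₂ later with thirdOf-sound p q rs later
  ...   | r′ , r′∈ , ss = r′ , there r′∈ , ss

  secondOf-sound : ∀ p qs → secondOf p qs ≡ true → ∃[ q ] ∃[ r ] q ∈ qs × r ∈ qs × sep p q ≡ true × sep p r ≡ true × sep q r ≡ true
  secondOf-sound p (q ∷ qs) eq with ∨-elim {sep p q ∧ thirdOf p q qs} eq
  ... | inj₂ later with secondOf-sound p qs later
  ...   | q′ , r , q′∈ , r∈ , ss = q′ , r , there q′∈ , there r∈ , ss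
  secondOf-sound p (q ∷ qs) eq | inj₁ both with ∧-elim {sep p q} both
  ...   | pq , third with thirdOf-sound p q qs third
  ...     | r , r∈ , pr , qr = q , r , here refl , there r∈ , pq , pr , qr

  tripleOf-sound : ∀ ps → tripleOf ps ≡ true → ∃[ p ] ∃[ q ] ∃[ r ] (p ∈ ps × q ∈ ps × r ∈ ps) × sep p q ≡ true × sep p r ≡ true × sep q r ≡ true
  tripleOf-sound (p ∷ ps) eq with ∨-elim {secondOf p ps} eq
  ... | inj₁ second with secondOf-sound p ps second
  ...   | q , r , q∈ , r∈ , ss = p , q , r , (here refl , there q∈ , there r∈) , ss
  tripleOf-sound (p ∷ ps) eq | inj₂ later with tripleOf-sound ps later
  ...   | p′ , q , r , (p∈ , q∈ , r∈) , ss = p′ , q , r , (there p∈ , there q∈ , there r∈) , ss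

-- The sieve by squares

filterᵇ-sound : ∀ (f : ℕ → Bool) xs {x} → x ∈ filterᵇ f xs → x ∈ xs × f x ≡ true
filterᵇ-sound f (y ∷ ys) x∈ with f y in eq
filterᵇ-sound f (y ∷ ys) (here refl) | true = here refl , eq
filterᵇ-sound f (y ∷ ys) (there x∈) | true with filterᵇ-sound f ys x∈
... | x∈ys , fx = there x∈ys , fx
filterᵇ-sound f (y ∷ ys) x∈ | false with filterᵇ-sound f ys x∈
... | x∈ys , fx = there x∈ys , fx

filterᵇ-complete : ∀ (f : ℕ → Bool) xs {x} → x ∈ xs → f x ≡ true → x ∈ filterᵇ f xs
filterᵇ-complete f (y ∷ ys) (here refl) fx rewrite fx = here refl
filterᵇ-complete f (y ∷ ys) (there x∈) fx with f y
... | true = there (filterᵇ-complete f ys x∈ fx)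
... | false = filterᵇ-complete f ys x∈ fx

-- Merges descending lists. Only membership is proved of it; that the result is in descending order
-- is verified on the actual lists by `scan`.
merge : List ℕ → List ℕ → List ℕ
merge [] ys = ys
merge (x ∷ xs) [] = x ∷ xs
merge (x ∷ xs) (y ∷ ys) = if y <ᵇ x then x ∷ merge xs (y ∷ ys) else y ∷ merge (x ∷ xs) ys

∈-mergeʳ : ∀ xs ys {z} → z ∈ ys → z ∈ merge xs ys
∈-mergeʳ [] ys z∈ = z∈
∈-mergeʳ (x ∷ xs) (y ∷ ys) z∈ with y <ᵇ x
∈-mergeʳ (x ∷ xs) (y ∷ ys) z∈ | true = there (∈-mergeʳ xs (y ∷ ys) z∈)
∈-mergeʳ (x ∷ xs) (y ∷ ys) (here refl) | false = here refl
∈-mergeʳ (x ∷ xs) (y ∷ ys) (there z∈) | false = there (∈-mergeʳ (x ∷ xs) ys z∈)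

∈-mergeˡ : ∀ xs ys {z} → z ∈ xs → z ∈ merge xs ys
∈-mergeˡ (x ∷ xs) [] z∈ = z∈
∈-mergeˡ (x ∷ xs) (y ∷ ys) z∈ with y <ᵇ x
∈-mergeˡ (x ∷ xs) (y ∷ ys) (here refl) | true = here refl
∈-mergeˡ (x ∷ xs) (y ∷ ys) (there z∈) | true = there (∈-mergeˡ xs (y ∷ ys) z∈)
∈-mergeˡ (x ∷ xs) (y ∷ ys) z∈ | false = there (∈-mergeˡ (x ∷ xs) ys z∈)

-- 2 ^ 22
limit : ℕ
limit = 4194304

-- As r² ≡ 1 mod 12, these are the multiples of r² in the class γ.
multiples : ℕ → ℕ → ℕ → List ℕ
multiples r² γ zero = []
multiples r² γ (suc i) = r² * (γ + 12 * i) ∷ multiples r² γ i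

∈-multiples : ∀ r² γ k i → i < k → r² * (γ + 12 * i) ∈ multiples r² γ k
∈-multiples r² γ (suc k) i i<1+k with m≤n⇒m<n∨m≡n (≤-pred i<1+k)
... | inj₁ i<k = there (∈-multiples r² γ k i i<k)
... | inj₂ refl = here refl

upwards : ℕ → ℕ → List ℕ
upwards r zero = []
upwards r (suc k) = r ∷ upwards (suc r) k

∈-upwards : ∀ a k r → a ≤ r → r < a + k → r ∈ upwards a k
∈-upwards a zero r a≤r r< = contradiction a≤r (<⇒≱ (subst (r <_) (+-identityʳ a) r<))
∈-upwards a (suc k) r a≤r r< with m≤n⇒m<n∨m≡n a≤r
... | inj₁ a<r = there (∈-upwards (suc a) k r a<r (subst (r <_) (+-suc a k) r<))
... | inj₂ refl = here refl

sieveTest : ℕ → (f : ℕ) .{{_ : NonZero f}} → Bool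
sieveTest r f = (r ≡ᵇ f) ∨ not (r % f ≡ᵇ 0)

-- Composite numbers passing the test do no harm, since only completeness of nonSquareFree matters.
isSieved : ℕ → Bool
isSieved r = sieveTest r 2 ∧ sieveTest r 3 ∧ sieveTest r 5 ∧ sieveTest r 7 ∧ sieveTest r 11 ∧ sieveTest r 13

sievedFrom5 : List ℕ
sievedFrom5 = filterᵇ isSieved (upwards 5 2043)

prime[13] : Prime 13
prime[13] = from-yes (prime? 13)

sieveTest-prime : ∀ {r f} .{{_ : NonZero f}} → Prime r → Prime f → sieveTest r f ≡ true
sieveTest-prime {r} {f} pr pf with r ≡ᵇ f in eq | r % f in eq₀
... | true | _ = refl
... | false | suc _ = refl
... | false | zero = contradiction (subst T eq (≡⇒≡ᵇ r f (sym (prime-∣ pf pr (m%n≡0⇒n∣m r f eq₀))))) λ ()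

isSieved-prime : ∀ {r} → Prime r → isSieved r ≡ true
isSieved-prime pr = cong₂ _∧_ (sieveTest-prime pr prime[2]) (cong₂ _∧_ (sieveTest-prime pr prime[3]) (cong₂ _∧_ (sieveTest-prime pr prime[5])
  (cong₂ _∧_ (sieveTest-prime pr prime[7]) (cong₂ _∧_ (sieveTest-prime pr prime[11]) (sieveTest-prime pr prime[13])))))

multiplesOf : ℕ → ℕ → List ℕ
multiplesOf γ r = multiples (r * r) γ (suc (limit ÷ (12 * (r * r))))

nonSquareFree : List ℕ → ℕ → List ℕ
nonSquareFree rs γ = foldr (λ r → merge (multiplesOf γ r)) [] rs

∈-nonSquareFree : ∀ rs γ {r z} → r ∈ rs → z ∈ multiplesOf γ r → z ∈ nonSquareFree rs γ
∈-nonSquareFree (r ∷ rs) γ (here refl) z∈ = ∈-mergeˡ (multiplesOf γ r) (nonSquareFree rs γ) z∈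
∈-nonSquareFree (r′ ∷ rs) γ (there r∈) z∈ = ∈-mergeʳ (multiplesOf γ r′) (nonSquareFree rs γ) (∈-nonSquareFree rs γ r∈ z∈)

unit-squares : allBelow 12 (λ v → (v % 2 ≡ᵇ 0) ∨ (v % 3 ≡ᵇ 0) ∨ ((v * v) % 12 ≡ᵇ 1)) ≡ true
unit-squares = refl

prime²%12 : ∀ r → Prime r → 5 ≤ r → (r * r) % 12 ≡ 1
prime²%12 r pr 5≤r = by-2 (∨-elim {v % 2 ≡ᵇ 0} (allBelow-sound 12 (λ v → (v % 2 ≡ᵇ 0) ∨ (v % 3 ≡ᵇ 0) ∨ ((v * v) % 12 ≡ᵇ 1)) unit-squares v (m%n<n r 12)))
  where
  v : ℕ
  v = r % 12
  ≢0 : ∀ {q} .{{_ : NonZero q}} → q ∣ 12 → Prime q → q < 5 → (v % q ≡ᵇ 0) ≡ true → ⊥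
  ≢0 {q} q∣12 pq q<5 eq = <⇒≱ q<5 (≤-trans 5≤r (≤-reflexive (sym (prime-∣ pq pr (m%n≡0⇒n∣m r q (trans (sym (m∣n⇒o%n%m≡o%m q 12 r q∣12)) (≡ᵇ⇒≡ (v % q) 0 (subst T (sym eq) _))))))))
  by-3 : (v % 3 ≡ᵇ 0) ≡ true ⊎ ((v * v) % 12 ≡ᵇ 1) ≡ true → (r * r) % 12 ≡ 1
  by-3 (inj₁ eq) = ⊥-elim (≢0 {3} (divides 4 refl) prime[3] (≤ᵇ⇒≤ 4 5 _) eq)
  by-3 (inj₂ eq) = trans (%-distribˡ-* r r 12) (≡ᵇ⇒≡ ((v * v) % 12) 1 (subst T (sym eq) _))
  by-2 : (v % 2 ≡ᵇ 0) ≡ true ⊎ (v % 3 ≡ᵇ 0) ∨ ((v * v) % 12 ≡ᵇ 1) ≡ true → (r * r) % 12 ≡ 1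
  by-2 (inj₁ eq) = ⊥-elim (≢0 {2} (divides 6 refl) prime[2] (≤ᵇ⇒≤ 3 5 _) eq)
  by-2 (inj₂ eq) = by-3 (∨-elim {v % 3 ≡ᵇ 0} eq)

-- As γ is divisible by neither 3 nor 4, r is at least 5, and r² ≤ η < 2²² gives r < 2048. Since r²
-- ≡ 1 mod 12, the cofactor η / r² lies in the class γ again and occurs among the `multiples`.
nonSquareFree-complete : ∀ γ η r → γ % 3 ≢ 0 → γ % 4 ≢ 0 → η % 12 ≡ γ → 1 ≤ η → η < limit → Prime r → r * r ∣ η → η ∈ nonSquareFree sievedFrom5 γ
nonSquareFree-complete γ η r γ3 γ4 η≡γ 1≤η η<limit pr r²∣η@(divides m η≡) =
  ∈-nonSquareFree sievedFrom5 γ (filterᵇ-complete isSieved (upwards 5 2043) (∈-upwards 5 2043 r 5≤r r<2048) (isSieved-prime pr))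
    (subst (_∈ multiplesOf γ r) (sym η≡r²[γ+12i]) (∈-multiples (r * r) γ (suc (limit ÷ (12 * (r * r)))) i i<))
  where
  η%d : ∀ d .{{_ : NonZero d}} → d ∣ 12 → η % d ≡ γ % d
  η%d d d∣12 = trans (sym (m∣n⇒o%n%m≡o%m d 12 η d∣12)) (cong (_% d) η≡γ)
  r≢2 : r ≢ 2
  r≢2 refl = γ4 (trans (sym (η%d 4 (divides 3 refl))) (n∣m⇒m%n≡0 η 4 r²∣η))
  r≢3 : r ≢ 3
  r≢3 refl = γ3 (trans (sym (η%d 3 (divides 4 refl))) (n∣m⇒m%n≡0 η 3 (∣-trans (m∣m*n 3) r²∣η)))
  5≤r : 5 ≤ r
  5≤r with primeSize pr
  ... | is-2 eq = contradiction eq r≢2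
  ... | is-3 eq = contradiction eq r≢3
  ... | is-5 refl = ≤-refl
  ... | is-7 refl = ≤ᵇ⇒≤ 5 7 _
  ... | is-11 refl = ≤ᵇ⇒≤ 5 11 _
  ... | large 13≤r = ≤-trans (≤ᵇ⇒≤ 5 13 _) 13≤r
  r<2048 : r < 2048
  r<2048 = <²⇒< {r} {2048} (≤-<-trans (∣⇒≤ {{>-nonZero 1≤η}} r²∣η) η<limit)
  i : ℕ
  i = m / 12
  η≡r²m : η ≡ r * r * m
  η≡r²m = trans η≡ (*-comm m (r * r))
  m%12 : m % 12 ≡ γ
  m%12 = begin
    m % 12               ≡⟨ cong (_% 12) (*-identityˡ m) ⟨
    (1 * m) % 12         ≡⟨ %-*-congˡ 12 {r * r} {1} m (prime²%12 r pr 5≤r) ⟨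
    (r * r * m) % 12     ≡⟨ cong (_% 12) η≡r²m ⟨
    η % 12               ≡⟨ η≡γ ⟩
    γ                    ∎
    where open ≡-Reasoning
  m≡ : m ≡ γ + 12 * i
  m≡ = trans (m≡m%n+[m/n]*n m 12) (cong₂ _+_ m%12 (*-comm i 12))
  η≡r²[γ+12i] : η ≡ r * r * (γ + 12 * i)
  η≡r²[γ+12i] = trans η≡r²m (cong (r * r *_) m≡)
  i< : i < suc (limit ÷ (12 * (r * r)))
  i< = s≤s (m*n≤o⇒m≤o÷n i (12 * (r * r)) limit (*-mono-≤ {1} {12} (s≤s z≤n) (*-mono-≤ (prime≥1 pr) (prime≥1 pr))) (begin
    i * (12 * (r * r))       ≡⟨ solve 2 (λ i q → i :* (con 12 :* q) := q :* (con 12 :* i)) refl i (r * r) ⟩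
    r * r * (12 * i)         ≤⟨ *-monoʳ-≤ (r * r) (m≤n+m (12 * i) γ) ⟩
    r * r * (γ + 12 * i)     ≡⟨ η≡r²[γ+12i] ⟨
    η                        ≤⟨ <⇒≤ η<limit ⟩
    limit                    ∎))
    where
    open ≤-Reasoning
    open +-*-Solver

record Window : Set where
  constructor window
  field
    primes pool : List ℕ
    top : ℕ

absent : ℕ → List ℕ → Bool
absent e [] = true
absent e (y ∷ ys) = if e <ᵇ y then absent e ys else not (e ≡ᵇ y)

smoothGap : ℕ → ℕ → Bool
smoothGap p q = (p <ᵇ q) ∧ smooth (q ∸ p)

usable : ℕ → ℕ → List ℕ → ℕ → Bool
usable n x rest q = (n ∸ q <ᵇ x) ∧ (q <ᵇ n) ∧ absent (n ∸ q) rest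

-- rest lists the non-square-free numbers below x, in descending order.
recovers : List ℕ → ℕ → ℕ → List ℕ → Bool
recovers pool n x rest = (n <ᵇ 120) ∨ tripleOf smoothGap (filterᵇ (usable n x rest) pool)

allOf : ∀ {A : Set} → (A → Bool) → List A → Bool
allOf f [] = true
allOf f (x ∷ xs) = f x ∧ allOf f xs

allOf-sound : ∀ {A : Set} (f : A → Bool) xs → allOf f xs ≡ true → All (λ x → f x ≡ true) xs
allOf-sound f [] eq = []
allOf-sound f (x ∷ xs) eq with ∧-elim {f x} eq
... | fx , fxs = fx ∷ allOf-sound f xs fxs

-- For n = x + p, a further n ∸ p′ < x in the list is at most the next element y, so n ≤ y + top.
checkPair : ℕ → ℕ → List ℕ → Window → Bool
checkPair x y l (window primes pool top) = allOf (λ p → (y + top <ᵇ x + p) ∨ recovers pool (x + p) x l) primes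

scan : List Window → List ℕ → Bool
scan ws [] = true
scan ws (x ∷ []) = true
scan ws (x ∷ y ∷ l) = not (x <ᵇ y) ∧ allOf (checkPair x y (y ∷ l)) ws ∧ scan ws (y ∷ l)

T⇒≡true : ∀ {b} → T b → b ≡ true
T⇒≡true {true} _ = refl

not-<ᵇ : ∀ {x y} → not (x <ᵇ y) ≡ true → y ≤ x
not-<ᵇ {x} {y} eq = ≮⇒≥ λ x<y → contradiction (trans (sym eq) (cong not (T⇒≡true (<⇒<ᵇ x<y)))) λ ()

scan-tail : ∀ ws x l → scan ws (x ∷ l) ≡ true → scan ws l ≡ true
scan-tail ws x [] eq = refl
scan-tail ws x (y ∷ l) eq = proj₂ (∧-elim {allOf (checkPair x y (y ∷ l)) ws} (proj₂ (∧-elim {not (x <ᵇ y)} eq)))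

scan-≤ : ∀ ws x l → scan ws (x ∷ l) ≡ true → ∀ {z} → z ∈ l → z ≤ x
scan-≤ ws x (y ∷ l) eq (here refl) = not-<ᵇ (proj₁ (∧-elim {not (x <ᵇ y)} eq))
scan-≤ ws x (y ∷ l) eq (there z∈) = ≤-trans (scan-≤ ws y l (scan-tail ws x (y ∷ l) eq) z∈) (not-<ᵇ (proj₁ (∧-elim {not (x <ᵇ y)} eq)))

-- `absent` stops at the first entry not above `e`, which is conclusive for a descending list; the
-- descent is certified by `scan`.
absent-sound : ∀ ws l e → scan ws l ≡ true → absent e l ≡ true → ¬ (e ∈ l)
absent-sound ws (y ∷ l) e sc ab e∈ with e <ᵇ y in lt
absent-sound ws (y ∷ l) e sc ab (here refl) | true = contradiction (<ᵇ⇒< e e (subst T (sym lt) _)) (<-irrefl refl)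
absent-sound ws (y ∷ l) e sc ab (there e∈) | true = absent-sound ws l e (scan-tail ws y l sc) ab e∈
... | false = not-≡ᵇ ab (≤-antisym e≤y (≮⇒≥ λ e<y → contradiction (trans (sym lt) (T⇒≡true (<⇒<ᵇ e<y))) λ ()))
  where
  e≤y : e ≤ y
  e≤y = [ (λ { refl → ≤-refl }) , scan-≤ ws y l sc ]′ (split e∈)
    where
    split : e ∈ (y ∷ l) → e ≡ y ⊎ e ∈ l
    split (here eq) = inj₁ eq
    split (there e∈l) = inj₂ e∈l

-- If two entries e > e′ of the list belong to the same n, then e and its successor in the list are
-- so close that the test of `checkPair` was not skipped for n = e + p. `rest` is the list from that
-- successor on.
scan-sound : ∀ ws l → scan ws l ≡ true → ∀ {primes pool top} → window primes pool top ∈ ws →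
             ∀ {e e′ p p′} → e ∈ l → e′ ∈ l → e′ < e → p ∈ primes → p′ ≤ top → e + p ≡ e′ + p′ →
             ∃[ rest ] recovers pool (e + p) e rest ≡ true × scan ws rest ≡ true × (∀ z → z ∈ l → z < e → z ∈ rest)
scan-sound ws (x ∷ []) sc w∈ (here refl) (here refl) e′<e = contradiction e′<e (<-irrefl refl)
scan-sound ws (x ∷ y ∷ l) sc {primes} {pool} {top} w∈ {e} {e′} {p} {p′} e∈ e′∈ e′<e p∈ p′≤ eq = by-position e∈ e′∈
  where
  parts = ∧-elim {not (x <ᵇ y)} sc
  tail-ok : scan ws (y ∷ l) ≡ true
  tail-ok = scan-tail ws x (y ∷ l) sc
  by-position : e ∈ (x ∷ y ∷ l) → e′ ∈ (x ∷ y ∷ l) →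
                ∃[ rest ] recovers pool (e + p) e rest ≡ true × scan ws rest ≡ true × (∀ z → z ∈ (x ∷ y ∷ l) → z < e → z ∈ rest)
  by-position (here refl) (here refl) = contradiction e′<e (<-irrefl refl)
  by-position (here refl) (there e′∈) = y ∷ l , found , tail-ok , λ { z (here refl) z<e → contradiction z<e (<-irrefl refl) ; z (there z∈) _ → z∈ }
    where
    e′≤y : e′ ≤ y
    e′≤y = [ (λ { refl → ≤-refl }) , scan-≤ ws y l tail-ok ]′ (split e′∈)
      where
      split : e′ ∈ (y ∷ l) → e′ ≡ y ⊎ e′ ∈ l
      split (here eq) = inj₁ eq
      split (there e∈l) = inj₂ e∈l
    pair : (y + top <ᵇ x + p) ∨ recovers pool (x + p) x (y ∷ l) ≡ true
    pair = All.lookup (allOf-sound _ primes (All.lookup (allOf-sound (checkPair x y (y ∷ l)) ws (proj₁ (∧-elim {allOf (checkPair x y (y ∷ l)) ws} (proj₂ parts)))) w∈)) p∈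
    found : recovers pool (x + p) x (y ∷ l) ≡ true
    found with ∨-elim {y + top <ᵇ x + p} pair
    ... | inj₂ ok = ok
    ... | inj₁ lt = contradiction (<ᵇ⇒< (y + top) (x + p) (subst T (sym lt) _)) (≤⇒≯ (≤-trans (≤-reflexive eq) (+-mono-≤ e′≤y p′≤)))
  by-position (there e∈) (here refl) = contradiction e′<e (≤⇒≯ (scan-≤ ws x (y ∷ l) sc e∈))
  by-position (there e∈) (there e′∈) with scan-sound ws (y ∷ l) tail-ok w∈ e∈ e′∈ e′<e p∈ p′≤ eq
  ... | rest , ok , rest-ok , below = rest , ok , rest-ok , λ { z (here refl) z<e → contradiction z<e (≤⇒≯ (scan-≤ ws x (y ∷ l) sc e∈)) ; z (there z∈) z<e → below z z∈ z<e }

-- The four primes of a window lie in one class mod 12 and have 3-smooth gaps: if n ∸ p fails to be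
-- square-free for at most one of them, three candidates remain; otherwise the pool has to provide them.
pool5 pool7 pool11 pool1 : List ℕ
pool5 = 5 ∷ 17 ∷ 29 ∷ 41 ∷ 53 ∷ 89 ∷ 101 ∷ 113 ∷ 137 ∷ 149 ∷ 173 ∷ 197 ∷ 233 ∷ 257 ∷ 269 ∷ 281 ∷ 293 ∷ 317 ∷ 353 ∷ []
pool7 = 7 ∷ 19 ∷ 31 ∷ 43 ∷ 67 ∷ 79 ∷ 103 ∷ 127 ∷ 139 ∷ 151 ∷ 163 ∷ 199 ∷ 211 ∷ 223 ∷ 271 ∷ 283 ∷ 307 ∷ 331 ∷ 367 ∷ 379 ∷ []
pool11 = 11 ∷ 23 ∷ 47 ∷ 59 ∷ 71 ∷ 83 ∷ 107 ∷ 131 ∷ 167 ∷ 179 ∷ 191 ∷ 227 ∷ 239 ∷ 251 ∷ 263 ∷ 311 ∷ 347 ∷ 359 ∷ []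
pool1 = 61 ∷ 73 ∷ 97 ∷ 109 ∷ 157 ∷ 181 ∷ 193 ∷ 229 ∷ 241 ∷ 277 ∷ 313 ∷ 337 ∷ 349 ∷ 373 ∷ []

w5 w7 w11 w1 : Window
w5 = window (5 ∷ 17 ∷ 29 ∷ 41 ∷ []) pool5 41
w7 = window (7 ∷ 19 ∷ 31 ∷ 43 ∷ []) pool7 43
w11 = window (11 ∷ 23 ∷ 47 ∷ 59 ∷ []) pool11 59
w1 = window (61 ∷ 73 ∷ 97 ∷ 109 ∷ []) pool1 109

-- γ runs through the six residues modulo 12 that are divisible by neither 3 nor 4. Each list of
-- multiples serves every window that is used with its γ.
scan-7 : scan (w5 ∷ w7 ∷ []) (nonSquareFree sievedFrom5 7) ≡ true
scan-7 = refl

scan-11 : scan (w5 ∷ []) (nonSquareFree sievedFrom5 11) ≡ true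
scan-11 = refl

scan-1 : scan (w5 ∷ w7 ∷ []) (nonSquareFree sievedFrom5 1) ≡ true
scan-1 = refl

scan-5 : scan (w5 ∷ []) (nonSquareFree sievedFrom5 5) ≡ true
scan-5 = refl

scan-10 : scan (w5 ∷ w1 ∷ w7 ∷ []) (nonSquareFree sievedFrom5 10) ≡ true
scan-10 = refl

scan-2 : scan (w5 ∷ w11 ∷ w7 ∷ []) (nonSquareFree sievedFrom5 2) ≡ true
scan-2 = refl

-- `Z` is the final goal: two failures in one window lead to it directly, through the pool.
-- Otherwise at most one member of the window fails.
resolve : ∀ {B : ℕ → Set} {Z : Set} → (∀ p → Dec (B p)) → ∀ ps → AllPairs (λ p q → B p → B q → Z) ps → Z ⊎ AllPairs (λ p q → ¬ (B p × B q)) ps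
resolve B? [] [] = inj₂ []
resolve {B} {Z} B? (p ∷ ps) (hs ∷ hss) = combine (B? p) (resolve B? ps hss)
  where
  exclude : B p → ∀ qs → All (λ q → B p → B q → Z) qs → Z ⊎ All (λ q → ¬ (B p × B q)) qs
  exclude bp [] [] = inj₂ []
  exclude bp (q ∷ qs) (h ∷ hs) with B? q | exclude bp qs hs
  ... | yes bq | _ = inj₁ (h bp bq)
  ... | no ¬bq | inj₁ z = inj₁ z
  ... | no ¬bq | inj₂ none = inj₂ ((λ (_ , bq) → ¬bq bq) ∷ none)
  combine : Dec (B p) → Z ⊎ AllPairs (λ p q → ¬ (B p × B q)) ps → Z ⊎ AllPairs (λ p q → ¬ (B p × B q)) (p ∷ ps)
  combine _ (inj₁ z) = inj₁ z
  combine (no ¬bp) (inj₂ rest) = inj₂ (All.universal (λ _ (bp , _) → ¬bp bp) ps ∷ rest)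
  combine (yes bp) (inj₂ rest) with exclude bp ps hs
  ... | inj₁ z = inj₁ z
  ... | inj₂ none = inj₂ (none ∷ rest)

-- `c` is the class of the primes and `v` that of n, so γ ≡ v - c is the class of n - p; `γ-unique`
-- puts this in a form settled by evaluation.
record Class (c v γ : ℕ) (ws : List Window) : Set where
  field
    primes pool l : List ℕ
    top : ℕ
    complete : ∀ η r → η % 12 ≡ γ → 1 ≤ η → η < limit → Prime r → r * r ∣ η → η ∈ l
    listed : window primes pool top ∈ ws
    scanned : scan ws l ≡ true
    primes-ok : All (λ p → Prime p × p % 12 ≡ c × p ≤ top) primes
    pool-ok : All (λ p → Prime p × p % 12 ≡ c) pool
    gaps : AllPairs (λ p q → smoothGap p q ≡ true) primes
    4≤primes : 4 ≤ length primes
    top<120 : top < 120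
    c-odd : c % 2 ≡ 1
    γ%3 : γ % 3 ≢ 0
    γ-unique : allBelow 12 (λ u → not ((u + c) % 12 ≡ᵇ v) ∨ (u ≡ᵇ γ)) ≡ true

module InClass {c v γ ws} (C : Class c v γ ws) (n : ℕ) (n≡v : n % 12 ≡ v) (120≤n : 120 ≤ n) (n<limit : n < limit)
               (a b : ℕ) (pa : Prime a) (pb : Prime b) where
  open Class C

  module _ {p} (p<n : p < n) (p≡c : p % 12 ≡ c) where

    η≡γ : (n ∸ p) % 12 ≡ γ
    η≡γ = from-check (∨-elim {not ((u + c) % 12 ≡ᵇ v)} (allBelow-sound 12 (λ u → not ((u + c) % 12 ≡ᵇ v) ∨ (u ≡ᵇ γ)) γ-unique u (m%n<n (n ∸ p) 12)))
      where
      u : ℕ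
      u = (n ∸ p) % 12
      u+c : (u + c) % 12 ≡ v
      u+c = begin
        (u + c) % 12                      ≡⟨ cong (λ t → (u + t) % 12) p≡c ⟨
        (u + p % 12) % 12                 ≡⟨ %-distribˡ-+ (n ∸ p) p 12 ⟨
        (n ∸ p + p) % 12                  ≡⟨ cong (_% 12) (m∸n+n≡m (<⇒≤ p<n)) ⟩
        n % 12                            ≡⟨ n≡v ⟩
        v                                 ∎
        where open ≡-Reasoning
      from-check : not ((u + c) % 12 ≡ᵇ v) ≡ true ⊎ (u ≡ᵇ γ) ≡ true → u ≡ γ
      from-check (inj₁ eq) = contradiction u+c (not-≡ᵇ eq)
      from-check (inj₂ eq) = ≡ᵇ⇒≡ u γ (subst T (sym eq) _)

    3∤η : ¬ (3 ∣ n ∸ p)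
    3∤η d = γ%3 (trans (sym (trans (sym (m∣n⇒o%n%m≡o%m 3 12 (n ∸ p) (divides 4 refl))) (cong (_% 3) η≡γ))) (n∣m⇒m%n≡0 (n ∸ p) 3 d))

    p-odd : ¬ (2 ∣ p)
    p-odd 2∣p = contradiction (trans (sym (n∣m⇒m%n≡0 p 2 2∣p)) (trans (sym (m∣n⇒o%n%m≡o%m 2 12 p (divides 6 refl))) (trans (cong (_% 2) p≡c) c-odd))) λ ()

    squareFree : ¬ (n ∸ p ∈ l) → SquareFreeη n p
    squareFree ∉l r pr r²∣ = ∉l (complete (n ∸ p) r η≡γ (m<n⇒0<n∸m p<n) (≤-<-trans (m∸n≤m n p) n<limit) pr r²∣)

  gap-separated : ∀ {p q} → p < n → q < n → p % 12 ≡ c → smoothGap p q ≡ true → Separated n p q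
  gap-separated {p} {q} p<n q<n p≡c gap with ∧-elim {p <ᵇ q} gap
  ... | lt , sm = smooth-separated (<ᵇ⇒< p q (subst T (sym lt) _)) q<n sm λ (d , _) → 3∤η p<n p≡c d

  from-recovery : ∀ e p rest → n ∸ p ≡ e → recovers pool n e rest ≡ true → scan ws rest ≡ true → (∀ z → z ∈ l → z < e → z ∈ rest) → ∃ (Represents n a b)
  from-recovery e p rest refl rec rest-ok below = from-triple (tripleOf-sound smoothGap us (by-size (∨-elim {n <ᵇ 120} rec)))
    where
    us : List ℕ
    us = filterᵇ (usable n e rest) pool
    by-size : (n <ᵇ 120) ≡ true ⊎ tripleOf smoothGap us ≡ true → tripleOf smoothGap us ≡ true
    by-size (inj₁ lt) = contradiction (<ᵇ⇒< n 120 (subst T (sym lt) _)) (≤⇒≯ 120≤n)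
    by-size (inj₂ ok) = ok
    facts : ∀ {q} → q ∈ us → q < n × q % 12 ≡ c × Prime q × SquareFreeη n q
    facts {q} q∈ with filterᵇ-sound (usable n e rest) pool q∈
    ... | q∈pool , use with ∧-elim {n ∸ q <ᵇ e} use
    ...   | η<e , use′ with ∧-elim {q <ᵇ n} use′
    ...     | lt , ab = q<n , proj₂ ok , proj₁ ok , squareFree q<n (proj₂ ok) λ η∈l →
                absent-sound ws rest (n ∸ q) rest-ok ab (below (n ∸ q) η∈l (<ᵇ⇒< (n ∸ q) e (subst T (sym η<e) _)))
      where
      ok = All.lookup pool-ok q∈pool
      q<n = <ᵇ⇒< q n (subst T (sym lt) _)
    from-triple : (∃[ q₁ ] ∃[ q₂ ] ∃[ q₃ ] (q₁ ∈ us × q₂ ∈ us × q₃ ∈ us) × smoothGap q₁ q₂ ≡ true × smoothGap q₁ q₃ ≡ true × smoothGap q₂ q₃ ≡ true) → ∃ (Represents n a b)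
    from-triple (q₁ , q₂ , q₃ , (∈₁ , ∈₂ , ∈₃) , g₁₂ , g₁₃ , g₂₃) =
      three-candidates n a b pa pb (q₁ ∷ q₂ ∷ q₃ ∷ []) good ((sep ∈₁ ∈₂ g₁₂ ∷ sep ∈₁ ∈₃ g₁₃ ∷ []) ∷ (sep ∈₂ ∈₃ g₂₃ ∷ []) ∷ [] ∷ []) ≤-refl
      where
      sep : ∀ {p q} → p ∈ us → q ∈ us → smoothGap p q ≡ true → Separated n p q
      sep p∈ q∈ = gap-separated (proj₁ (facts p∈)) (proj₁ (facts q∈)) (proj₁ (proj₂ (facts p∈)))
      good′ : ∀ {q} → q ∈ us → Candidate n q × SquareFreeη n q
      good′ q∈ with facts q∈
      ... | q<n , q≡c , pq , sqf = candidate q<n pq (p-odd q<n q≡c) , sqf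
      good : ∀ {q} → q ∈ (q₁ ∷ q₂ ∷ q₃ ∷ []) → Candidate n q × SquareFreeη n q
      good (here refl) = good′ ∈₁
      good (there (here refl)) = good′ ∈₂
      good (there (there (here refl))) = good′ ∈₃

  primes<n : ∀ {p} → p ∈ primes → p < n
  primes<n p∈ = ≤-<-trans (proj₂ (proj₂ (All.lookup primes-ok p∈))) (<-≤-trans top<120 120≤n)

  restrict : ∀ {R : ℕ → ℕ → Set} {S : ℕ → ℕ → Set} ps → (∀ {p} → p ∈ ps → p ∈ primes) → AllPairs R ps →
             (∀ {p q} → p ∈ primes → q ∈ primes → R p q → S p q) → AllPairs S ps
  restrict [] _ [] h = []
  restrict (p ∷ ps) ⊆primes (rs ∷ rss) h = All.tabulate (λ q∈ → h (⊆primes (here refl)) (⊆primes (there q∈)) (All.lookup rs q∈)) ∷ restrict ps (⊆primes ∘ there) rss h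

  represented-in-class : ∃ (Represents n a b)
  represented-in-class = conclude (resolve (λ p → n ∸ p ∈? l) primes (restrict primes (λ p∈ → p∈) gaps two-bad))
    where
    two-bad : ∀ {p q} → p ∈ primes → q ∈ primes → smoothGap p q ≡ true → n ∸ p ∈ l → n ∸ q ∈ l → ∃ (Represents n a b)
    two-bad {p} {q} p∈ q∈ gap ηp∈ ηq∈ with scan-sound ws l scanned listed {p = p} {p′ = q} ηp∈ ηq∈ (∸-monoʳ-< p<q (<⇒≤ (primes<n q∈))) p∈ (proj₂ (proj₂ (All.lookup primes-ok q∈)))
                                              (trans (m∸n+n≡m (<⇒≤ (primes<n p∈))) (sym (m∸n+n≡m (<⇒≤ (primes<n q∈)))))
      where
      p<q : p < q
      p<q = <ᵇ⇒< p q (subst T (sym (proj₁ (∧-elim {p <ᵇ q} gap))) _)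
    ... | rest , rec , rest-ok , below = from-recovery (n ∸ p) p rest refl (subst (λ m → recovers pool m (n ∸ p) rest ≡ true) (m∸n+n≡m (<⇒≤ (primes<n p∈))) rec) rest-ok below
    conclude : ∃ (Represents n a b) ⊎ AllPairs (λ p q → ¬ (n ∸ p ∈ l × n ∸ q ∈ l)) primes → ∃ (Represents n a b)
    conclude (inj₁ found) = found
    conclude (inj₂ excl) = three-candidates n a b pa pb ps good
        (restrict ps (λ p∈ → proj₁ (∈-filter⁻ (¬K? bad?) {xs = primes} p∈)) (AllPairs.filter⁺ (¬K? bad?) gaps)
          λ p∈ q∈ → gap-separated (primes<n p∈) (primes<n q∈) (proj₁ (proj₂ (All.lookup primes-ok p∈))))
        (≤-pred (≤-trans 4≤primes (length-filter-¬ bad? primes excl)))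
      where
      bad? : ∀ p → Dec (n ∸ p ∈ l)
      bad? p = n ∸ p ∈? l
      ps : List ℕ
      ps = filter (¬K? bad?) primes
      good : ∀ {p} → p ∈ ps → Candidate n p × SquareFreeη n p
      good p∈ with ∈-filter⁻ (¬K? bad?) {xs = primes} p∈
      ... | p∈primes , ∉l with All.lookup primes-ok p∈primes
      ...   | pp , p≡c , _ = candidate (primes<n p∈primes) pp (p-odd (primes<n p∈primes) p≡c) , squareFree (primes<n p∈primes) p≡c ∉l

record WindowOk (c : ℕ) (w : Window) : Set where
  open Window w
  field
    primes-ok : All (λ p → Prime p × p % 12 ≡ c × p ≤ top) primes
    pool-ok : All (λ p → Prime p × p % 12 ≡ c) pool
    gaps : AllPairs (λ p q → smoothGap p q ≡ true) primes
    4≤primes : 4 ≤ length primes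
    top<120 : top < 120
    c-odd : c % 2 ≡ 1

opaque
  w5-ok : WindowOk 5 w5
  w5-ok = record
    { primes-ok = from-yes (All.all? (λ p → prime? p ×-dec (p % 12 ≟ 5) ×-dec (p ≤? 41)) (5 ∷ 17 ∷ 29 ∷ 41 ∷ []))
    ; pool-ok = from-yes (All.all? (λ p → prime? p ×-dec (p % 12 ≟ 5)) pool5)
    ; gaps = from-yes (AllPairs.allPairs? (λ p q → smoothGap p q ≟ᵇ true) (5 ∷ 17 ∷ 29 ∷ 41 ∷ []))
    ; 4≤primes = ≤-refl ; top<120 = ≤ᵇ⇒≤ 42 120 _ ; c-odd = refl }

  w7-ok : WindowOk 7 w7
  w7-ok = record
    { primes-ok = from-yes (All.all? (λ p → prime? p ×-dec (p % 12 ≟ 7) ×-dec (p ≤? 43)) (7 ∷ 19 ∷ 31 ∷ 43 ∷ []))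
    ; pool-ok = from-yes (All.all? (λ p → prime? p ×-dec (p % 12 ≟ 7)) pool7)
    ; gaps = from-yes (AllPairs.allPairs? (λ p q → smoothGap p q ≟ᵇ true) (7 ∷ 19 ∷ 31 ∷ 43 ∷ []))
    ; 4≤primes = ≤-refl ; top<120 = ≤ᵇ⇒≤ 44 120 _ ; c-odd = refl }

  w11-ok : WindowOk 11 w11
  w11-ok = record
    { primes-ok = from-yes (All.all? (λ p → prime? p ×-dec (p % 12 ≟ 11) ×-dec (p ≤? 59)) (11 ∷ 23 ∷ 47 ∷ 59 ∷ []))
    ; pool-ok = from-yes (All.all? (λ p → prime? p ×-dec (p % 12 ≟ 11)) pool11)
    ; gaps = from-yes (AllPairs.allPairs? (λ p q → smoothGap p q ≟ᵇ true) (11 ∷ 23 ∷ 47 ∷ 59 ∷ []))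
    ; 4≤primes = ≤-refl ; top<120 = ≤ᵇ⇒≤ 60 120 _ ; c-odd = refl }

  w1-ok : WindowOk 1 w1
  w1-ok = record
    { primes-ok = from-yes (All.all? (λ p → prime? p ×-dec (p % 12 ≟ 1) ×-dec (p ≤? 109)) (61 ∷ 73 ∷ 97 ∷ 109 ∷ []))
    ; pool-ok = from-yes (All.all? (λ p → prime? p ×-dec (p % 12 ≟ 1)) pool1)
    ; gaps = from-yes (AllPairs.allPairs? (λ p q → smoothGap p q ≟ᵇ true) (61 ∷ 73 ∷ 97 ∷ 109 ∷ []))
    ; 4≤primes = ≤-refl ; top<120 = ≤ᵇ⇒≤ 110 120 _ ; c-odd = refl }

classOf : ∀ {c v γ ws w} → WindowOk c w → w ∈ ws → ∃[ l ] scan ws l ≡ true × (∀ η r → η % 12 ≡ γ → 1 ≤ η → η < limit → Prime r → r * r ∣ η → η ∈ l) →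
          γ % 3 ≢ 0 → allBelow 12 (λ u → not ((u + c) % 12 ≡ᵇ v) ∨ (u ≡ᵇ γ)) ≡ true → Class c v γ ws
classOf {w = window primes pool top} ok listed (l , scanned , complete) γ%3 γ-unique = record
  { primes = primes ; pool = pool ; l = l ; top = top ; complete = complete ; listed = listed ; scanned = scanned
  ; primes-ok = primes-ok ; pool-ok = pool-ok ; gaps = gaps ; 4≤primes = 4≤primes ; top<120 = top<120
  ; c-odd = c-odd ; γ%3 = γ%3 ; γ-unique = γ-unique }
  where open WindowOk ok

opaque
  Scanned : ℕ → List Window → Set
  Scanned γ ws = ∃[ l ] scan ws l ≡ true × (∀ η r → η % 12 ≡ γ → 1 ≤ η → η < limit → Prime r → r * r ∣ η → η ∈ l)

  scanned : ∀ {γ ws} → Scanned γ ws → ∃[ l ] scan ws l ≡ true × (∀ η r → η % 12 ≡ γ → 1 ≤ η → η < limit → Prime r → r * r ∣ η → η ∈ l)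
  scanned s = s

  scanned-by : ∀ γ ws → scan ws (nonSquareFree sievedFrom5 γ) ≡ true → γ % 3 ≢ 0 → γ % 4 ≢ 0 → Scanned γ ws
  scanned-by γ ws ok γ3 γ4 = nonSquareFree sievedFrom5 γ , ok , λ η r → nonSquareFree-complete γ η r γ3 γ4

scanned-1 : Scanned 1 (w5 ∷ w7 ∷ [])
scanned-1 = scanned-by 1 _ scan-1 (λ ()) (λ ())
scanned-2 : Scanned 2 (w5 ∷ w11 ∷ w7 ∷ [])
scanned-2 = scanned-by 2 _ scan-2 (λ ()) (λ ())
scanned-5 : Scanned 5 (w5 ∷ [])
scanned-5 = scanned-by 5 _ scan-5 (λ ()) (λ ())
scanned-7 : Scanned 7 (w5 ∷ w7 ∷ [])
scanned-7 = scanned-by 7 _ scan-7 (λ ()) (λ ())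
scanned-10 : Scanned 10 (w5 ∷ w1 ∷ w7 ∷ [])
scanned-10 = scanned-by 10 _ scan-10 (λ ()) (λ ())
scanned-11 : Scanned 11 (w5 ∷ [])
scanned-11 = scanned-by 11 _ scan-11 (λ ()) (λ ())

window-represents : ∀ n → 120 ≤ n → n < limit → ∀ a b → Prime a → Prime b → ∃ (Represents n a b)
window-represents n 120≤n n<limit a b pa pb = by-residue (n % 12) refl (m%n<n n 12)
  where
  use : ∀ {c v γ ws} → Class c v γ ws → n % 12 ≡ v → ∃ (Represents n a b)
  use C eq = InClass.represented-in-class C n eq 120≤n n<limit a b pa pb
  first : ∀ {w : Window} {ws} → w ∈ (w ∷ ws)
  first = here refl
  by-residue : ∀ v → n % 12 ≡ v → v < 12 → ∃ (Represents n a b)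
  -- γ ≡ v - c must not be divisible by 3 or 4. For odd v only γ = 2 and γ = 10 are possible, which
  -- forces c = 11 for v = 1 and c = 1 for v = 11; otherwise c = 5 or c = 7 can be taken.
  by-residue 0 eq _ = use (classOf w5-ok first (scanned scanned-7) (λ ()) refl) eq
  by-residue 1 eq _ = use (classOf w11-ok (there first) (scanned scanned-2) (λ ()) refl) eq
  by-residue 2 eq _ = use (classOf w7-ok (there first) (scanned scanned-7) (λ ()) refl) eq
  by-residue 3 eq _ = use (classOf w5-ok first (scanned scanned-10) (λ ()) refl) eq
  by-residue 4 eq _ = use (classOf w5-ok first (scanned scanned-11) (λ ()) refl) eq
  by-residue 5 eq _ = use (classOf w7-ok (there (there first)) (scanned scanned-10) (λ ()) refl) eq
  by-residue 6 eq _ = use (classOf w5-ok first (scanned scanned-1) (λ ()) refl) eq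
  by-residue 7 eq _ = use (classOf w5-ok first (scanned scanned-2) (λ ()) refl) eq
  by-residue 8 eq _ = use (classOf w7-ok (there first) (scanned scanned-1) (λ ()) refl) eq
  by-residue 9 eq _ = use (classOf w7-ok (there (there first)) (scanned scanned-2) (λ ()) refl) eq
  by-residue 10 eq _ = use (classOf w5-ok first (scanned scanned-5) (λ ()) refl) eq
  by-residue 11 eq _ = use (classOf w1-ok (there first) (scanned scanned-10) (λ ()) refl) eq
  by-residue (suc (suc (suc (suc (suc (suc (suc (suc (suc (suc (suc (suc v)))))))))))) eq lt = contradiction lt (≤⇒≯ (m≤m+n 12 v))

-- The range 36 ≤ n < 120

opaque
  oddPrimes : List ℕ
  oddPrimes = 3 ∷ 5 ∷ 7 ∷ 11 ∷ 13 ∷ 17 ∷ 19 ∷ 23 ∷ 29 ∷ 31 ∷ 37 ∷ 41 ∷ 43 ∷ 47 ∷ 53 ∷ 59 ∷ 61 ∷ 67 ∷ 71 ∷ 73 ∷ 79 ∷ 83 ∷ 89 ∷ 97 ∷ 101 ∷ 103 ∷ 107 ∷ 109 ∷ 113 ∷ []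

  oddPrimes-ok : All (λ p → Prime p × ¬ (2 ∣ p)) oddPrimes
  oddPrimes-ok = from-yes (All.all? (λ p → prime? p ×-dec ¬? (2 ∣? p)) oddPrimes)

-- Meant for e < 120 < 11², where a square d² > 1 dividing e has 2 ≤ d ≤ 10.
squareFreeᵇ : ℕ → Bool
squareFreeᵇ e = allBelow 9 (λ d → not (e % ((2 + d) * (2 + d)) ≡ᵇ 0))

-- The primes used here come from different classes modulo 12, so that the prime 3 has to be tested
-- for each pair.
directGap : ℕ → ℕ → ℕ → Bool
directGap n p q = smoothGap p q ∧ (not ((n ∸ p) % 3 ≡ᵇ 0) ∨ not ((n ∸ q) % 3 ≡ᵇ 0))

direct : ℕ → Bool
direct n = tripleOf (directGap n) (filterᵇ (λ p → (p <ᵇ n) ∧ squareFreeᵇ (n ∸ p)) oddPrimes)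

opaque
  unfolding oddPrimes

  direct-check : allBelow 84 (λ i → direct (36 + i)) ≡ true
  direct-check = refl

direct-represents : ∀ n → 36 ≤ n → n < 120 → ∀ a b → Prime a → Prime b → ∃ (Represents n a b)
direct-represents n 36≤n n<120 a b pa pb = from-triple (tripleOf-sound (directGap n) us (subst (λ m → direct m ≡ true) (m+[n∸m]≡n 36≤n)
    (allBelow-sound 84 (λ i → direct (36 + i)) direct-check (n ∸ 36) (∸-monoˡ-< n<120 36≤n))))
  where
  us : List ℕ
  us = filterᵇ (λ p → (p <ᵇ n) ∧ squareFreeᵇ (n ∸ p)) oddPrimes
  facts : ∀ {p} → p ∈ us → Candidate n p × SquareFreeη n p
  facts {p} p∈ with filterᵇ-sound (λ p → (p <ᵇ n) ∧ squareFreeᵇ (n ∸ p)) oddPrimes p∈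
  ... | p∈odd , ok with ∧-elim {p <ᵇ n} ok | All.lookup oddPrimes-ok p∈odd
  ...   | lt , sqf | pp , odd = candidate p<n pp odd , squareFree
    where
    p<n : p < n
    p<n = <ᵇ⇒< p n (subst T (sym lt) _)
    squareFree : SquareFreeη n p
    squareFree r pr r²∣ = by-shift (m≤n⇒∃[o]m+o≡n (prime≥2 pr))
      where
      r<11 : r < 11
      r<11 = <²⇒< {r} {11} (≤-<-trans (≤-trans (∣⇒≤ {{>-nonZero (m<n⇒0<n∸m p<n)}} r²∣) (m∸n≤m n p)) (<-≤-trans n<120 (≤ᵇ⇒≤ 120 121 _)))
      by-shift : ∃[ d ] 2 + d ≡ r → ⊥
      by-shift (d , refl) = not-≡ᵇ (allBelow-sound 9 (λ d → not ((n ∸ p) % ((2 + d) * (2 + d)) ≡ᵇ 0)) sqf d (≤-pred (≤-pred r<11)))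
                              (n∣m⇒m%n≡0 (n ∸ p) ((2 + d) * (2 + d)) r²∣)
  sep : ∀ {p q} → p ∈ us → q ∈ us → directGap n p q ≡ true → Separated n p q
  sep {p} {q} p∈ q∈ gap with ∧-elim {smoothGap p q} gap
  ... | sg , not3 with ∧-elim {p <ᵇ q} sg
  ...   | lt , sm = smooth-separated (<ᵇ⇒< p q (subst T (sym lt) _)) (Candidate.p<n (proj₁ (facts q∈))) sm
            λ (d , e) → [ (λ h → not-≡ᵇ h (n∣m⇒m%n≡0 (n ∸ p) 3 d)) , (λ h → not-≡ᵇ h (n∣m⇒m%n≡0 (n ∸ q) 3 e)) ]′ (∨-elim {not ((n ∸ p) % 3 ≡ᵇ 0)} not3)
  from-triple : (∃[ p ] ∃[ q ] ∃[ r ] (p ∈ us × q ∈ us × r ∈ us) × directGap n p q ≡ true × directGap n p r ≡ true × directGap n q r ≡ true) → ∃ (Represents n a b)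
  from-triple (p , q , r , (p∈ , q∈ , r∈) , pq , pr , qr) =
    three-candidates n a b pa pb (p ∷ q ∷ r ∷ []) (λ { (here refl) → facts p∈ ; (there (here refl)) → facts q∈ ; (there (there (here refl))) → facts r∈ })
      ((sep p∈ q∈ pq ∷ sep p∈ r∈ pr ∷ []) ∷ (sep q∈ r∈ qr ∷ []) ∷ [] ∷ []) ≤-refl

represents : ∀ n → 36 ≤ n → ∀ a b → Prime a → Prime b → ∃ (Represents n a b)
represents n 36≤n a b pa pb = by-size (n <? 120) (n <? limit)
  where
  by-size : Dec (n < 120) → Dec (n < limit) → ∃ (Represents n a b)
  by-size (yes n<120) _ = direct-represents n 36≤n n<120 a b pa pb
  by-size (no n≮120) (yes n<limit) = window-represents n (≮⇒≥ n≮120) n<limit a b pa pb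
  by-size (no _) (no n≮limit) = LargeRange.represented n (≮⇒≥ n≮limit) a b pa pb

-- Deduction of the theorem

primeDivisor : ∀ d → 2 ≤ d → ∃[ r ] Prime r × r ∣ d
primeDivisor d@(suc _) 2≤d = from-factors (factors F) (factorsPrime F) (isFactorisation F)
  where
  open PrimeFactorisation
  F = factorise d
  from-factors : ∀ ps → All Prime ps → d ≡ product ps → ∃[ r ] Prime r × r ∣ d
  from-factors [] [] eq = contradiction 2≤d (<⇒≱ (s≤s (≤-reflexive eq)))
  from-factors (r ∷ ps) (pr ∷ _) eq = r , pr , subst (r ∣_) (sym eq) (m∣m*n (product ps))

prime-divisors : ∀ k → 1 ≤ k → ω k ≤ 2 → ∃[ a ] ∃[ b ] Prime a × Prime b × (∀ r → Prime r → r ∣ k → r ≡ a ⊎ r ≡ b)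
prime-divisors k 1≤k ω≤2 = from-list D ω≤2 (λ p∈ → proj₁ (proj₂ (∈-filter⁻ P? {xs = upTo (suc k)} p∈)))
  λ r pr r∣k → ∈-filter⁺ P? (∈-upTo⁺ (s≤s (∣⇒≤ {{>-nonZero 1≤k}} r∣k))) (pr , r∣k)
  where
  P? : ∀ p → Dec (Prime p × p ∣ k)
  P? p = prime? p ×-dec p ∣? k
  D : List ℕ
  D = filter P? (upTo (suc k))
  from-list : ∀ D → length D ≤ 2 → (∀ {p} → p ∈ D → Prime p) → (∀ r → Prime r → r ∣ k → r ∈ D) →
              ∃[ a ] ∃[ b ] Prime a × Prime b × (∀ r → Prime r → r ∣ k → r ≡ a ⊎ r ≡ b)
  -- This is `k` = 1: there is nothing to avoid, and any two primes serve. A single prime divisor is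
  -- taken twice below.
  from-list [] _ _ all = 2 , 2 , prime[2] , prime[2] , λ r pr r∣k → contradiction (all r pr r∣k) λ ()
  from-list (a ∷ []) _ prm all = a , a , prm (here refl) , prm (here refl) , λ r pr r∣k → at r (all r pr r∣k)
    where
    at : ∀ r → r ∈ (a ∷ []) → r ≡ a ⊎ r ≡ a
    at r (here eq) = inj₁ eq
  from-list (a ∷ b ∷ []) _ prm all = a , b , prm (here refl) , prm (there (here refl)) , λ r pr r∣k → at r (all r pr r∣k)
    where
    at : ∀ r → r ∈ (a ∷ b ∷ []) → r ≡ a ⊎ r ≡ b
    at r (here eq) = inj₁ eq
    at r (there (here eq)) = inj₂ eq
  from-list (_ ∷ _ ∷ _ ∷ _) (s≤s (s≤s ()))

-- The hypothesis `2 ∣ k → 2 ∣ n` unites the two parts of the theorem: for odd `k` it is vacuous,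
-- for even `k` it is the evenness of `n`.
isPrimePlus : ∀ k n → 1 < k → ω k ≤ 2 → 36 ≤ n → (2 ∣ k → 2 ∣ n) → IsPrimePlus𝕊[ k ] n
isPrimePlus k n 1<k ω≤2 36≤n even = from-divisors (prime-divisors k (<⇒≤ 1<k) ω≤2)
  where
  from-divisors : (∃[ a ] ∃[ b ] Prime a × Prime b × (∀ r → Prime r → r ∣ k → r ≡ a ⊎ r ≡ b)) → IsPrimePlus𝕊[ k ] n
  from-divisors (a , b , pa , pb , ⊆ab) = from-representation (represents n 36≤n a b pa pb)
    where
    from-representation : ∃ (Represents n a b) → IsPrimePlus𝕊[ k ] n
    from-representation (p , p<n , pp , r²∤ , r∤) = p , n ∸ p , pp , p<n , ((0<η , λ {d} → square-free d) , coprime) , sym (m+[n∸m]≡n (<⇒≤ p<n))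
      where
      0<η : 0 < n ∸ p
      0<η = m<n⇒0<n∸m p<n
      square-free : ∀ d → d * d ∣ n ∸ p → d ≡ 1
      square-free zero 0∣ = contradiction (0∣⇒≡0 0∣) (>⇒≢ 0<η)
      square-free (suc zero) _ = refl
      square-free d@(suc (suc _)) d²∣ with primeDivisor d (s≤s (s≤s z≤n))
      ... | r , pr , r∣d = contradiction (∣-trans (*-pres-∣ r∣d r∣d) d²∣) (r²∤ r pr)
      coprime : gcd (n ∸ p) k ≡ 1
      coprime = by-gcd (gcd (n ∸ p) k) (gcd[m,n]∣m (n ∸ p) k) (gcd[m,n]∣n (n ∸ p) k)
        where
        by-gcd : ∀ g → g ∣ n ∸ p → g ∣ k → g ≡ 1
        by-gcd zero 0∣ _ = contradiction (0∣⇒≡0 0∣) (>⇒≢ 0<η)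
        by-gcd (suc zero) _ _ = refl
        by-gcd g@(suc (suc _)) g∣η g∣k with primeDivisor g (s≤s (s≤s z≤n))
        ... | r , pr , r∣g = contradiction (∣-trans r∣g g∣η) (r∤ r pr (⊆ab r pr (∣-trans r∣g g∣k)) λ { refl → even (∣-trans r∣g g∣k) })

theorem1p1 : ∀ (k : ℕ) → 1 < k → ω k ≤ 2 →
    (¬ (2 ∣ k) → ∀ (n : ℕ) → 36 ≤ n → IsPrimePlus𝕊[ k ] n)
    × (2 ∣ k → ∀ (n : ℕ) → 2 ∣ n → 36 ≤ n → IsPrimePlus𝕊[ k ] n)
theorem1p1 k 1<k ω≤2 =
  (λ 2∤k n 36≤n → isPrimePlus k n 1<k ω≤2 36≤n λ 2∣k → contradiction 2∣k 2∤k) ,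
  (λ _ n 2∣n 36≤n → isPrimePlus k n 1<k ω≤2 36≤n λ _ → 2∣n)
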